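{- Let $G$ be a nice graph on at least $3$ vertices. Then $\mathrm{mind}(G) \leq \partial_2(G)$, and hence $\mathrm{ch}_\Sigma^e(G) \leq \partial_2(G) + 1$.
   Context: All graphs are finite, simple and loopless. A graph is nice if it has no connected component isomorphic to $K_2$. Monomial index. For a polynomial $P \in \mathbb{R}[x_1,\ldots,x_m]$ and a monomial $M$ occurring in $P$ with nonzero coefficient (after full expansion), let $h(M)$ be the largest exponent of any variable in $M$. The monomial index $\mathrm{mind}(P)$ is the minimum of $h(M)$ over all monomials $M$ of $P$ with nonzero coefficient (with $\mathrm{mind}(0)=\infty$). For a graph $G$ with edges $e_1,\ldots,e_m$, associate the variable $x_i$ with $e_i$, and for each vertex $v$ put $X_v = \sum_{e_i \ni v} x_i$. For an orientation $D$ of $G$ let $P_D(x_1,\ldots,x_m) = \prod_{(u,v)\in E(D)} (X_v - X_u)$. Define $\mathrm{mind}(G) = \mathrm{mind}(P_D)$; this does not depend on the orientation $D$, since changing $D$ changes $P_D$ only by a sign. Edge weight choosability number. $\mathrm{ch}_\Sigma^e(G)$ is the smallest positive integer $k$ such that for every assignment of a list $L_e$ of $k$ real numbers to each edge $e$ of $G$ there is a choice of weights $w(e)\in L_e$ ($e \in E(G)$) for which $v \mapsto \sum_{e\ni v} w(e)$ is a proper colouring of $V(G)$ (adjacent vertices get different sums). 2-degeneracy. For a graph $H$ having two vertices at distance exactly $2$ in $H$, let $\delta_2(H)$ be the minimum of $d_H(u)+d_H(v)$ over all pairs $u,v\in V(H)$ at distance exactly $2$ in $H$. Then $\partial_2(G)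 = \max \delta_2(H)$, the maximum taken over all induced subgraphs $H$ of $G$ that have two vertices at distance exactly $2$. If no induced subgraph of $G$ has two vertices at distance exactly $2$, then by convention $\partial_2(G) = 2\Delta(G)$, where $\Delta(G)$ is the maximum degree of $G$. -}

module Defs where

open import Algebra.Apartness.Bundles using (HeytingField; module HeytingCommutativeRing)
open import Algebra.Bundles using (CommutativeRing)
import Algebra.Definitions.RawMonoid as RawMonoidDefs
open import Data.Bool.Base using (Bool; true; false; T; _∧_; if_then_else_)
open import Data.Bool.Properties using (T?)
open import Data.Fin.Base as Fin using (Fin)
import Data.Fin.Properties as Finₚ
open import Data.Fin.Subset using (Subset; _∈_; Nonempty; ∣_∣)
open import Data.List.Base as List
  using (List; []; _∷_; _++_; map; filter; foldr; allFin; cartesianProduct; cartesianProductWith; mapMaybe; length)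
open import Data.Maybe.Base using (Maybe; just; nothing; fromMaybe)
open import Data.Nat.Base as ℕ using (ℕ; zero; suc; _≤_; _⊔_; _⊓_)
open import Data.Nat.Induction using (<-rec)
import Data.Nat.Properties as ℕₚ
open import Data.Product.Base using (Σ; ∃; ∃-syntax; _×_; _,_; proj₁; proj₂; swap; map₁)
open import Data.Sum.Base using (_⊎_)
open import Data.Vec.Base as Vec using (Vec; []; _∷_)
import Data.Vec.Properties as Vecₚ
open import Function.Bundles using (_⇔_; mk⇔)
open import Function.Definitions using (Injective)
open import Level using () renaming (_⊔_ to _⊔ˡ_; suc to lsuc)
open import Relation.Binary.Core using (Rel)
open import Relation.Binary.PropositionalEquality using (_≡_; _≢_)
open import Relation.Binary.Structures using (IsStrictPartialOrder)
open import Relation.Nullary.Decidable using (Dec; does; ¬?; _×-dec_; _⊎-dec_)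
open import Relation.Nullary.Negation using (¬_)

------------------------------------------------------------------------
-- Real numbers: Archimedean, Cauchy complete ordered fields.
--
-- The library has no type of reals, so they are given by the axioms that
-- determine them up to isomorphism.  "Different" is the apartness _#_ ,
-- which by tightness and #⇔< is the classical x ≉ y under excluded middle.

record RealNumbers c ℓ₁ ℓ₂ ℓ₃ : Set (lsuc (c ⊔ˡ ℓ₁ ⊔ˡ ℓ₂ ⊔ˡ ℓ₃)) where
  infix 4 _<_
  field
    heytingField : HeytingField c ℓ₁ ℓ₂

  open HeytingField heytingField public

  commutativeRing : CommutativeRing c ℓ₁
  commutativeRing = HeytingCommutativeRing.commutativeRing heytingCommutativeRing

  open RawMonoidDefs (CommutativeRing.+-rawMonoid commutativeRing) using () renaming (_×_ to _·_)

  field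
    _<_                  : Rel Carrier ℓ₃
    isStrictPartialOrder : IsStrictPartialOrder _≈_ _<_
    #⇔<                  : ∀ {x y} → x # y ⇔ (x < y ⊎ y < x)
    +-mono-<             : ∀ {x y} z → x < y → x + z < y + z
    *-pos                : ∀ {x y} → 0# < x → 0# < y → 0# < x * y
    archimedean          : ∀ x → ∃[ k ] x < k · 1#

  IsCauchy : (ℕ → Carrier) → Set (c ⊔ˡ ℓ₃)
  IsCauchy s = ∀ ε → 0# < ε → ∃[ N ] (∀ i j → N ≤ i → N ≤ j → s i < s j + ε)

  ConvergesTo : (ℕ → Carrier) → Carrier → Set (c ⊔ˡ ℓ₃)
  ConvergesTo s x =
    ∀ ε → 0# < ε → ∃[ N ] (∀ i → N ≤ i → (s i < x + ε) × (x < s i + ε))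

  field
    complete : ∀ s → IsCauchy s → ∃[ x ] ConvergesTo s x

------------------------------------------------------------------------
-- Finite simple graphs

record Graph (n : ℕ) : Set where
  field
    adj    : Fin n → Fin n → Bool
    sym    : ∀ {u v} → T (adj u v) → T (adj v u)
    irrefl : ∀ {v} → ¬ T (adj v v)

  Adj : Fin n → Fin n → Set
  Adj u v = T (adj u v)

  degree : Fin n → ℕ
  degree v = ∣ Vec.tabulate (adj v) ∣

  maxDegree : ℕ
  maxDegree = foldr _⊔_ 0 (map degree (allFin n))

  -- Walks of a given length.
  Walk : ℕ → Fin n → Fin n → Set
  Walk zero    u v = u ≡ v
  Walk (suc k) u v = ∃[ w ] (Adj u w × Walk k w v)

  Connected : Fin n → Fin n → Set
  Connected u v = ∃[ k ] Walk k u v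

  IsDistance : Fin n → Fin n → ℕ → Set
  IsDistance u v k = Walk k u v × (∀ {j} → j ℕ.< k → ¬ Walk j u v)

  walk? : ∀ k u v → Dec (Walk k u v)
  walk? zero    u v = u Finₚ.≟ v
  walk? (suc k) u v = Finₚ.any? λ w → T? (adj u w) ×-dec walk? k w v

  isDistance? : ∀ u v k → Dec (IsDistance u v k)
  isDistance? u v k =
    walk? k u v ×-dec ℕₚ.allUpTo? (λ j → ¬? (walk? j u v)) k

  -- Each edge is listed once, as the pair (u , v) with u < v.
  edgeList : List (Fin n × Fin n)
  edgeList = filter (λ (u , v) → (u Finₚ.<? v) ×-dec T? (adj u v))
                    (cartesianProduct (allFin n) (allFin n))

  size : ℕ
  size = length edgeList

  Edge : Set
  Edge = Fin size

  ends : Edge → Fin n × Fin n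
  ends = List.lookup edgeList

  incidentEdges : Fin n → List Edge
  incidentEdges v =
    filter (λ e → (proj₁ (ends e) Finₚ.≟ v) ⊎-dec (proj₂ (ends e) Finₚ.≟ v))
           (allFin size)

  -- The Boolean says whether the edge {u < v} is directed from u to v.
  Orientation : Set
  Orientation = Edge → Bool

  arc : Orientation → Edge → Fin n × Fin n
  arc D e = if D e then ends e else swap (ends e)

  IsComponent : Subset n → Set
  IsComponent C = Nonempty C × (∀ {u} → u ∈ C → ∀ v → (v ∈ C ⇔ Connected u v))

  -- f is an isomorphism from K₂, with vertex set Fin 2, onto the subgraph
  -- induced by C.
  IsK₂ : Subset n → Set
  IsK₂ C = Σ (Fin 2 → Fin n) λ f →
      Injective _≡_ _≡_ f
    × (∀ v → (v ∈ C ⇔ (∃[ i ] f i ≡ v)))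
    × (∀ i j → (Adj (f i) (f j) ⇔ i ≢ j))

  Nice : Set
  Nice = ¬ (∃[ C ] (IsComponent C × IsK₂ C))

open Graph public using (Nice)

------------------------------------------------------------------------
-- 2-degeneracy

minimum : List ℕ → Maybe ℕ
minimum []       = nothing
minimum (x ∷ xs) = just (foldr _⊓_ x xs)

maximum : List ℕ → Maybe ℕ
maximum []       = nothing
maximum (x ∷ xs) = just (foldr _⊔_ x xs)

subsets : ∀ n → List (Subset n)
subsets zero    = [] ∷ []
subsets (suc n) = map (true ∷_) (subsets n) ++ map (false ∷_) (subsets n)

-- The subgraph induced by S, kept on the vertex type Fin n.  The vertices
-- outside S become isolated, hence are at distance 2 from no vertex, and
-- contribute nothing to the degrees of the vertices in S.
induced : ∀ {n} → Graph n → Subset n → Graph n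
induced {n} G S = record { adj = adjS ; sym = symS ; irrefl = irreflS }
  where
  open Graph G
  adjS : Fin n → Fin n → Bool
  adjS u v = Vec.lookup S u ∧ (Vec.lookup S v ∧ adj u v)
  symS : ∀ {u v} → T (adjS u v) → T (adjS v u)
  symS {u} {v} p with Vec.lookup S u | Vec.lookup S v
  ... | true | true = sym p
  irreflS : ∀ {v} → ¬ T (adjS v v)
  irreflS {v} p with Vec.lookup S v
  ... | true = irrefl p

-- nothing when no two vertices are at distance 2.
δ₂ : ∀ {n} → Graph n → Maybe ℕ
δ₂ {n} H = minimum (map (λ (u , v) → degree u ℕ.+ degree v) distance2Pairs)
  where
  open Graph H
  distance2Pairs : List (Fin n × Fin n)
  distance2Pairs = filter (λ (u , v) → isDistance? u v 2)
                          (cartesianProduct (allFin n) (allFin n))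

∂₂ : ∀ {n} → Graph n → ℕ
∂₂ {n} G = fromMaybe (2 ℕ.* Graph.maxDegree G)
                     (maximum (mapMaybe (λ S → δ₂ (induced G S)) (subsets n)))

------------------------------------------------------------------------
-- Monomial index and edge weight choosability

module _ {c ℓ₁ ℓ₂ ℓ₃} (ℝ : RealNumbers c ℓ₁ ℓ₂ ℓ₃) where
  open RealNumbers ℝ

  -- Formal sums of terms (coefficient , exponent vector), in which an
  -- exponent vector may be repeated; `coefficient` collects like terms.
  Polynomial : ℕ → Set c
  Polynomial m = List (Carrier × Vec ℕ m)

  coefficient : ∀ {m} → Polynomial m → Vec ℕ m → Carrier
  coefficient []            α = 0#
  coefficient ((a , β) ∷ p) α =
    if does (Vecₚ.≡-dec ℕₚ._≟_ β α) then a + coefficient p α else coefficient p α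

  module _ {m : ℕ} where
    infixl 7 _*ᵖ_
    infixl 6 _+ᵖ_ _-ᵖ_

    0ᵖ 1ᵖ : Polynomial m
    0ᵖ = []
    1ᵖ = (1# , Vec.replicate m 0) ∷ []

    var : Fin m → Polynomial m
    var i = (1# , Vec.replicate m 0 Vec.[ i ]≔ 1) ∷ []

    _+ᵖ_ _-ᵖ_ _*ᵖ_ : Polynomial m → Polynomial m → Polynomial m
    p +ᵖ q = p ++ q
    p -ᵖ q = p ++ map (map₁ (λ a → - a)) q
    _*ᵖ_ = cartesianProductWith λ (a , α) (b , β) → a * b , Vec.zipWith ℕ._+_ α β

    largestExponent : Vec ℕ m → ℕ
    largestExponent = Vec.foldr _ _⊔_ 0

    -- mind(p) = k.  As mind(0) = ∞, no k qualifies for the zero polynomial.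
    IsMonomialIndex : Polynomial m → ℕ → Set ℓ₂
    IsMonomialIndex p k =
        (∃[ α ] (coefficient p α # 0# × largestExponent α ≡ k))
      × (∀ α → coefficient p α # 0# → k ≤ largestExponent α)

  module _ {n : ℕ} (G : Graph n) where
    open Graph G

    vertexSum : Fin n → Polynomial size
    vertexSum v = foldr _+ᵖ_ 0ᵖ (map var (incidentEdges v))

    graphPolynomial : Orientation → Polynomial size
    graphPolynomial D = foldr _*ᵖ_ 1ᵖ (map factor (allFin size))
      where
      factor : Edge → Polynomial size
      factor e = let (u , v) = arc D e in vertexSum v -ᵖ vertexSum u

    -- mind(G) = k, including the independence of the orientation.
    IsMind : ℕ → Set ℓ₂
    IsMind k = ∀ D → IsMonomialIndex (graphPolynomial D) k

    -- The lists consist of k distinct reals.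
    Choosable : ℕ → Set (c ⊔ˡ ℓ₂)
    Choosable k =
      (L : Edge → Fin k → Carrier) →
      (∀ e {i j} → i ≢ j → L e i # L e j) →
      Σ (Edge → Fin k) λ choice →
        let weightSum v = foldr _+_ 0# (map (λ e → L e (choice e)) (incidentEdges v))
        in ∀ {u v} → Adj u v → weightSum u # weightSum v

    IsCh : ℕ → Set (c ⊔ˡ ℓ₂)
    IsCh k = 1 ≤ k × Choosable k × (∀ j → 1 ≤ j → Choosable j → k ≤ j)

    -- ch(G) ≤ b: the least positive k with Choosable k is at most b.  A
    -- constructive witness of leastness is not asked for; the two lemmas
    -- below relate this to IsCh.
    Ch≤ : ℕ → Set (c ⊔ˡ ℓ₂)
    Ch≤ b = ∃[ k ] (1 ≤ k × k ≤ b × Choosable k)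

    IsCh⇒Ch≤⇔≤ : ∀ {k b} → IsCh k → (Ch≤ b ⇔ k ≤ b)
    IsCh⇒Ch≤⇔≤ {k} (1≤k , ck , least) = mk⇔
      (λ (j , 1≤j , j≤b , cj) → ℕₚ.≤-trans (least j 1≤j cj) j≤b)
      (λ k≤b → k , 1≤k , k≤b , ck)

    Ch≤⇒¬¬IsCh : ∀ {b} → Ch≤ b → ¬ ¬ (∃[ k ] (IsCh k × k ≤ b))
    Ch≤⇒¬¬IsCh {b} (k , 1≤k , k≤b , ck) none = noneChoosable k 1≤k k≤b ck
      where
      noneChoosable : ∀ k → 1 ≤ k → k ≤ b → ¬ Choosable k
      noneChoosable = <-rec _ λ k smaller 1≤k k≤b ck →
        none (k , (1≤k , ck , λ j 1≤j cj → ℕₚ.≮⇒≥ λ j<k →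
          smaller j<k 1≤j (ℕₚ.≤-trans (ℕₚ.<⇒≤ j<k) k≤b) cj) , k≤b)

{-# OPTIONS --safe #-}
-- Idea.  The coefficient of Π x_e^(α e) in P_D, times Π (α e)!, is the
-- permanent of the matrix in which the column of e is repeated α e times.
-- Hence mind(G) ≤ k follows from a nonzero permanent in which every column is
-- repeated at most k times, and a permanent may be evaluated at differences of
-- columns: by multilinearity it is then nonzero for some choice of the terms.
--
-- If w is a common neighbour of u and v, then the column of uw minus that of
-- vw vanishes outside the rows of the edges at u or v, and does not depend on
-- w.  So u and v can be removed, if these rows are handled with such columns.
-- When u and v are at distance 2 and d(u) + d(v) is minimal, the difference
-- for one w is repeated d(u) + d(v) ≤ ∂₂(G) times.  When no two vertices are
-- at distance 2, the graph consists of cliques; u and v are then adjacent, and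
-- the difference is used for all their common neighbours w, at most twice for
-- each, together with two copies of the column of uv.  Edges that become
-- components K₂ on removing u and v have zero columns of their own; they are
-- matched with edges connecting them to u or v.
--
-- The permanents are integers, so that being nonzero is decidable; only the
-- transfer to P_D and the Combinatorial Nullstellensatz take place in ℝ.

module Submission where

-- How the multiplicities fit. Let u and v lie in a clique with t common neighbours. The 2t + 1
-- edges at u or v need as many columns, but t differences used twice supply only 2t; hence the
-- column of uv. It agrees with the difference on the edges at u, is its negative on the edges at v,
-- and is 0 in its own row. With one copy of it the permanent is a multiple of t - t = 0; with two
-- copies the corresponding factor is 0 - 2t. So two copies are taken, and one of the differences is
-- used only once. This slack is spent at the vertex w through which a new component K₂ is connected
-- to u or v: the connecting edge may coincide with a column chosen from the difference for w.
--
-- When u and v are at distance 2, the single difference may exhaust the bound, and a connecting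
-- edge equal to uw or vw would exceed it. This can happen only for a new component K₂ containing w,
-- of which there is at most one. Its edge is matched with uw, and the excess is avoided because the
-- column of uw is 0 in its own row, so that the columns chosen from the differences cannot all be
-- uw.

-- Integer permanents: row expansion, block triangular matrices, multilinearity

module Permanents where

  open import Data.Integer.Base using (ℤ; +_; 0ℤ; 1ℤ; _+_; _-_; _*_; -_)
  import Data.Integer.Properties as ℤₚ
  open import Data.Integer.Tactic.RingSolver using (solve-∀)
  open import Data.List.Base using (List; []; _∷_; _++_; map; length; replicate; foldr)
  open import Data.List.Properties using (++-assoc)
  open import Data.List.Relation.Binary.Permutation.Propositional as Perm using (_↭_; prep; swap)
  open import Data.List.Relation.Binary.Pointwise.Base using (Pointwise; []; _∷_)
  open import Data.List.Relation.Unary.All as All using (All; []; _∷_)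
  import Data.List.Relation.Unary.All.Properties as Allₚ
  open import Data.List.Membership.Propositional using (_∈_)
  open import Data.List.Membership.Propositional.Properties using (∈-∃++)
  open import Data.List.Relation.Binary.Permutation.Propositional.Properties using (shift)
  open import Data.List.Relation.Unary.AllPairs as AllPairs using (AllPairs; []; _∷_)
  open import Data.Nat.Base as ℕ using (ℕ; zero; suc; _!)
  import Data.Nat.Properties as ℕₚ
  open import Data.Product.Base using (∃-syntax; _×_; _,_; proj₁; proj₂)
  open import Data.Sum.Base using (_⊎_; inj₁; inj₂)
  open import Function.Base using (_∘_)
  open import Relation.Binary.PropositionalEquality
  open import Relation.Nullary.Decidable using (yes; no)
  open import Relation.Nullary.Negation using (contradiction)

  i*j≢0 : ∀ {i j} → i ≢ 0ℤ → j ≢ 0ℤ → i * j ≢ 0ℤ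
  i*j≢0 {i} i≢0 j≢0 ij≡0 with ℤₚ.i*j≡0⇒i≡0∨j≡0 i ij≡0
  ... | inj₁ i≡0 = i≢0 i≡0
  ... | inj₂ j≡0 = j≢0 j≡0

  module _ {A : Set} where

    Column : Set
    Column = A → ℤ

    -- The continuation `k` receives the columns left over, in their order, once `c` has been taken
    -- for the row `r`. Expansion along one row is thereby separated from the use of the minor, and
    -- can be iterated over several rows.
    expand : A → List Column → (List Column → ℤ) → ℤ
    expand r []       k = 0ℤ
    expand r (c ∷ cs) k = c r * k cs + expand r cs (k ∘ (c ∷_))

    -- The permanent of the matrix with the given rows and columns, by Laplace
    -- expansion along the rows; it is 0 when the matrix is not square.
    per : List A → List Column → ℤ
    per []       []      = 1ℤ
    per []       (_ ∷ _) = 0ℤ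
    per (r ∷ rs) cs      = expand r cs (per rs)

    expand-cong-length : ∀ r cs {f g} → (∀ es → suc (length es) ≡ length cs → f es ≡ g es) →
                         expand r cs f ≡ expand r cs g
    expand-cong-length r []       f≗g = refl
    expand-cong-length r (c ∷ cs) f≗g = cong₂ _+_ (cong (c r *_) (f≗g cs refl))
      (expand-cong-length r cs (λ es eq → f≗g (c ∷ es) (cong suc eq)))

    expand-cong : ∀ r cs {f g} → (∀ es → f es ≡ g es) → expand r cs f ≡ expand r cs g
    expand-cong r cs f≗g = expand-cong-length r cs (λ es _ → f≗g es)

    expand-+ : ∀ r cs f g → expand r cs (λ es → f es + g es) ≡ expand r cs f + expand r cs g
    expand-+ r []       f g = refl
    expand-+ r (c ∷ cs) f g = trans
      (cong (_+_ (c r * (f cs + g cs))) (expand-+ r cs (f ∘ (c ∷_)) (g ∘ (c ∷_))))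
      (lemma (c r) (f cs) (g cs) _ _)
      where
      lemma : ∀ x y z u v → x * (y + z) + (u + v) ≡ (x * y + u) + (x * z + v)
      lemma = solve-∀

    expand-* : ∀ r cs x f → expand r cs (λ es → x * f es) ≡ x * expand r cs f
    expand-* r []       x f = sym (ℤₚ.*-zeroʳ x)
    expand-* r (c ∷ cs) x f = trans
      (cong (_+_ (c r * (x * f cs))) (expand-* r cs x (f ∘ (c ∷_))))
      (lemma (c r) x (f cs) _)
      where
      lemma : ∀ a x y u → a * (x * y) + x * u ≡ x * (a * y + u)
      lemma = solve-∀

    -- The head column is taken by `r`, by `s` or by neither row; exchanging the rows swaps the
    -- first two groups of terms. This is the symmetry of the permanent in its rows.
    expand-comm : ∀ r s cs k →
      expand r cs (λ es → expand s es k) ≡ expand s cs (λ es → expand r es k)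
    expand-comm r s []       k = refl
    expand-comm r s (c ∷ cs) k = begin
      c r * expand s cs k + expand r cs (λ es → c s * k es + expand s es (k ∘ (c ∷_)))
        ≡⟨ cong (_+_ (c r * expand s cs k)) (half r s) ⟩
      c r * expand s cs k + (c s * expand r cs k + expand r cs (λ es → expand s es (k ∘ (c ∷_))))
        ≡⟨ cong (λ z → c r * expand s cs k + (c s * expand r cs k + z)) (expand-comm r s cs _) ⟩
      c r * expand s cs k + (c s * expand r cs k + expand s cs (λ es → expand r es (k ∘ (c ∷_))))
        ≡⟨ lemma (c r * expand s cs k) (c s * expand r cs k) _ ⟩
      c s * expand r cs k + (c r * expand s cs k + expand s cs (λ es → expand r es (k ∘ (c ∷_))))
        ≡⟨ cong (_+_ (c s * expand r cs k)) (sym (half s r)) ⟩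
      c s * expand r cs k + expand s cs (λ es → c r * k es + expand r es (k ∘ (c ∷_))) ∎
      where
      open ≡-Reasoning
      lemma : ∀ x y z → x + (y + z) ≡ y + (x + z)
      lemma = solve-∀
      half : ∀ r s → expand r cs (λ es → c s * k es + expand s es (k ∘ (c ∷_))) ≡
                     c s * expand r cs k + expand r cs (λ es → expand s es (k ∘ (c ∷_)))
      half r s = trans (expand-+ r cs _ _) (cong (_+ expand r cs (λ es → expand s es (k ∘ (c ∷_)))) (expand-* r cs (c s) k))

    per-↭ : ∀ {rs ss} → rs ↭ ss → ∀ cs → per rs cs ≡ per ss cs
    per-↭ Perm.refl         cs = refl
    per-↭ (prep r p)   cs = expand-cong r cs (per-↭ p)
    per-↭ (swap r s p) cs = trans (expand-comm r s cs _)
      (expand-cong s cs (λ es → expand-cong r es (per-↭ p)))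
    per-↭ (Perm.trans p q)  cs = trans (per-↭ p cs) (per-↭ q cs)

    AgreeOn : List A → Column → Column → Set
    AgreeOn rs c d = All (λ r → c r ≡ d r) rs

    per-cong : ∀ rs {cs ds} → Pointwise (AgreeOn rs) cs ds → per rs cs ≡ per rs ds
    per-cong []       []      = refl
    per-cong []       (_ ∷ _) = refl
    per-cong (r ∷ rs) cs≈ds   = go cs≈ds (per-cong rs)
      where
      go : ∀ {cs ds f g} → Pointwise (AgreeOn (r ∷ rs)) cs ds →
           (∀ {es fs} → Pointwise (AgreeOn rs) es fs → f es ≡ g fs) →
           expand r cs f ≡ expand r ds g
      go []                        f≗g = refl
      go ((c≈d ∷ c≈ds) ∷ cs≈ds) f≗g = cong₂ _+_
        (cong₂ _*_ c≈d (f≗g (tails cs≈ds)))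
        (go cs≈ds (λ es≈fs → f≗g (c≈ds ∷ es≈fs)))
        where
        tails : ∀ {cs ds} → Pointwise (AgreeOn (r ∷ rs)) cs ds → Pointwise (AgreeOn rs) cs ds
        tails []                 = []
        tails ((_ ∷ eqs) ∷ rest) = eqs ∷ tails rest

    VanishesOn : List A → Column → Set
    VanishesOn rs c = All (λ r → c r ≡ 0ℤ) rs

    expand-vanish : ∀ r {cs} → All (λ c → c r ≡ 0ℤ) cs → ∀ k → expand r cs k ≡ 0ℤ
    expand-vanish r []            k = refl
    expand-vanish r (c≡0 ∷ cs≡0) k = cong₂ _+_ (cong (_* _) c≡0) (expand-vanish r cs≡0 _)

    per-zeroRow : ∀ {r rs cs} → r ∈ rs → All (λ c → c r ≡ 0ℤ) cs → per rs cs ≡ 0ℤ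
    per-zeroRow {r} {rs} {cs} r∈rs cs≡0 with ∈-∃++ r∈rs
    ... | ys , zs , refl = trans (per-↭ (shift r ys zs) cs) (expand-vanish r cs≡0 _)

    -- The rows `rs` must draw their columns from `cs`, because `ds` vanishes on them, and being
    -- equally many they exhaust `cs`. The entries of `cs` in the rows `ss` are arbitrary: the
    -- matrix is only block triangular.
    per-block : ∀ rs ss {cs ds} → length rs ≡ length cs → All (VanishesOn rs) ds →
                per (rs ++ ss) (cs ++ ds) ≡ per rs cs * per ss ds
    per-block []       ss {[]}         eq ds≡0 = sym (ℤₚ.*-identityˡ _)
    per-block (r ∷ rs) ss {cs} {ds} eq ds≡0 = begin
      expand r (cs ++ ds) (per (rs ++ ss))
        ≡⟨ split cs (All.map All.head ds≡0) _ ⟩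
      expand r cs (λ es → per (rs ++ ss) (es ++ ds))
        ≡⟨ expand-cong-length r cs (λ es eq′ →
             trans (per-block rs ss (ℕsuc (trans eq (sym eq′))) (All.map All.tail ds≡0))
                   (ℤₚ.*-comm (per rs es) (per ss ds))) ⟩
      expand r cs (λ es → per ss ds * per rs es)
        ≡⟨ expand-* r cs (per ss ds) (per rs) ⟩
      per ss ds * expand r cs (per rs)
        ≡⟨ ℤₚ.*-comm (per ss ds) _ ⟩
      expand r cs (per rs) * per ss ds ∎
      where
      open ≡-Reasoning
      ℕsuc : ∀ {m n} → suc m ≡ suc n → m ≡ n
      ℕsuc refl = refl
      split : ∀ cs {ds} → All (λ c → c r ≡ 0ℤ) ds → ∀ k →
              expand r (cs ++ ds) k ≡ expand r cs (λ es → k (es ++ ds))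
      split []       ds≡0 k = expand-vanish r ds≡0 k
      split (c ∷ cs) ds≡0 k = cong (_+_ (c r * k (cs ++ _))) (split cs ds≡0 _)

    per-block≢0 : ∀ rs ss {cs ds} → length rs ≡ length cs → All (VanishesOn rs) ds →
                  per rs cs ≢ 0ℤ → per ss ds ≢ 0ℤ → per (rs ++ ss) (cs ++ ds) ≢ 0ℤ
    per-block≢0 rs ss eq ds≡0 p≢0 q≢0 eq′ = i*j≢0 p≢0 q≢0 (trans (sym (per-block rs ss eq ds≡0)) eq′)

    -- Lets the squareness of a block be recovered from its nonzero permanent instead of being
    -- carried through the induction.
    per≢0⇒length≡ : ∀ rs cs → per rs cs ≢ 0ℤ → length rs ≡ length cs
    per≢0⇒length≡ []       []       p≢0 = refl
    per≢0⇒length≡ []       (c ∷ cs) p≢0 = contradiction refl p≢0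
    per≢0⇒length≡ (r ∷ rs) cs       p≢0 with length cs ℕₚ.≟ suc (length rs)
    ... | yes eq = sym eq
    ... | no neq = contradiction (trans (expand-cong-length r cs zeros) (expand-0 cs)) p≢0
      where
      expand-0 : ∀ cs → expand r cs (λ _ → 0ℤ) ≡ 0ℤ
      expand-0 []       = refl
      expand-0 (c ∷ cs) = cong₂ _+_ (ℤₚ.*-zeroʳ (c r)) (expand-0 cs)
      zeros : ∀ es → suc (length es) ≡ length cs → per rs es ≡ 0ℤ
      zeros es eq with per rs es ℤₚ.≟ 0ℤ
      ... | yes z = z
      ... | no nz = contradiction (trans (sym eq) (cong suc (sym (per≢0⇒length≡ rs es nz)))) neq

    -- The matrix is triangular, so the first row splits off as a block of size 1.
    per-diagonal≢0 : ∀ (f : A → Column) rs → All (λ r → f r r ≢ 0ℤ) rs →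
                     AllPairs (λ r s → f s r ≡ 0ℤ) rs → per rs (map f rs) ≢ 0ℤ
    per-diagonal≢0 f []       []            []            = λ ()
    per-diagonal≢0 f (r ∷ rs) (fr≢0 ∷ rest) (fs≡0 ∷ rest′) =
      per-block≢0 (r ∷ []) rs {f r ∷ []} refl (Allₚ.map⁺ (All.map (_∷ []) fs≡0))
        (λ eq → fr≢0 (trans (lemma (f r r)) eq)) (per-diagonal≢0 f rs rest rest′)
      where
      lemma : ∀ x → x ≡ x * 1ℤ + 0ℤ
      lemma = solve-∀

    -- Linearity in one column, phrased as a relation between lists so that it is inherited by the
    -- minors in which that column remains.
    data Difference : List Column → List Column → List Column → Set where
      here  : ∀ {a b cs} → Difference ((λ r → a r - b r) ∷ cs) (a ∷ cs) (b ∷ cs)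
      there : ∀ {c ds as bs} → Difference ds as bs → Difference (c ∷ ds) (c ∷ as) (c ∷ bs)

    expand-difference : ∀ r {ds as bs} → Difference ds as bs → ∀ {k} →
      (∀ {ds as bs} → Difference ds as bs → k ds ≡ k as - k bs) →
      expand r ds k ≡ expand r as k - expand r bs k
    expand-difference r (here {a} {b} {cs}) {k} k-diff = begin
      (a r - b r) * k cs + expand r cs (k ∘ ((λ r → a r - b r) ∷_))
        ≡⟨ cong (_+_ ((a r - b r) * k cs)) (expand-cong r cs (λ es → trans (k-diff here)
             (cong (_+_ (k (a ∷ es))) (sym (ℤₚ.-1*i≡-i _))))) ⟩
      (a r - b r) * k cs + expand r cs (λ es → k (a ∷ es) + - 1ℤ * k (b ∷ es))
        ≡⟨ cong (_+_ ((a r - b r) * k cs)) (trans (expand-+ r cs _ _)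
             (cong (_+_ (expand r cs (k ∘ (a ∷_)))) (expand-* r cs (- 1ℤ) _))) ⟩
      (a r - b r) * k cs + (expand r cs (k ∘ (a ∷_)) + - 1ℤ * expand r cs (k ∘ (b ∷_)))
        ≡⟨ lemma (a r) (b r) (k cs) _ _ ⟩
      (a r * k cs + expand r cs (k ∘ (a ∷_))) - (b r * k cs + expand r cs (k ∘ (b ∷_))) ∎
      where
      open ≡-Reasoning
      lemma : ∀ a b k x y → (a - b) * k + (x + - 1ℤ * y) ≡ (a * k + x) - (b * k + y)
      lemma = solve-∀
    expand-difference r (there {c} {ds} {as} {bs} d) {k} k-diff = trans
      (cong₂ _+_ (cong (c r *_) (k-diff d)) (expand-difference r d (λ d′ → k-diff (there d′))))
      (lemma (c r) (k as) (k bs) _ _)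
      where
      lemma : ∀ c p q x y → c * (p - q) + (x - y) ≡ (c * p + x) - (c * q + y)
      lemma = solve-∀

    per-difference : ∀ rs {ds as bs} → Difference ds as bs → per rs ds ≡ per rs as - per rs bs
    per-difference []       here      = refl
    per-difference []       (there _) = refl
    per-difference (r ∷ rs) d         = expand-difference r d (per-difference rs)

    -- All `suc j` choices of a column leave the same minor.
    expand-replicate : ∀ r d j k →
      expand r (replicate (suc j) d) k ≡ + suc j * (d r * k (replicate j d))
    expand-replicate r d zero    k = lemma (d r * k [])
      where
      lemma : ∀ x → x + 0ℤ ≡ 1ℤ * x
      lemma = solve-∀
    expand-replicate r d (suc j) k = trans
      (cong (_+_ (d r * k (replicate (suc j) d))) (expand-replicate r d j (k ∘ (d ∷_))))
      (lemma (+ suc j) _)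
      where
      lemma : ∀ n x → x + n * x ≡ (1ℤ + n) * x
      lemma = solve-∀

    per-replicate≢0 : ∀ rs d → All (λ r → d r ≢ 0ℤ) rs → per rs (replicate (length rs) d) ≢ 0ℤ
    per-replicate≢0 []       d []            = λ ()
    per-replicate≢0 (r ∷ rs) d (dr≢0 ∷ d≢0) eq =
      i*j≢0 {+ suc (length rs)} (λ ()) (i*j≢0 dr≢0 (per-replicate≢0 rs d d≢0))
        (trans (sym (expand-replicate r d (length rs) (per rs))) eq)

    -- With c = ε d and ε = ±1, the permanents with zero, one and two columns c
    -- and all others d are multiples of the elementary symmetric functions
    -- e₀ = 1, e₁ and 2 e₂ = e₁² - (number of rows) of the values of ε.
    module TwoColumns (c d ε : A → ℤ) where

      Scaled : A → Set
      Scaled r = c r ≡ ε r * d r × ε r * ε r ≡ 1ℤ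

      Π e₁ : List A → ℤ
      Π  = foldr (λ r x → d r * x) 1ℤ
      e₁ = foldr (λ r x → ε r + x) 0ℤ

      per₀ : ∀ rs {m} → length rs ≡ m → per rs (replicate m d) ≡ + (m !) * Π rs
      per₀ []       refl = refl
      per₀ (r ∷ rs) refl = begin
        expand r (replicate (suc m) d) (per rs)  ≡⟨ expand-replicate r d m (per rs) ⟩
        + suc m * (d r * per rs (replicate m d)) ≡⟨ cong (λ z → + suc m * (d r * z)) (per₀ rs refl) ⟩
        + suc m * (d r * (+ (m !) * Π rs))       ≡⟨ lemma (+ suc m) (d r) (+ (m !)) (Π rs) ⟩
        (+ suc m * + (m !)) * (d r * Π rs)       ≡⟨ cong (_* (d r * Π rs)) (sym (ℤₚ.pos-* (suc m) (m !))) ⟩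
        + (suc m !) * (d r * Π rs) ∎
        where
        m = length rs
        open ≡-Reasoning
        lemma : ∀ s d f p → s * (d * (f * p)) ≡ (s * f) * (d * p)
        lemma = solve-∀

      per₁ : ∀ rs {m} → length rs ≡ suc m → All Scaled rs →
             per rs (c ∷ replicate m d) ≡ + (m !) * Π rs * e₁ rs
      per₁ (r ∷ []) refl ((c≡ , _) ∷ []) rewrite c≡ = lemma (ε r) (d r)
        where
        lemma : ∀ e d → e * d * 1ℤ + 0ℤ ≡ 1ℤ * (d * 1ℤ) * (e + 0ℤ)
        lemma = solve-∀
      per₁ (r ∷ rs@(_ ∷ rs′)) refl ((c≡ , _) ∷ scaled) = begin
        c r * per rs (replicate (suc m) d) + expand r (replicate (suc m) d) (λ es → per rs (c ∷ es))
          ≡⟨ cong₂ _+_ (cong₂ _*_ c≡ (per₀ rs refl))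
               (trans (expand-replicate r d m (λ es → per rs (c ∷ es))) (cong (λ z → + suc m * (d r * z)) (per₁ rs refl scaled))) ⟩
        ε r * d r * (+ (suc m !) * Π rs) + + suc m * (d r * (+ (m !) * Π rs * e₁ rs))
          ≡⟨ cong (λ z → ε r * d r * (z * Π rs) + + suc m * (d r * (+ (m !) * Π rs * e₁ rs))) (ℤₚ.pos-* (suc m) (m !)) ⟩
        ε r * d r * (+ suc m * + (m !) * Π rs) + + suc m * (d r * (+ (m !) * Π rs * e₁ rs))
          ≡⟨ lemma (ε r) (d r) (+ suc m) (+ (m !)) (Π rs) (e₁ rs) ⟩
        + suc m * + (m !) * (d r * Π rs) * (ε r + e₁ rs)
          ≡⟨ cong (λ z → z * (d r * Π rs) * (ε r + e₁ rs)) (sym (ℤₚ.pos-* (suc m) (m !))) ⟩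
        + (suc m !) * (d r * Π rs) * (ε r + e₁ rs) ∎
        where
        m = length rs′
        open ≡-Reasoning
        lemma : ∀ e d s f p t → e * d * (s * f * p) + s * (d * (f * p * t)) ≡ s * f * (d * p) * (e + t)
        lemma = solve-∀

      per₂ : ∀ rs {m} → length rs ≡ suc (suc m) → All Scaled rs →
             per rs (c ∷ c ∷ replicate m d) ≡ + (m !) * Π rs * (e₁ rs * e₁ rs - + suc (suc m))
      per₂ (r ∷ s ∷ []) refl ((c≡ , ε²) ∷ (c≡′ , ε²′) ∷ []) rewrite c≡ | c≡′ = begin
        ε r * d r * (ε s * d s * 1ℤ + 0ℤ) + (ε r * d r * (ε s * d s * 1ℤ + 0ℤ) + 0ℤ)
          ≡⟨ lemma (ε r) (d r) (ε s) (d s) ⟩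
        1ℤ * (d r * (d s * 1ℤ)) * ((ε r + (ε s + 0ℤ)) * (ε r + (ε s + 0ℤ)) - (ε r * ε r + ε s * ε s))
          ≡⟨ cong₂ (λ x y → 1ℤ * (d r * (d s * 1ℤ)) * ((ε r + (ε s + 0ℤ)) * (ε r + (ε s + 0ℤ)) - (x + y))) ε² ε²′ ⟩
        1ℤ * (d r * (d s * 1ℤ)) * ((ε r + (ε s + 0ℤ)) * (ε r + (ε s + 0ℤ)) - + 2) ∎
        where
        open ≡-Reasoning
        lemma : ∀ e d f g → e * d * (f * g * 1ℤ + 0ℤ) + (e * d * (f * g * 1ℤ + 0ℤ) + 0ℤ) ≡
          1ℤ * (d * (g * 1ℤ)) * ((e + (f + 0ℤ)) * (e + (f + 0ℤ)) - (e * e + f * f))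
        lemma = solve-∀
      per₂ (r ∷ rs@(_ ∷ _ ∷ rs′)) refl ((c≡ , ε²) ∷ scaled) = begin
        c r * per rs (c ∷ replicate (suc m) d) +
          (c r * per rs (c ∷ replicate (suc m) d) +
           expand r (replicate (suc m) d) (λ es → per rs (c ∷ c ∷ es)))
          ≡⟨ cong₂ (λ x y → x + (x + y))
               (cong₂ _*_ c≡ (trans (per₁ rs refl scaled) (cong (λ z → z * Π rs * e₁ rs) (ℤₚ.pos-* (suc m) (m !)))))
               (trans (expand-replicate r d m (λ es → per rs (c ∷ c ∷ es))) (cong (λ z → + suc m * (d r * z)) (per₂ rs refl scaled))) ⟩
        ε r * d r * (+ suc m * + (m !) * Π rs * e₁ rs) +
          (ε r * d r * (+ suc m * + (m !) * Π rs * e₁ rs) +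
           + suc m * (d r * (+ (m !) * Π rs * (e₁ rs * e₁ rs - + suc (suc m)))))
          ≡⟨ lemma (ε r) (d r) (+ suc m) (+ (m !)) (Π rs) (e₁ rs) (+ suc (suc m)) ⟩
        + suc m * + (m !) * (d r * Π rs) * ((ε r + e₁ rs) * (ε r + e₁ rs) - (ε r * ε r + + suc (suc m)))
          ≡⟨ cong₂ (λ x y → x * (d r * Π rs) * ((ε r + e₁ rs) * (ε r + e₁ rs) - (y + + suc (suc m))))
               (sym (ℤₚ.pos-* (suc m) (m !))) ε² ⟩
        + (suc m !) * (d r * Π rs) * ((ε r + e₁ rs) * (ε r + e₁ rs) - + suc (suc (suc m))) ∎
        where
        m = length rs′
        open ≡-Reasoning
        lemma : ∀ e d s f p t n →
          e * d * (s * f * p * t) + (e * d * (s * f * p * t) + s * (d * (f * p * (t * t - n)))) ≡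
          s * f * (d * p) * ((e + t) * (e + t) - (e * e + n))
        lemma = solve-∀

      -- With balanced signs the factor e₁² - (m + 2) is the nonzero number -(m + 2), whereas by
      -- `per₁` a single column `c` would give permanent 0.
      per₂≢0 : ∀ rs {m} → length rs ≡ suc (suc m) → All Scaled rs → All (λ r → d r ≢ 0ℤ) rs →
               e₁ rs ≡ 0ℤ → per rs (c ∷ c ∷ replicate m d) ≢ 0ℤ
      per₂≢0 rs {m} eq scaled d≢0 e₁≡0 =
        subst (_≢ 0ℤ) (sym (per₂ rs eq scaled))
          (i*j≢0 (i*j≢0 m!≢0 (Π≢0 d≢0)) λ z≡0 → -n≢0 (trans (sym (cong (λ z → z * z - + suc (suc m)) e₁≡0)) z≡0))
        where
        m!≢0 : + (m !) ≢ 0ℤ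
        m!≢0 eq = ℕ.≢-nonZero⁻¹ (m !) {{m ℕₚ.!≢0}} (ℤₚ.+-injective eq)
        Π≢0 : ∀ {rs} → All (λ r → d r ≢ 0ℤ) rs → Π rs ≢ 0ℤ
        Π≢0 []            = λ ()
        Π≢0 (d≢0 ∷ rest) = i*j≢0 d≢0 (Π≢0 rest)
        -n≢0 : 0ℤ * 0ℤ - + suc (suc m) ≢ 0ℤ
        -n≢0 ()

    module _ {B : Set} (col : B → Column) where

      difference : B × B → Column
      difference (x , y) r = col x r - col y r

      Choice : List B → List (B × B) → Set
      Choice = Pointwise (λ d (x , y) → d ≡ x ⊎ d ≡ y)

      -- If both columns of a pair gave permanent 0, linearity would give 0 for their difference;
      -- decidable equality of integers tells which one to keep. The columns already chosen
      -- accumulate in `cs`.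
      resolve : ∀ rs cs qs → per rs (cs ++ map difference qs) ≢ 0ℤ →
                ∃[ ds ] (Choice ds qs × per rs (cs ++ map col ds) ≢ 0ℤ)
      resolve rs cs []        p≢0 = [] , [] , p≢0
      resolve rs cs (q ∷ qs) p≢0 with pick
        where
        position : ∀ cs {a b es} → Difference (cs ++ (λ r → a r - b r) ∷ es) (cs ++ a ∷ es) (cs ++ b ∷ es)
        position []       = here
        position (_ ∷ cs) = there (position cs)
        pick : ∃[ x ] ((x ≡ proj₁ q ⊎ x ≡ proj₂ q) × per rs (cs ++ col x ∷ map difference qs) ≢ 0ℤ)
        pick with per rs (cs ++ col (proj₁ q) ∷ map difference qs) ℤₚ.≟ 0ℤ
        ... | no  p≢0′ = proj₁ q , inj₁ refl , p≢0′
        ... | yes p≡0  = proj₂ q , inj₂ refl , λ p≡0′ →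
          p≢0 (trans (per-difference rs (position cs)) (cong₂ _-_ p≡0 p≡0′))
      ... | x , x∈q , p≢0′
        with resolve rs (cs ++ col x ∷ []) qs (subst (λ z → per rs z ≢ 0ℤ) (sym (++-assoc cs _ _)) p≢0′)
      ... | ds , choice , p≢0″ = x ∷ ds , x∈q ∷ choice , subst (λ z → per rs z ≢ 0ℤ) (++-assoc cs _ _) p≢0″

-- Permanents as derivatives of products of linear forms

module Coefficients where

  open import Data.Fin.Base using (Fin; zero; suc)
  import Data.Fin.Properties as Finₚ
  open import Data.Integer.Base using (ℤ; +_; 0ℤ; 1ℤ; _+_; _-_; _*_; -_)
  import Data.Integer.Properties as ℤₚ
  open import Data.Integer.Tactic.RingSolver using (solve-∀)
  open import Data.List.Base using (List; []; _∷_; map; foldr; filter; length)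
  open import Data.Nat.Base as ℕ using (ℕ; zero; suc)
  import Data.Nat.Properties as ℕₚ
  open import Data.Product.Base using (_×_; _,_)
  open import Data.Vec.Base as Vec using (Vec; []; _∷_)
  open import Function.Base using (_∘_)
  open import Relation.Binary.PropositionalEquality
  open import Relation.Nullary.Decidable using (yes; no)
  open import Relation.Nullary.Negation using (contradiction)
  open Permanents

  -- Coefficient functions of polynomials in m variables: `shift 0 i q` is xᵢ q.
  shift : ∀ {a} {A : Set a} {m} → A → Fin m → (Vec ℕ m → A) → Vec ℕ m → A
  shift o zero    q (zero  ∷ α) = o
  shift o zero    q (suc a ∷ α) = q (a ∷ α)
  shift o (suc i) q (a     ∷ α) = shift o i (q ∘ (a ∷_)) α

  raise : ∀ {m} → Fin m → Vec ℕ m → Vec ℕ m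
  raise zero    (a ∷ α) = suc a ∷ α
  raise (suc i) (a ∷ α) = a ∷ raise i α

  0̂ : ∀ {m} → Vec ℕ m
  0̂ = Vec.replicate _ 0

  count : ∀ {m} → Fin m → List (Fin m) → ℕ
  count e cs = length (filter (Finₚ._≟ e) cs)

  lookup-raise : ∀ {m} (i : Fin m) α → Vec.lookup (raise i α) i ≡ suc (Vec.lookup α i)
  lookup-raise zero    (a ∷ α) = refl
  lookup-raise (suc i) (a ∷ α) = lookup-raise i α

  lookup-raise-≢ : ∀ {m} {i j : Fin m} α → i ≢ j → Vec.lookup (raise i α) j ≡ Vec.lookup α j
  lookup-raise-≢ {i = zero}  {zero}  α       i≢j = contradiction refl i≢j
  lookup-raise-≢ {i = zero}  {suc j} (a ∷ α) i≢j = refl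
  lookup-raise-≢ {i = suc i} {zero}  (a ∷ α) i≢j = refl
  lookup-raise-≢ {i = suc i} {suc j} (a ∷ α) i≢j = lookup-raise-≢ α (i≢j ∘ cong suc)

  lookup-replicate0 : ∀ {m} (j : Fin m) → Vec.lookup 0̂ j ≡ 0
  lookup-replicate0 zero    = refl
  lookup-replicate0 (suc j) = lookup-replicate0 j

  lookup-foldr-raise : ∀ {m} (cs : List (Fin m)) e → Vec.lookup (foldr raise 0̂ cs) e ≡ count e cs
  lookup-foldr-raise []       e = lookup-replicate0 e
  lookup-foldr-raise (c ∷ cs) e with c Finₚ.≟ e
  ... | yes refl = trans (lookup-raise c _) (cong suc (lookup-foldr-raise cs c))
  ... | no  c≢e  = trans (lookup-raise-≢ _ c≢e) (lookup-foldr-raise cs e)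

  largest≤ : ∀ {m k} (α : Vec ℕ m) → (∀ i → Vec.lookup α i ℕ.≤ k) → Vec.foldr _ ℕ._⊔_ 0 α ℕ.≤ k
  largest≤ []      α≤k = ℕ.z≤n
  largest≤ (a ∷ α) α≤k = ℕₚ.⊔-lub (α≤k zero) (largest≤ α (α≤k ∘ suc))

  shift-map : ∀ {a b} {A : Set a} {B : Set b} {m} (f : A → B) o (i : Fin m) q α →
              f (shift o i q α) ≡ shift (f o) i (f ∘ q) α
  shift-map f o zero    q (zero  ∷ α) = refl
  shift-map f o zero    q (suc a ∷ α) = refl
  shift-map f o (suc i) q (a     ∷ α) = shift-map f o i _ α

  unit : ∀ {m} → Vec ℕ m → ℤ
  unit []          = 1ℤ
  unit (zero  ∷ α) = unit α
  unit (suc _ ∷ α) = 0ℤ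

  module _ {m : ℕ} where

    Coefs : Set
    Coefs = Vec ℕ m → ℤ

    sumOver : List (Fin m) → (Fin m → ℤ) → ℤ
    sumOver is f = foldr (λ i x → f i + x) 0ℤ is

    sumOver-cong : ∀ is {f g} → (∀ i → f i ≡ g i) → sumOver is f ≡ sumOver is g
    sumOver-cong []       f≗g = refl
    sumOver-cong (i ∷ is) f≗g = cong₂ _+_ (f≗g i) (sumOver-cong is f≗g)

    sumOver-0 : ∀ is → sumOver is (λ _ → 0ℤ) ≡ 0ℤ
    sumOver-0 []       = refl
    sumOver-0 (i ∷ is) = trans (ℤₚ.+-identityˡ _) (sumOver-0 is)

    sumOver-linear : ∀ is f x g →
      sumOver is (λ i → f i * x + g i) ≡ sumOver is f * x + sumOver is g
    sumOver-linear []       f x g = refl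
    sumOver-linear (i ∷ is) f x g = trans (cong (_+_ (f i * x + g i)) (sumOver-linear is f x g))
      (lemma (f i) x (g i) _ _)
      where
      lemma : ∀ f x g y z → f * x + g + (y * x + z) ≡ (f + y) * x + (g + z)
      lemma = solve-∀

    -- The linear form given by the sum of the variables in the first list
    -- minus the sum of those in the second.
    Form : Set
    Form = List (Fin m) × List (Fin m)

    infixr 7 _·_

    _·_ : Form → Coefs → Coefs
    ((ps , ns) · q) α = sumOver ps (λ i → shift 0ℤ i q α) - sumOver ns (λ i → shift 0ℤ i q α)

    coefs : List Form → Coefs
    coefs []       = unit
    coefs (ℓ ∷ ℓs) = ℓ · coefs ℓs

  δ : ∀ {m} → Fin m → Fin m → ℤ
  δ zero    zero    = 1ℤ
  δ zero    (suc c) = 0ℤ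
  δ (suc i) zero    = 0ℤ
  δ (suc i) (suc c) = δ i c

  δ-refl : ∀ {m} (i : Fin m) → δ i i ≡ 1ℤ
  δ-refl zero    = refl
  δ-refl (suc i) = δ-refl i

  δ-≢ : ∀ {m} {i j : Fin m} → i ≢ j → δ i j ≡ 0ℤ
  δ-≢ {i = zero}  {zero}  i≢j = contradiction refl i≢j
  δ-≢ {i = zero}  {suc j} i≢j = refl
  δ-≢ {i = suc i} {zero}  i≢j = refl
  δ-≢ {i = suc i} {suc j} i≢j = δ-≢ (i≢j ∘ cong suc)

  -- The partial derivative with respect to the variable `c`, on coefficient functions.
  ∂ : ∀ {m} → Fin m → (Vec ℕ m → ℤ) → Vec ℕ m → ℤ
  ∂ c q β = + suc (Vec.lookup β c) * q (raise c β)

  ∂-0 : ∀ {m} (c : Fin m) q β → q (raise c β) ≡ 0ℤ → ∂ c q β ≡ 0ℤ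
  ∂-0 c q β q≡0 = trans (cong (+ suc (Vec.lookup β c) *_) q≡0) (ℤₚ.*-zeroʳ (+ suc (Vec.lookup β c)))

  -- The product rule for a variable times `q`. When `i` is `c`, the factor b + 1 in `∂` splits into
  -- 1, from differentiating the variable, and b, from differentiating `q`.
  ∂-shift : ∀ {m} (c i : Fin m) q β → ∂ c (shift 0ℤ i q) β ≡ δ i c * q β + shift 0ℤ i (∂ c q) β
  ∂-shift zero zero q (zero  ∷ β) = lemma (q (0 ∷ β))
    where
    lemma : ∀ x → 1ℤ * x ≡ 1ℤ * x + 0ℤ
    lemma = solve-∀
  ∂-shift zero zero q (suc b ∷ β) = lemma (+ suc b) (q (suc b ∷ β))
    where
    lemma : ∀ n x → (1ℤ + n) * x ≡ 1ℤ * x + n * x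
    lemma = solve-∀
  ∂-shift zero (suc i) q (b ∷ β) =
    trans (shift-map (+ suc b *_) 0ℤ i _ β)
    (trans (cong (λ o → shift o i (λ β → + suc b * q (suc b ∷ β)) β) (ℤₚ.*-zeroʳ (+ suc b)))
           (sym (ℤₚ.+-identityˡ _)))
  ∂-shift (suc c) zero q (zero  ∷ β) = ℤₚ.*-zeroʳ (+ suc (Vec.lookup β c))
  ∂-shift (suc c) zero q (suc b ∷ β) = sym (ℤₚ.+-identityˡ _)
  ∂-shift (suc c) (suc i) q (b ∷ β) = ∂-shift c i (q ∘ (b ∷_)) β

  shift-0̂ : ∀ {m} (i : Fin m) q → shift 0ℤ i q 0̂ ≡ 0ℤ
  shift-0̂ zero    q = refl
  shift-0̂ (suc i) q = shift-0̂ i (q ∘ (0 ∷_))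

  unit-raise : ∀ {m} (c : Fin m) β → unit (raise c β) ≡ 0ℤ
  unit-raise zero    (b     ∷ β) = refl
  unit-raise (suc c) (zero  ∷ β) = unit-raise c β
  unit-raise (suc c) (suc b ∷ β) = refl

  unit-0̂ : ∀ m → unit {m} 0̂ ≡ 1ℤ
  unit-0̂ zero    = refl
  unit-0̂ (suc m) = unit-0̂ m

  module _ {m : ℕ} where

    -- The derivative of the linear form by the variable `c`, which is the entry of the column `c`
    -- in the row of the form.
    col : Fin m → Form → ℤ
    col c (ps , ns) = sumOver ps (λ i → δ i c) - sumOver ns (λ i → δ i c)

    leibniz : ∀ c ℓ q β → ∂ c (ℓ · q) β ≡ col c ℓ * q β + (ℓ · ∂ c q) β
    leibniz c (ps , ns) q β = begin
      n * (sumOver ps s - sumOver ns s)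
        ≡⟨ lemma₁ n (sumOver ps s) (sumOver ns s) ⟩
      n * sumOver ps s - n * sumOver ns s
        ≡⟨ cong₂ _-_ (part ps) (part ns) ⟩
      (sumOver ps d * q β + sumOver ps t) - (sumOver ns d * q β + sumOver ns t)
        ≡⟨ lemma₂ (sumOver ps d) (q β) (sumOver ps t) (sumOver ns d) (sumOver ns t) ⟩
      (sumOver ps d - sumOver ns d) * q β + (sumOver ps t - sumOver ns t) ∎
      where
      open ≡-Reasoning
      n = + suc (Vec.lookup β c)
      s t d : Fin m → ℤ
      s i = shift 0ℤ i q (raise c β)
      t i = shift 0ℤ i (∂ c q) β
      d i = δ i c
      lemma₁ : ∀ n x y → n * (x - y) ≡ n * x - n * y
      lemma₁ = solve-∀
      lemma₂ : ∀ a q b c d → (a * q + b) - (c * q + d) ≡ (a - c) * q + (b - d)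
      lemma₂ = solve-∀
      distrib : ∀ is → n * sumOver is s ≡ sumOver is (λ i → n * s i)
      distrib []       = ℤₚ.*-zeroʳ n
      distrib (i ∷ is) = trans (ℤₚ.*-distribˡ-+ n (s i) _) (cong (_+_ (n * s i)) (distrib is))
      part : ∀ is → n * sumOver is s ≡ sumOver is d * q β + sumOver is t
      part is = trans (distrib is) (trans (sumOver-cong is (λ i → ∂-shift c i q β))
                                          (sumOver-linear is d (q β) t))

    ∂* : List (Fin m) → Coefs → Coefs
    ∂* []       q = q
    ∂* (c ∷ cs) q = ∂* cs (∂ c q)

    ∂*-linear : ∀ cs x {p q r : Coefs} → (∀ β → p β ≡ x * q β + r β) →
                ∀ β → ∂* cs p β ≡ x * ∂* cs q β + ∂* cs r β
    ∂*-linear []       x p≡ β = p≡ β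
    ∂*-linear (c ∷ cs) x {p} {q} {r} p≡ β = ∂*-linear cs x
      (λ β → trans (cong (+ suc (Vec.lookup β c) *_) (p≡ (raise c β))) (lemma (+ suc (Vec.lookup β c)) x (q (raise c β)) (r (raise c β)))) β
      where
      lemma : ∀ n x q r → n * (x * q + r) ≡ x * (n * q) + n * r
      lemma = solve-∀

    ∂*-0 : ∀ cs {q : Coefs} → (∀ β → q β ≡ 0ℤ) → ∀ β → ∂* cs q β ≡ 0ℤ
    ∂*-0 []       q≡0 β = q≡0 β
    ∂*-0 (c ∷ cs) {q} q≡0 β = ∂*-0 cs (λ β → ∂-0 c q β (q≡0 (raise c β))) β

    ·-0̂ : ∀ (ℓ : Form {m}) (q : Coefs) → (ℓ · q) 0̂ ≡ 0ℤ
    ·-0̂ (ps , ns) q = cong₂ _-_ (zeros ps) (zeros ns)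
      where
      zeros : ∀ is → sumOver is (λ i → shift 0ℤ i q 0̂) ≡ 0ℤ
      zeros is = trans (sumOver-cong is (λ i → shift-0̂ i q)) (sumOver-0 is)

    -- Laplace expansion along the row `ℓ` is the Leibniz rule: the term of `c` is the one in which
    -- the derivative by `c` falls on the factor `ℓ`. If no derivative falls on `ℓ`, this factor
    -- makes the constant coefficient 0.
    expand-∂* : ∀ ℓ cs q {k} → (∀ es → k (map col es) ≡ ∂* es q 0̂) →
                expand ℓ (map col cs) k ≡ ∂* cs (ℓ · q) 0̂
    expand-∂* ℓ []       q k≡ = sym (·-0̂ ℓ q)
    expand-∂* ℓ (c ∷ cs) q k≡ = trans
      (cong₂ _+_ (cong (col c ℓ *_) (k≡ cs)) (expand-∂* ℓ cs (∂ c q) (λ es → k≡ (c ∷ es))))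
      (sym (∂*-linear cs (col c ℓ) (leibniz c ℓ q) 0̂))

    per≡∂* : ∀ ℓs cs → per ℓs (map col cs) ≡ ∂* cs (coefs ℓs) 0̂
    per≡∂* []       []       = sym (unit-0̂ m)
    per≡∂* []       (c ∷ cs) = sym (∂*-0 cs
      (λ β → ∂-0 c unit β (unit-raise c β)) 0̂)
    per≡∂* (ℓ ∷ ℓs) cs       = expand-∂* ℓ cs (coefs ℓs) (per≡∂* ℓs)

    -- Each derivative multiplies one coefficient, that of the raised exponent vector, by a positive
    -- integer. The accumulated integer is the product of factorials when `β` is zero.
    ∂*≢0 : ∀ cs q {β} → ∂* cs q β ≢ 0ℤ → q (foldr raise β cs) ≢ 0ℤ
    ∂*≢0 []       q ∂≢0 = ∂≢0
    ∂*≢0 (c ∷ cs) q {β} ∂≢0 q≡0 = ∂*≢0 cs (∂ c q) ∂≢0 (∂-0 c q (foldr raise β cs) q≡0)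

    per≢0⇒coefs≢0 : ∀ ℓs cs → per ℓs (map col cs) ≢ 0ℤ → coefs ℓs (foldr raise 0̂ cs) ≢ 0ℤ
    per≢0⇒coefs≢0 ℓs cs p≢0 = ∂*≢0 cs (coefs ℓs) (p≢0 ∘ trans (per≡∂* ℓs cs))

-- Lists without repetition as sets of rows, and multiplicities

module Lists where

  open import Data.Fin.Base using (Fin)
  import Data.Fin.Properties as Finₚ
  open import Data.List.Base using (List; []; _∷_; _++_; filter; length; allFin; map)
  open import Data.List.Membership.Propositional using (_∈_; _∉_)
  open import Data.List.Membership.Propositional.Properties using (∈-filter⁺; ∈-filter⁻; ∈-allFin; ∈-map⁻)
  open import Data.List.Membership.Propositional.Properties.WithK using (unique∧set⇒bag)
  open import Data.List.Properties using (filter-++; filter-none; length-++)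
  open import Data.List.Relation.Binary.BagAndSetEquality using (∼bag⇒↭)
  open import Data.List.Relation.Binary.Permutation.Propositional using (_↭_; refl; prep; ↭-trans; ↭-sym)
  open import Data.List.Relation.Binary.Permutation.Propositional.Properties using (shift)
  open import Data.List.Relation.Unary.All as All using (All; []; _∷_)
  open import Data.List.Relation.Unary.AllPairs using ([]; _∷_)
  open import Data.List.Relation.Unary.Any using (here; there)
  open import Data.List.Relation.Unary.Unique.Propositional using (Unique)
  import Data.List.Relation.Unary.Unique.Propositional.Properties as Uniqueₚ
  open import Data.Nat.Base using (ℕ; _+_; _≤_; z≤n; s≤s)
  open import Data.Product.Base using (∃-syntax; _×_; _,_; proj₁; proj₂)
  open import Data.Sum.Base using (_⊎_; inj₁; inj₂)
  open import Function.Base using (_∘_)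
  open import Function.Bundles using (mk⇔)
  open import Level using (0ℓ)
  open import Relation.Binary.PropositionalEquality using (_≡_; _≢_; refl; sym; trans; cong; subst)
  open import Relation.Nullary.Decidable using (yes; no; ¬?; _×-dec_)
  open import Relation.Nullary.Negation using (¬_; contradiction)
  open import Relation.Unary using (Pred; Decidable)
  open Coefficients using (count)

  module _ {A : Set} where

    unique-↭ : {xs ys : List A} → Unique xs → Unique ys →
               (∀ {x} → x ∈ xs → x ∈ ys) → (∀ {x} → x ∈ ys → x ∈ xs) → xs ↭ ys
    unique-↭ xs! ys! xs⊆ys ys⊆xs = ∼bag⇒↭ (unique∧set⇒bag xs! ys! (mk⇔ xs⊆ys ys⊆xs))

    filter-split : {P Q R : Pred A 0ℓ} (P? : Decidable P) (Q? : Decidable Q) (R? : Decidable R) →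
      (∀ x → P x → Q x ⊎ R x) → (∀ x → Q x → P x) → (∀ x → R x → P x) → (∀ x → Q x → ¬ R x) →
      ∀ xs → filter P? xs ↭ filter Q? xs ++ filter R? xs
    filter-split P? Q? R? split Q⇒P R⇒P Q∥R []       = refl
    filter-split P? Q? R? split Q⇒P R⇒P Q∥R (x ∷ xs)
      with P? x | Q? x | R? x | filter-split P? Q? R? split Q⇒P R⇒P Q∥R xs
    ... | yes _ | yes _ | no  _ | xs↭ = prep x xs↭
    ... | yes _ | no  _ | yes _ | xs↭ = ↭-trans (prep x xs↭) (↭-sym (shift x (filter Q? xs) (filter R? xs)))
    ... | no  _ | no  _ | no  _ | xs↭ = xs↭
    ... | yes p | no ¬q | no ¬r | _ = contradiction (split x p) λ { (inj₁ q) → ¬q q ; (inj₂ r) → ¬r r }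
    ... | _     | yes q | yes r | _ = contradiction r (Q∥R x q)
    ... | no ¬p | yes q | no  _ | _ = contradiction (Q⇒P x q) ¬p
    ... | no ¬p | no  _ | yes r | _ = contradiction (R⇒P x r) ¬p

    length-filter-unique≤1 : {P : Pred A 0ℓ} (P? : Decidable P) {xs : List A} →
      (∀ {x y} → x ∈ xs → y ∈ xs → P x → P y → x ≡ y) → Unique xs → length (filter P? xs) ≤ 1
    length-filter-unique≤1 P? {[]}     P! _ = z≤n
    length-filter-unique≤1 P? {x ∷ xs} P! (x∉ ∷ xs!) with P? x
    ... | no  _ = length-filter-unique≤1 P? (λ x∈ y∈ → P! (there x∈) (there y∈)) xs!
    ... | yes p rewrite filter-none P? {xs} (All.tabulate λ y∈ q → All.lookup x∉ y∈ (P! (here refl) (there y∈) p q)) = s≤s z≤n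

    unique-map⁺ : {B : Set} (f : A → B) {xs : List A} → (∀ {x y} → x ∈ xs → y ∈ xs → f x ≡ f y → x ≡ y) →
                  Unique xs → Unique (map f xs)
    unique-map⁺ f         f-inj []         = []
    unique-map⁺ f {x ∷ xs} f-inj (x∉ ∷ xs!) =
      All.tabulate (λ y∈ → fresh (∈-map⁻ f y∈)) ∷ unique-map⁺ f (λ p q → f-inj (there p) (there q)) xs!
      where
      fresh : ∀ {y} → ∃[ z ] (z ∈ xs × y ≡ f z) → f x ≢ y
      fresh (z , z∈ , refl) fx≡fz = All.lookup x∉ z∈ (f-inj (here refl) (there z∈) fx≡fz)

  module _ {m : ℕ} where

    rowsOf : {P : Pred (Fin m) 0ℓ} → Decidable P → List (Fin m)
    rowsOf P? = filter P? (allFin m)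

    module _ {P : Pred (Fin m) 0ℓ} (P? : Decidable P) where

      ∈-rowsOf⁺ : ∀ {x} → P x → x ∈ rowsOf P?
      ∈-rowsOf⁺ = ∈-filter⁺ P? (∈-allFin _)

      ∈-rowsOf⁻ : ∀ {x} → x ∈ rowsOf P? → P x
      ∈-rowsOf⁻ = proj₂ ∘ ∈-filter⁻ P? {xs = allFin m}

      all-rowsOf : {Q : Pred (Fin m) 0ℓ} → (∀ {x} → P x → Q x) → All Q (rowsOf P?)
      all-rowsOf P⇒Q = All.tabulate (P⇒Q ∘ ∈-rowsOf⁻)

      rowsOf! : Unique (rowsOf P?)
      rowsOf! = Uniqueₚ.filter⁺ P? (Uniqueₚ.allFin⁺ m)

      except? : ∀ x → Decidable (λ y → P y × y ≢ x)
      except? x y = P? y ×-dec ¬? (y Finₚ.≟ x)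

      rowsOf-extract : ∀ {x} → P x → rowsOf P? ↭ x ∷ rowsOf (except? x)
      rowsOf-extract {x} px = unique-↭ rowsOf!
        (All.tabulate (λ y∈ x≡y → proj₂ (proj₂ (∈-filter⁻ (except? x) {xs = allFin m} y∈)) (sym x≡y))
          ∷ Uniqueₚ.filter⁺ (except? x) (Uniqueₚ.allFin⁺ m))
        split
        (λ { (here refl) → ∈-rowsOf⁺ px
           ; (there y∈) → ∈-rowsOf⁺ (proj₁ (proj₂ (∈-filter⁻ (except? x) {xs = allFin m} y∈))) })
        where
        split : ∀ {y} → y ∈ rowsOf P? → y ∈ x ∷ rowsOf (except? x)
        split {y} y∈ with y Finₚ.≟ x
        ... | yes y≡x = here y≡x
        ... | no y≢x  = there (∈-filter⁺ (except? x) (∈-allFin y) (∈-rowsOf⁻ y∈ , y≢x))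

    count-++ : ∀ (e : Fin m) xs ys → count e (xs ++ ys) ≡ count e xs + count e ys
    count-++ e xs ys = trans (cong length (filter-++ (Finₚ._≟ e) xs ys)) (length-++ (filter (Finₚ._≟ e) xs))

    count-∉ : ∀ {e : Fin m} {xs} → e ∉ xs → count e xs ≡ 0
    count-∉ {e} {xs} e∉xs = cong length (filter-none (Finₚ._≟ e)
      (All.tabulate {xs = xs} (λ x∈xs x≡e → e∉xs (subst (_∈ xs) x≡e x∈xs))))

    count-unique≤1 : ∀ {e : Fin m} {xs} → Unique xs → count e xs ≤ 1
    count-unique≤1 {e} = length-filter-unique≤1 (Finₚ._≟ e) (λ _ _ x≡e y≡e → trans x≡e (sym y≡e))

-- Columns of edges and their differences

module EdgeColumns where

  open import Data.Fin.Base using (Fin)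
  import Data.Fin.Properties as Finₚ
  open import Data.Fin.Subset using (Subset; _∈_; _∉_; _-_; _─_; ∣_∣; inside; outside; ⊤)
  open import Data.Fin.Subset.Properties using (_∈?_; x∈p∧x≢y⇒x∈p-y; x∈p⇒∣p-x∣<∣p∣; p─q⊆p; x∈⁅x⁆; ∣p─q∣≤∣p∣; ∈⊤)
  open import Data.Integer.Base as ℤ using (ℤ; 0ℤ; 1ℤ; +_)
  import Data.Integer.Properties as ℤₚ
  open import Data.Integer.Tactic.RingSolver using (solve-∀)
  open import Data.List.Base using (List; []; _∷_; _++_; map; length; allFin; filter; replicate)
  import Data.List.Membership.Propositional as List
  open import Data.List.Membership.Propositional.Properties using (∈-++⁻; ∈-map⁻; ∈-map⁺; ∈-length; ∈-++⁺ˡ; ∈-++⁺ʳ)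
  open import Data.List.Properties using (++-assoc; map-++; length-++; length-map; map-∘; ++-identityʳ; map-replicate; length-filter; filter-notAll; filter-accept; filter-reject; filter-++; filter-none; filter-all)
  open import Data.List.Relation.Binary.Permutation.Propositional using (_↭_; ↭-sym; ↭-trans; refl)
  open import Data.List.Relation.Binary.Permutation.Propositional.Properties using (++⁺ˡ; ++⁺ʳ; shift; ↭-length)
  open import Data.List.Relation.Binary.Pointwise.Base using ([]; _∷_; Pointwise)
  open import Data.List.Relation.Unary.All as All using (All; []; _∷_)
  import Data.List.Relation.Unary.All.Properties as Allₚ
  open import Data.List.Relation.Unary.AllPairs as AllPairs using (AllPairs; []; _∷_)
  open import Data.List.Relation.Unary.Any using (here; there)
  open import Data.List.Relation.Unary.Unique.Propositional using (Unique)
  open import Data.Nat.Base as ℕ using (ℕ; zero; suc; _≤_; _<_; s≤s; z≤n)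
  import Data.Nat.Properties as ℕₚ
  open import Data.Product.Base using (∃-syntax; _×_; _,_; proj₁; proj₂)
  open import Data.Sum.Base as Sum using (_⊎_; inj₁; inj₂; [_,_]′)
  open import Data.Vec.Base using (_∷_)
  import Data.Vec as Vec
  open import Function.Base using (_∘_)
  open import Relation.Binary.PropositionalEquality
  open import Relation.Nullary.Decidable using (Dec; yes; no; ¬?; _×-dec_; _⊎-dec_; _→-dec_; decidable-stable; does; dec-true; dec-false)
  open import Relation.Nullary.Negation using (¬_; contradiction)
  open import Data.Empty using (⊥)
  open import Data.List.Membership.DecPropositional using () renaming (_∈?_ to member?)
  open import Data.Bool.Base using (if_then_else_)
  import Data.List.Relation.Unary.Unique.Propositional.Properties as Uniqueₚ
  open import Relation.Unary using (Decidable)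
  open Permanents
  open Coefficients using (count; δ; δ-refl; δ-≢)
  open Lists

  x∉p-x : ∀ {n} {p : Subset n} {x} → x ∉ p - x
  x∉p-x {p = p} {x} x∈p-x = go p x∈p-x (x∈⁅x⁆ x)
    where
    go : ∀ {n} (p : Subset n) {q x} → x ∈ p ─ q → x ∉ q
    go (inside ∷ p) {outside ∷ q} Vec.here      ()
    go (_ ∷ p) {inside ∷ q}  (Vec.there x∈p─q) (Vec.there x∈q) = go p x∈p─q x∈q
    go (_ ∷ p) {outside ∷ q} (Vec.there x∈p─q) (Vec.there x∈q) = go p x∈p─q x∈q

  module Edges {n m : ℕ} (ends : Fin m → Fin n × Fin n) where

    tail head : Fin m → Fin n
    tail = proj₁ ∘ ends
    head = proj₂ ∘ ends

    Touch : Fin n → Fin m → Set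
    Touch x e = tail e ≡ x ⊎ head e ≡ x

    touch? : ∀ x e → Dec (Touch x e)
    touch? x e = (tail e Finₚ.≟ x) ⊎-dec (head e Finₚ.≟ x)

    -- The coefficient of the variable of c in the factor of e.
    colE : Fin m → Fin m → ℤ
    colE c e = inc (head e) ℤ.- inc (tail e)
      where
      inc : Fin n → ℤ
      inc x = δ (tail c) x ℤ.+ δ (head c) x

    module Simple (loopless : ∀ e → tail e ≢ head e)
                  (simple : ∀ {e f x y} → x ≢ y → Touch x e → Touch y e → Touch x f → Touch y f → e ≡ f) where

      touch-two : ∀ {e x y z} → x ≢ y → Touch x e → Touch y e → Touch z e → z ≡ x ⊎ z ≡ y
      touch-two x≢y (inj₁ refl) (inj₁ refl) _           = contradiction refl x≢y
      touch-two x≢y (inj₁ refl) (inj₂ refl) (inj₁ refl) = inj₁ refl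
      touch-two x≢y (inj₁ refl) (inj₂ refl) (inj₂ refl) = inj₂ refl
      touch-two x≢y (inj₂ refl) (inj₁ refl) (inj₁ refl) = inj₂ refl
      touch-two x≢y (inj₂ refl) (inj₁ refl) (inj₂ refl) = inj₁ refl
      touch-two x≢y (inj₂ refl) (inj₂ refl) _           = contradiction refl x≢y

      other-end : ∀ {e x} → Touch x e → ∃[ y ] (x ≢ y × Touch y e)
      other-end {e} (inj₁ refl) = head e , loopless e , inj₂ refl
      other-end {e} (inj₂ refl) = tail e , (loopless e ∘ sym) , inj₁ refl

      -- Symmetric in the ends of `c`, so that they can be named freely, whatever the direction of
      -- `c`.
      colE≡ : ∀ {p q} c e → p ≢ q → Touch p c → Touch q c →
              colE c e ≡ (δ p (head e) ℤ.+ δ q (head e)) ℤ.- (δ p (tail e) ℤ.+ δ q (tail e))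
      colE≡ c e p≢q (inj₁ refl) (inj₁ refl) = contradiction refl p≢q
      colE≡ c e p≢q (inj₁ refl) (inj₂ refl) = refl
      colE≡ c e p≢q (inj₂ refl) (inj₁ refl) = cong₂ ℤ._-_
        (ℤₚ.+-comm (δ (tail c) (head e)) _) (ℤₚ.+-comm (δ (tail c) (tail e)) _)
      colE≡ c e p≢q (inj₂ refl) (inj₂ refl) = contradiction refl p≢q

      Away : Fin n → Fin m → Set
      Away x e = ¬ Touch x e

      δ-away : ∀ {p e} → Away p e → δ p (head e) ≡ 0ℤ × δ p (tail e) ≡ 0ℤ
      δ-away p∉e = δ-≢ (p∉e ∘ inj₂ ∘ sym) , δ-≢ (p∉e ∘ inj₁ ∘ sym)

      colE-away : ∀ {p q c e} → p ≢ q → Touch p c → Touch q c → Away p e → Away q e → colE c e ≡ 0ℤ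
      colE-away {p} {q} {c} {e} p≢q p∈c q∈c p∉e q∉e = trans (colE≡ c e p≢q p∈c q∈c)
        (cong₂ ℤ._-_ (cong₂ ℤ._+_ (proj₁ (δ-away p∉e)) (proj₁ (δ-away q∉e)))
                     (cong₂ ℤ._+_ (proj₂ (δ-away p∉e)) (proj₂ (δ-away q∉e))))

      colE-self : ∀ c → colE c c ≡ 0ℤ
      colE-self c = begin
        colE c c ≡⟨⟩
        (δ p q ℤ.+ δ q q) ℤ.- (δ p p ℤ.+ δ q p)
          ≡⟨ cong₂ ℤ._-_ (cong₂ ℤ._+_ (δ-≢ (loopless c)) (δ-refl q))
                         (cong₂ ℤ._+_ (δ-refl p) (δ-≢ (loopless c ∘ sym))) ⟩
        0ℤ ∎
        where
        open ≡-Reasoning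
        p = tail c
        q = head c

      δ-one-end≢0 : ∀ {p e} → Touch p e → δ p (head e) ℤ.- δ p (tail e) ≢ 0ℤ
      δ-one-end≢0 {e = e} (inj₁ refl) eq
        with () ← trans (sym (cong₂ ℤ._-_ (δ-≢ (loopless e)) (δ-refl (tail e)))) eq
      δ-one-end≢0 {e = e} (inj₂ refl) eq
        with () ← trans (sym (cong₂ ℤ._-_ (δ-refl (head e)) (δ-≢ (loopless e ∘ sym)))) eq

      colE-tip : ∀ {p q c e} → p ≢ q → Touch p c → Touch q c → Away q e →
                 colE c e ≡ δ p (head e) ℤ.- δ p (tail e)
      colE-tip {p} {q} {c} {e} p≢q p∈c q∈c q∉e = trans (colE≡ c e p≢q p∈c q∈c)
        (trans (cong₂ (λ a b → (δ p (head e) ℤ.+ a) ℤ.- (δ p (tail e) ℤ.+ b))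
                      (proj₁ (δ-away q∉e)) (proj₂ (δ-away q∉e)))
               (lemma (δ p (head e)) (δ p (tail e))))
        where
        lemma : ∀ x y → (x ℤ.+ 0ℤ) ℤ.- (y ℤ.+ 0ℤ) ≡ x ℤ.- y
        lemma = solve-∀

      colE≢0 : ∀ {p q c e} → p ≢ q → Touch p c → Touch q c → Touch p e → Away q e → colE c e ≢ 0ℤ
      colE≢0 p≢q p∈c q∈c p∈e q∉e = δ-one-end≢0 p∈e ∘ trans (sym (colE-tip p≢q p∈c q∈c q∉e))

      -- The column of the indicator function of u minus that of v.
      dipole : Fin n → Fin n → Fin m → ℤ
      dipole u v e = (δ u (head e) ℤ.- δ u (tail e)) ℤ.- (δ v (head e) ℤ.- δ v (tail e))

      difference≡dipole : ∀ {u v w a b} → u ≢ w → v ≢ w → Touch u a → Touch w a → Touch v b → Touch w b →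
                          ∀ e → difference colE (a , b) e ≡ dipole u v e
      difference≡dipole {u} {v} {w} {a} {b} u≢w v≢w u∈a w∈a v∈b w∈b e =
        trans (cong₂ ℤ._-_ (colE≡ a e u≢w u∈a w∈a) (colE≡ b e v≢w v∈b w∈b))
              (lemma (δ u (head e)) (δ w (head e)) (δ u (tail e)) (δ w (tail e)) (δ v (head e)) (δ v (tail e)))
        where
        lemma : ∀ uh wh ut wt vh vt →
          ((uh ℤ.+ wh) ℤ.- (ut ℤ.+ wt)) ℤ.- ((vh ℤ.+ wh) ℤ.- (vt ℤ.+ wt)) ≡ (uh ℤ.- ut) ℤ.- (vh ℤ.- vt)
        lemma = solve-∀

      dipole-away : ∀ {u v e} → Away u e → Away v e → dipole u v e ≡ 0ℤ
      dipole-away u∉e v∉e = cong₂ ℤ._-_ (cong₂ ℤ._-_ (proj₁ (δ-away u∉e)) (proj₂ (δ-away u∉e)))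
                                        (cong₂ ℤ._-_ (proj₁ (δ-away v∉e)) (proj₂ (δ-away v∉e)))

      dipole-tip : ∀ {u v e} → Away v e → dipole u v e ≡ δ u (head e) ℤ.- δ u (tail e)
      dipole-tip {u} {v} {e} v∉e = trans
        (cong₂ (λ a b → (δ u (head e) ℤ.- δ u (tail e)) ℤ.- (a ℤ.- b)) (proj₁ (δ-away v∉e)) (proj₂ (δ-away v∉e)))
        (lemma (δ u (head e)) (δ u (tail e)))
        where
        lemma : ∀ x y → (x ℤ.- y) ℤ.- (0ℤ ℤ.- 0ℤ) ≡ x ℤ.- y
        lemma = solve-∀

      dipole-swap : ∀ u v e → dipole u v e ≡ ℤ.- dipole v u e
      dipole-swap u v e = lemma (δ u (head e) ℤ.- δ u (tail e)) _
        where
        lemma : ∀ x y → x ℤ.- y ≡ ℤ.- (y ℤ.- x)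
        lemma = solve-∀

      -x≢0 : ∀ {x} → x ≢ 0ℤ → ℤ.- x ≢ 0ℤ
      -x≢0 x≢0 eq = x≢0 (trans (sym (ℤₚ.neg-involutive _)) (cong ℤ.-_ eq))

      -- An edge that meets only one of `u` and `v` has entry 1 or -1. On an edge joining them the
      -- two contributions have the same sign, and the entry is 2 or -2.
      dipole≢0 : ∀ {u v e} → u ≢ v → Touch u e ⊎ Touch v e → dipole u v e ≢ 0ℤ
      dipole≢0 {u} {v} {e} u≢v meets with touch? u e | touch? v e
      ... | no u∉e   | no v∉e  = λ _ → [ u∉e , v∉e ]′ meets
      ... | yes u∈e  | no v∉e  = λ eq → δ-one-end≢0 u∈e (trans (sym (dipole-tip {u} v∉e)) eq)
      ... | no u∉e   | yes v∈e = λ eq → -x≢0 (δ-one-end≢0 v∈e ∘ trans (sym (dipole-tip {v} u∉e)))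
                                          (trans (sym (dipole-swap u v e)) eq)
      ... | yes u∈e  | yes v∈e = both u∈e v∈e
        where
        both : Touch u e → Touch v e → dipole u v e ≢ 0ℤ
        both (inj₁ refl) (inj₁ refl) = contradiction refl u≢v
        both (inj₂ refl) (inj₂ refl) = contradiction refl u≢v
        both (inj₁ refl) (inj₂ refl)
          rewrite δ-refl (tail e) | δ-refl (head e) | δ-≢ (loopless e) | δ-≢ (loopless e ∘ sym) = λ ()
        both (inj₂ refl) (inj₁ refl)
          rewrite δ-refl (tail e) | δ-refl (head e) | δ-≢ (loopless e) | δ-≢ (loopless e ∘ sym) = λ ()

      -- Isolated edges and the statement proved by induction

      In : Subset n → Fin m → Set
      In S e = tail e ∈ S × head e ∈ S

      in? : ∀ S e → Dec (In S e)
      in? S e = (tail e ∈? S) ×-dec (head e ∈? S)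

      Share : Fin m → Fin m → Set
      Share e f = ∃[ x ] (Touch x e × Touch x f)

      share? : ∀ e f → Dec (Share e f)
      share? e f = Finₚ.any? λ x → touch? x e ×-dec touch? x f

      -- If e lies in S, then it is a component K₂ of the graph induced by S.
      Isolated : Subset n → Fin m → Set
      Isolated S e = ∀ f → In S f → Share e f → f ≡ e

      abstract
        isolated? : ∀ S e → Dec (Isolated S e)
        isolated? S e = Finₚ.all? λ f → in? S f →-dec (share? e f →-dec (f Finₚ.≟ e))

      neighbourEdge : ∀ {S e} → ¬ Isolated S e → ∃[ f ] (In S f × Share e f × f ≢ e)
      neighbourEdge {S} {e} ¬iso = decidable-stable
        (Finₚ.any? λ f → in? S f ×-dec (share? e f ×-dec ¬? (f Finₚ.≟ e)))
        λ none → ¬iso λ f f∈S share → decidable-stable (f Finₚ.≟ e) λ f≢e → none (f , f∈S , share , f≢e)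

      Live : Subset n → Fin m → Set
      Live S e = In S e × ¬ Isolated S e

      abstract
        live? : ∀ S e → Dec (Live S e)
        live? S e = in? S e ×-dec ¬? (isolated? S e)

      -- The rows are those of live edges only, since an isolated edge of `S` has entry 0 in the
      -- column of every edge of `S`. That the columns belong to edges of `S` keeps their
      -- multiplicities separate from those of the columns added when two vertices are put back.
      Claim : ℕ → Subset n → Set
      Claim k S = ∃[ cs ] (All (In S) cs × (∀ e → count e cs ≤ k) × per (rowsOf (live? S)) (map colE cs) ≢ 0ℤ)

      -- Putting back two vertices

      module Removal (S : Subset n) (u v : Fin n) (u≢v : u ≢ v)
                     (busy : ∀ {e} → In S e → Touch u e ⊎ Touch v e → ¬ Isolated S e) where

        S′ : Subset n
        S′ = S - u - v

        Meets : Fin m → Set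
        Meets e = Touch u e ⊎ Touch v e

        meets? : ∀ e → Dec (Meets e)
        meets? e = touch? u e ⊎-dec touch? v e

        in⁺ : ∀ {e} → In S e → ¬ Meets e → In S′ e
        in⁺ (t∈S , h∈S) ¬meets = keep t∈S (¬meets ∘ Sum.map inj₁ inj₁) , keep h∈S (¬meets ∘ Sum.map inj₂ inj₂)
          where
          keep : ∀ {x} → x ∈ S → ¬ (x ≡ u ⊎ x ≡ v) → x ∈ S′
          keep x∈S x≢ = x∈p∧x≢y⇒x∈p-y (x∈p∧x≢y⇒x∈p-y x∈S (x≢ ∘ inj₁)) (x≢ ∘ inj₂)

        in⁻ : ∀ {e} → In S′ e → In S e
        in⁻ (t∈ , h∈) = drop t∈ , drop h∈
          where
          drop : ∀ {x} → x ∈ S′ → x ∈ S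
          drop = p─q⊆p S _ ∘ p─q⊆p (S - u) _

        in-avoids : ∀ {e} → In S′ e → ¬ Meets e
        in-avoids (t∈ , h∈) = [ [ u∉ t∈ , u∉ h∈ ]′ , [ v∉ t∈ , v∉ h∈ ]′ ]′
          where
          u∉ : ∀ {x} → x ∈ S′ → x ≢ u
          u∉ x∈ refl = x∉p-x (p─q⊆p (S - u) _ x∈)
          v∉ : ∀ {x} → x ∈ S′ → x ≢ v
          v∉ x∈ refl = x∉p-x x∈

        awayᵘ : ∀ {e} → In S′ e → Away u e
        awayᵘ e∈ = in-avoids e∈ ∘ inj₁

        awayᵛ : ∀ {e} → In S′ e → Away v e
        awayᵛ e∈ = in-avoids e∈ ∘ inj₂

        New : Fin m → Set
        New e = In S′ e × Isolated S′ e × ¬ Isolated S e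

        abstract
          new? : ∀ e → Dec (New e)
          new? e = in? S′ e ×-dec (isolated? S′ e ×-dec ¬? (isolated? S e))

        Removed : Fin m → Set
        Removed e = In S e × Meets e

        abstract
          removed? : ∀ e → Dec (Removed e)
          removed? e = in? S e ×-dec meets? e

        -- A live edge that avoids `u` and `v` stays live or becomes isolated by their removal. That
        -- all removed edges are live is the assumption `busy`.
        live-↭ : rowsOf (live? S) ↭ rowsOf (live? S′) ++ (rowsOf new? ++ rowsOf removed?)
        live-↭ = ↭-trans
          (filter-split (live? S) (live? S′) (λ e → new? e ⊎-dec removed? e) split live⇒ rest⇒
            (λ { e (e∈ , ¬iso) (inj₁ (_ , iso , _)) → ¬iso iso
               ; e (e∈ , ¬iso) (inj₂ (_ , meets)) → in-avoids e∈ meets }) (allFin m))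
          (++⁺ˡ (rowsOf (live? S′))
            (filter-split (λ e → new? e ⊎-dec removed? e) new? removed? (λ e p → p) (λ e → inj₁) (λ e → inj₂)
              (λ { e (e∈ , _) (_ , meets) → in-avoids e∈ meets }) (allFin m)))
          where
          split : ∀ e → Live S e → Live S′ e ⊎ (New e ⊎ Removed e)
          split e (e∈ , ¬iso) with meets? e | isolated? S′ e
          ... | yes meets | _ = inj₂ (inj₂ (e∈ , meets))
          ... | no ¬meets | yes iso′ = inj₂ (inj₁ (in⁺ e∈ ¬meets , iso′ , ¬iso))
          ... | no ¬meets | no ¬iso′ = inj₁ (in⁺ e∈ ¬meets , ¬iso′)
          live⇒ : ∀ e → Live S′ e → Live S e
          live⇒ e (e∈ , ¬iso′) = in⁻ e∈ , λ iso → ¬iso′ λ f f∈ → iso f (in⁻ f∈)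
          rest⇒ : ∀ e → New e ⊎ Removed e → Live S e
          rest⇒ e (inj₁ (e∈ , _ , ¬iso)) = in⁻ e∈ , ¬iso
          rest⇒ e (inj₂ (e∈ , meets))   = e∈ , busy e∈ meets

        Connects : Fin m → Fin m → Set
        Connects e f = In S f × Share e f × Meets f

        connects? : ∀ e f → Dec (Connects e f)
        connects? e f = in? S f ×-dec (share? e f ×-dec meets? f)

        abstract
          connector : Fin m → Fin m
          connector e with Finₚ.any? (connects? e)
          ... | yes (f , _) = f
          ... | no _        = e

          -- The edge `e` has a neighbouring edge in `S` but none in `S′`, so the neighbouring edge
          -- meets `u` or `v`. Hence the default value in `connector` is never taken for a new edge.
          connector-connects : ∀ {e} → New e → Connects e (connector e)
          connector-connects {e} (e∈ , iso′ , ¬iso) with Finₚ.any? (connects? e)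
          ... | yes (f , c) = c
          ... | no none with neighbourEdge ¬iso
          ...   | f , f∈ , share , f≢e with meets? f
          ...     | yes meets = contradiction (f , f∈ , share , meets) none
          ...     | no ¬meets = contradiction (iso′ f (in⁺ f∈ ¬meets) share) f≢e

        -- How the connector of a new isolated edge looks: x is the end of the edge, z is u or v.
        record Bridge (e f : Fin m) : Set where
          field
            {x z} : Fin n
            x≢z   : x ≢ z
            x∈e   : Touch x e
            x∈f   : Touch x f
            z∈f   : Touch z f
            z≡    : z ≡ u ⊎ z ≡ v

        abstract
          bridge : ∀ {e} → New e → Bridge e (connector e)
          bridge {e} new@(e∈ , _) with connector-connects new
          ... | _ , (x , x∈e , x∈f) , inj₁ u∈f = record
            { x≢z = λ { refl → awayᵘ e∈ x∈e } ; x∈e = x∈e ; x∈f = x∈f ; z∈f = u∈f ; z≡ = inj₁ refl }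
          ... | _ , (x , x∈e , x∈f) , inj₂ v∈f = record
            { x≢z = λ { refl → awayᵛ e∈ x∈e } ; x∈e = x∈e ; x∈f = x∈f ; z∈f = v∈f ; z≡ = inj₂ refl }

        awayᶻ : ∀ {e z} → z ≡ u ⊎ z ≡ v → In S′ e → Away z e
        awayᶻ (inj₁ refl) = awayᵘ
        awayᶻ (inj₂ refl) = awayᵛ

        -- One end of the connector lies on `e`, and no other edge of `S′` reaches it because `e` is
        -- isolated there; the other end is `u` or `v`, which no edge of `S′` touches.
        connector-vanishes : ∀ {e f} → New e → In S′ f → f ≢ e → colE (connector e) f ≡ 0ℤ
        connector-vanishes {e} {f} new@(_ , iso′ , _) f∈ f≢e = colE-away x≢z x∈f z∈f
          (λ x∈ → f≢e (iso′ f f∈ (x , x∈e , x∈))) (awayᶻ z≡ f∈)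
          where open Bridge (bridge new)

        connector≢0 : ∀ {e} → New e → colE (connector e) e ≢ 0ℤ
        connector≢0 new@(e∈ , _) = colE≢0 x≢z x∈f z∈f x∈e (awayᶻ z≡ e∈)
          where open Bridge (bridge new)

        -- Only one end of the connector can lie on edges of `S′`, so `e` and `f` share it, and
        -- isolation makes them equal.
        connector-injective : ∀ {e f} → New e → New f → connector e ≡ connector f → e ≡ f
        connector-injective {e} {f} newᵉ@(e∈ , iso′ , _) newᶠ@(f∈ , _) eq = sym
          (iso′ f f∈ (x , x∈e , decidable-stable (touch? x f) (λ x∉f →
            [ (λ y≡x → x∉f (subst (λ y → Touch y f) y≡x y∈f))
            , (λ y≡z → awayᶻ z≡ f∈ (subst (λ y → Touch y f) y≡z y∈f)) ]′
            (touch-two x≢z x∈f z∈f (subst (Touch y) (sym eq) y∈cf)))))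
          where
          open Bridge (bridge newᵉ)
          open Bridge (bridge newᶠ) using () renaming (x to y; x∈e to y∈f; x∈f to y∈cf)

        connectors! : ∀ {ns} → All New ns → Unique ns → Unique (map connector ns)
        connectors! news = unique-map⁺ connector
          (λ e∈ f∈ → connector-injective (All.lookup news e∈) (All.lookup news f∈))

        -- The new edges `ns` are matched with their connectors, while the rows `rs` are left to the
        -- columns `xs` and the differences `qs`. Both lists are parameters because in one case a
        -- new edge has to be treated together with the removed ones.
        module Step {k : ℕ} {ns rs : List (Fin m)} (news : All New ns) (ns! : Unique ns)
                    (rows-↭ : rowsOf (live? S) ↭ rowsOf (live? S′) ++ (ns ++ rs))
                    (claim : Claim k S′)
                    (xs : List (Fin m)) (qs : List (Fin m × Fin m))
                    (xs-removed : All Removed xs)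
                    (qs-removed : All (λ q → Removed (proj₁ q) × Removed (proj₂ q)) qs)
                    (vanishes : ∀ {e} → In S′ e → e List.∈ rowsOf (live? S′) ⊎ e List.∈ ns →
                      All (λ x → colE x e ≡ 0ℤ) xs × All (λ q → difference colE q e ≡ 0ℤ) qs)
                    (per≢0 : per rs (map colE xs ++ map (difference colE) qs) ≢ 0ℤ)
                    (count≤ : ∀ ds → Choice colE ds qs → ∀ e →
                      count e (map connector ns) ℕ.+ count e (xs ++ ds) ≤ k)
          where

          private
            old = rowsOf (live? S′)
            cs = proj₁ claim
            fs = map connector ns

            ns⇒in : ∀ {e} → e List.∈ ns → New e
            ns⇒in = All.lookup news

            old⇒in : ∀ {e} → e List.∈ old → Live S′ e
            old⇒in = ∈-rowsOf⁻ (live? S′)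

            vanishOn : ∀ {rows} → (∀ {e} → e List.∈ rows → In S′ e × (e List.∈ old ⊎ e List.∈ ns)) →
                       All (VanishesOn rows) (map colE xs ++ map (difference colE) qs)
            vanishOn rows⇒ = Allₚ.++⁺
              (Allₚ.map⁺ (All.tabulate λ x∈ → All.tabulate λ e∈ →
                All.lookup (proj₁ (vanishes (proj₁ (rows⇒ e∈)) (proj₂ (rows⇒ e∈)))) x∈))
              (Allₚ.map⁺ (All.tabulate λ q∈ → All.tabulate λ e∈ →
                All.lookup (proj₂ (vanishes (proj₁ (rows⇒ e∈)) (proj₂ (rows⇒ e∈)))) q∈))

            fs≢0 : per ns (map (colE ∘ connector) ns) ≢ 0ℤ
            fs≢0 = per-diagonal≢0 (colE ∘ connector) ns (All.map connector≢0 news) (pairs news ns!)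
              where
              pairs : ∀ {ns} → All New ns → Unique ns → AllPairs (λ r s → colE (connector s) r ≡ 0ℤ) ns
              pairs []            []           = []
              pairs (new ∷ news) (n∉ ∷ ns!) =
                All.tabulate (λ s∈ → connector-vanishes (All.lookup news s∈) (proj₁ new)
                                       (λ { refl → All.lookup n∉ s∈ refl }))
                ∷ pairs news ns!

            -- Block triangular, with diagonal blocks for the old rows, `ns` and `rs`: connectors
            -- vanish on the old rows, `xs` and `qs` on the old rows and on `ns`. The columns `cs`
            -- may have any entries in the rows below their block.
            whole≢0 : per (rowsOf (live? S)) ((map colE cs ++ map colE fs ++ map colE xs) ++ map (difference colE) qs) ≢ 0ℤ
            whole≢0 = subst (_≢ 0ℤ) (trans (sym (per-↭ rows-↭ _)) (cong (per (rowsOf (live? S))) reassoc))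
              (per-block≢0 old (ns ++ rs) (per≢0⇒length≡ old _ (proj₂ (proj₂ (proj₂ claim))))
                (Allₚ.++⁺ (Allₚ.map⁺ (All.tabulate λ n∈ → All.tabulate λ e∈ →
                             connector-vanishes (ns⇒in n∈) (proj₁ (old⇒in e∈))
                               (λ { refl → proj₂ (old⇒in e∈) (proj₁ (proj₂ (ns⇒in n∈))) })))
                          (vanishOn (λ e∈ → proj₁ (old⇒in e∈) , inj₁ e∈)))
                (proj₂ (proj₂ (proj₂ claim)))
                (per-block≢0 ns rs (sym (length-map _ ns))
                  (vanishOn (λ e∈ → proj₁ (ns⇒in e∈) , inj₂ e∈)) fs≢0 per≢0))
              where
              reassoc : map colE cs ++ (map (colE ∘ connector) ns ++ (map colE xs ++ map (difference colE) qs)) ≡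
                        (map colE cs ++ map colE fs ++ map colE xs) ++ map (difference colE) qs
              reassoc = trans
                (cong (λ z → map colE cs ++ (z ++ (map colE xs ++ map (difference colE) qs))) (map-∘ ns))
                (trans (cong (map colE cs ++_) (sym (++-assoc (map colE fs) (map colE xs) _)))
                       (sym (++-assoc (map colE cs) _ _)))

            choice-removed : ∀ {ds qs} → Choice colE ds qs →
              All (λ q → Removed (proj₁ q) × Removed (proj₂ q)) qs → All Removed ds
            choice-removed []                  []               = []
            choice-removed (inj₁ refl ∷ ch) ((r , _) ∷ rest) = r ∷ choice-removed ch rest
            choice-removed (inj₂ refl ∷ ch) ((_ , r) ∷ rest) = r ∷ choice-removed ch rest

          step : Claim k S
          step with resolve colE (rowsOf (live? S)) _ qs whole≢0
          ... | ds , choice , p≢0 = cs ++ (fs ++ (xs ++ ds)) , in-all , counts , subst (λ z → per (rowsOf (live? S)) z ≢ 0ℤ) maps p≢0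
            where
            maps : (map colE cs ++ map colE fs ++ map colE xs) ++ map colE ds ≡ map colE (cs ++ (fs ++ (xs ++ ds)))
            maps = begin
              (map colE cs ++ map colE fs ++ map colE xs) ++ map colE ds
                ≡⟨ ++-assoc (map colE cs) _ _ ⟩
              map colE cs ++ ((map colE fs ++ map colE xs) ++ map colE ds)
                ≡⟨ cong (map colE cs ++_) (++-assoc (map colE fs) _ _) ⟩
              map colE cs ++ (map colE fs ++ (map colE xs ++ map colE ds))
                ≡⟨ cong (λ z → map colE cs ++ (map colE fs ++ z)) (sym (map-++ colE xs ds)) ⟩
              map colE cs ++ (map colE fs ++ map colE (xs ++ ds))
                ≡⟨ cong (map colE cs ++_) (sym (map-++ colE fs _)) ⟩
              map colE cs ++ map colE (fs ++ (xs ++ ds))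
                ≡⟨ sym (map-++ colE cs _) ⟩
              map colE (cs ++ (fs ++ (xs ++ ds))) ∎
              where open ≡-Reasoning
            fs-removed : All Removed fs
            fs-removed = Allₚ.map⁺ (All.map (λ new → let (c∈ , _ , meets) = connector-connects new in c∈ , meets) news)
            removed : All Removed (fs ++ (xs ++ ds))
            removed = Allₚ.++⁺ fs-removed (Allₚ.++⁺ xs-removed (choice-removed choice qs-removed))
            in-all : All (In S) (cs ++ (fs ++ (xs ++ ds)))
            in-all = Allₚ.++⁺ (All.map in⁻ (proj₁ (proj₂ claim))) (All.map proj₁ removed)
            -- The columns `cs` avoid `u` and `v`, and all the added ones meet `u` or `v`, so no
            -- edge is counted in both parts.
            counts : ∀ e → count e (cs ++ (fs ++ (xs ++ ds))) ≤ k
            counts e with meets? e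
            ... | yes meets = subst (_≤ k) (sym (trans (count-++ e cs _)
                    (cong₂ ℕ._+_ (count-∉ (λ e∈ → in-avoids (All.lookup (proj₁ (proj₂ claim)) e∈) meets))
                                 (count-++ e fs _)))) (count≤ ds choice e)
            ... | no ¬meets = subst (_≤ k) (sym (trans (count-++ e cs _)
                    (trans (cong (count e cs ℕ.+_) (count-∉ (λ e∈ → ¬meets (proj₂ (All.lookup removed e∈)))))
                           (ℕₚ.+-identityʳ _)))) (proj₁ (proj₂ (proj₂ claim)) e)

      -- Two vertices at distance 2

      choice-replicate : ∀ {ds} d {a b} → Choice colE ds (replicate d (a , b)) →
                         length ds ≡ d × All (λ c → c ≡ a ⊎ c ≡ b) ds
      choice-replicate zero    []         = refl , []
      choice-replicate (suc d) (c ∷ choice) with choice-replicate d choice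
      ... | len , all = cong suc len , c ∷ all

      module Distant (S : Subset n) {u v w : Fin n} (u≢v : u ≢ v) (u≢w : u ≢ w) (v≢w : v ≢ w)
                     {a b : Fin m} (a∈S : In S a) (u∈a : Touch u a) (w∈a : Touch w a)
                     (b∈S : In S b) (v∈b : Touch v b) (w∈b : Touch w b)
                     (apart : ∀ {e} → In S e → Touch u e → Touch v e → ⊥) where

        -- An isolated edge at `u` or `v` would equal one of `a` and `b`, hence both as these meet
        -- in `w`, and would join `u` to `v`.
        busy : ∀ {e} → In S e → Touch u e ⊎ Touch v e → ¬ Isolated S e
        busy e∈S (inj₁ u∈e) iso with iso a a∈S (u , u∈e , u∈a)
        ... | refl with iso b b∈S (w , w∈a , w∈b)
        ...   | refl = apart a∈S u∈a v∈b
        busy e∈S (inj₂ v∈e) iso with iso b b∈S (v , v∈e , v∈b)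
        ... | refl with iso a a∈S (w , w∈b , w∈a)
        ...   | refl = apart a∈S u∈a v∈b

        open Removal S u v u≢v busy

        module _ {k : ℕ} (claim : Claim k S′) (d≤k : length (rowsOf removed?) ≤ k) where

          private
            d = length (rowsOf removed?)
            qs = replicate d (a , b)

            a-removed : Removed a
            a-removed = a∈S , inj₁ u∈a

            b-removed : Removed b
            b-removed = b∈S , inj₂ v∈b

            1≤k : 1 ≤ k
            1≤k = ℕₚ.≤-trans (∈-length (∈-rowsOf⁺ removed? a-removed)) d≤k

            removed≢0 : per (rowsOf removed?) (map (difference colE) qs) ≢ 0ℤ
            removed≢0 = subst (λ z → per (rowsOf removed?) z ≢ 0ℤ) (sym (map-replicate (difference colE) d (a , b)))
              (per-replicate≢0 (rowsOf removed?) (difference colE (a , b))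
                (all-rowsOf removed? λ (_ , meets) →
                  dipole≢0 u≢v meets ∘ trans (sym (difference≡dipole u≢w v≢w u∈a w∈a v∈b w∈b _))))

            difference-vanishes : ∀ {e} → In S′ e → difference colE (a , b) e ≡ 0ℤ
            difference-vanishes e∈ = trans (difference≡dipole u≢w v≢w u∈a w∈a v∈b w∈b _)
                                           (dipole-away (awayᵘ e∈) (awayᵛ e∈))

            -- The connector has an end on `e`, whereas the ends of `a` and `b` are among `u`, `v`
            -- and `w`, none of which lies on `e`.
            no-clash : ∀ {e} → New e → Away w e → ¬ (connector e ≡ a ⊎ connector e ≡ b)
            no-clash {e} new@(e∈ , _) w∉e = λ
              { (inj₁ eq) → clash (awayᵘ e∈) (touch-two u≢w u∈a w∈a (subst (Touch x) eq x∈f))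
              ; (inj₂ eq) → clash (awayᵛ e∈) (touch-two v≢w v∈b w∈b (subst (Touch x) eq x∈f)) }
              where
              open Bridge (bridge new)
              clash : ∀ {y} → Away y e → x ≡ y ⊎ x ≡ w → ⊥
              clash y∉e (inj₁ x≡y) = y∉e (subst (λ z → Touch z e) x≡y x∈e)
              clash y∉e (inj₂ x≡w) = w∉e (subst (λ z → Touch z e) x≡w x∈e)

            counts : ∀ {ns ys} → All New ns → Unique ns → All (Away w) ns → All (λ c → c ≡ a ⊎ c ≡ b) ys →
                     ∀ e → count e ys ≤ k → count e (map connector ns) ℕ.+ count e ys ≤ k
            counts {ns} {ys} news ns! away ab e ≤k with member? Finₚ._≟_ e (map connector ns)
            ... | no e∉  = subst (_≤ k) (sym (cong (ℕ._+ count e ys) (count-∉ e∉))) ≤k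
            ... | yes e∈ with ∈-map⁻ connector e∈
            ...   | n , n∈ , refl = subst (_≤ k)
              (sym (trans (cong (count e (map connector ns) ℕ.+_)
                            (count-∉ (λ e∈ys → no-clash (All.lookup news n∈) (All.lookup away n∈) (All.lookup ab e∈ys))))
                          (ℕₚ.+-identityʳ _)))
              (ℕₚ.≤-trans (count-unique≤1 (connectors! news ns!)) 1≤k)

          unobstructed : (∀ {e} → New e → Away w e) → Claim k S
          unobstructed w∉new = Step.step news (rowsOf! new?) live-↭ claim [] qs []
            (Allₚ.replicate⁺ d (a-removed , b-removed))
            (λ e∈ _ → [] , Allₚ.replicate⁺ d (difference-vanishes e∈))
            removed≢0
            (λ ds choice e → let (len , ab) = choice-replicate d choice in
              counts news (rowsOf! new?) (all-rowsOf new? w∉new) ab e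
                (ℕₚ.≤-trans (length-filter (Finₚ._≟ e) ds) (subst (_≤ k) (sym len) d≤k)))
            where
            news : All New (rowsOf new?)
            news = all-rowsOf new? (λ new → new)

          -- Now `a` or `b` may be the connector of `n₀`, so the row `n₀` joins the removed rows and
          -- gets the column `a` explicitly. As `n₀` is isolated, no other new edge touches `w`, and
          -- the remaining connectors differ from `a` and `b`.
          obstructed : ∀ {n₀} → New n₀ → Touch w n₀ → Claim k S
          obstructed {n₀} new₀@(n₀∈ , iso₀ , _) w∈n₀ = from-block block
            where
            lemma : ∀ x → x ≡ x ℤ.* 1ℤ ℤ.+ 0ℤ
            lemma = solve-∀
            -- The differences are resolved inside this block and not in the whole matrix: the
            -- argument below looks at the row `a`, in which the columns from the induction
            -- hypothesis could have nonzero entries.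
            block : ∃[ ds ] (Choice colE ds qs × per (n₀ ∷ rowsOf removed?) (map colE (a ∷ ds)) ≢ 0ℤ)
            block = resolve colE (n₀ ∷ rowsOf removed?) (colE a ∷ []) qs
              (per-block≢0 (n₀ ∷ []) (rowsOf removed?) {colE a ∷ []} refl
                (Allₚ.map⁺ (Allₚ.replicate⁺ d (difference-vanishes n₀∈ ∷ [])))
                (λ eq → colE≢0 (u≢w ∘ sym) w∈a u∈a w∈n₀ (awayᵘ n₀∈) (trans (lemma (colE a n₀)) eq)) removed≢0)
            from-block : ∃[ ds ] (Choice colE ds qs × per (n₀ ∷ rowsOf removed?) (map colE (a ∷ ds)) ≢ 0ℤ) → Claim k S
            from-block (ds , choice , block≢0) = Step.step news ns! rows-↭ claim (a ∷ ds) []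
              (a-removed ∷ All.map (λ { (inj₁ refl) → a-removed ; (inj₂ refl) → b-removed }) ab)
              []
              -- The columns `a` and `b` vanish here individually, not just their difference,
              -- because `n₀` is the only edge of `S′` at `w`.
              (λ {e} e∈ old⊎new → let w∉e = away e∈ (≢n₀ old⊎new) in
                 colE-away u≢w u∈a w∈a (awayᵘ e∈) w∉e
                 ∷ All.map (λ { (inj₁ refl) → colE-away u≢w u∈a w∈a (awayᵘ e∈) w∉e
                              ; (inj₂ refl) → colE-away v≢w v∈b w∈b (awayᵛ e∈) w∉e }) ab
                 , [])
              (subst (λ z → per (n₀ ∷ rowsOf removed?) z ≢ 0ℤ) (sym (++-identityʳ (map colE (a ∷ ds)))) block≢0)
              (λ { .[] [] e → subst (λ z → count e (map connector ns) ℕ.+ count e z ≤ k) (sym (++-identityʳ (a ∷ ds)))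
                     (counts news ns! (All.tabulate λ n∈ → away (proj₁ (All.lookup news n∈)) (≢n₀ (inj₂ n∈)))
                             (inj₁ refl ∷ ab) e (ℕₚ.≤-trans (count≤d e) d≤k)) })
              where
              ab : All (λ c → c ≡ a ⊎ c ≡ b) ds
              ab = proj₂ (choice-replicate d choice)
              len : length ds ≡ d
              len = proj₁ (choice-replicate d choice)
              other? = except? new? n₀
              ns = rowsOf other?
              news : All New ns
              news = all-rowsOf other? proj₁
              ns! : Unique ns
              ns! = rowsOf! other?
              ≢n₀ : ∀ {e} → e List.∈ rowsOf (live? S′) ⊎ e List.∈ ns → e ≢ n₀
              ≢n₀ (inj₁ e∈) refl = proj₂ (∈-rowsOf⁻ (live? S′) e∈) iso₀
              ≢n₀ (inj₂ e∈)      = proj₂ (∈-rowsOf⁻ other? e∈)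
              away : ∀ {e} → In S′ e → e ≢ n₀ → Away w e
              away e∈ e≢n₀ w∈e = e≢n₀ (iso₀ _ e∈ (w , w∈n₀ , w∈e))
              rows-↭ : rowsOf (live? S) ↭ rowsOf (live? S′) ++ (ns ++ (n₀ ∷ rowsOf removed?))
              rows-↭ = ↭-trans live-↭ (++⁺ˡ (rowsOf (live? S′))
                (↭-trans (++⁺ʳ (rowsOf removed?) (rowsOf-extract new? new₀)) (↭-sym (shift n₀ ns (rowsOf removed?)))))
              -- The row a vanishes in the column a, so not all of the ds equal a.
              not-all-a : ¬ All (_≡ a) ds
              not-all-a all = block≢0 (per-zeroRow {rs = n₀ ∷ rowsOf removed?} {map colE (a ∷ ds)} (there (∈-rowsOf⁺ removed? a-removed))
                (colE-self a ∷ Allₚ.map⁺ {f = colE} (All.map (λ { refl → colE-self a }) all)))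
              -- The additional copy of `a` is compensated by a column of `ds` other than `a`; for
              -- every other edge the length of `ds` is bound enough.
              count≤d : ∀ e → count e (a ∷ ds) ≤ d
              count≤d e with a Finₚ.≟ e
              ... | no a≢e   = subst (count e ds ≤_) len (length-filter (Finₚ._≟ e) ds)
              ... | yes refl = subst (suc (count a ds) ≤_) len
                (filter-notAll (Finₚ._≟ a) ds (Allₚ.¬All⇒Any¬ (Finₚ._≟ a) ds not-all-a))

          distant : Claim k S
          distant with Finₚ.any? (λ e → new? e ×-dec touch? w e)
          ... | yes (n₀ , new , w∈n₀) = obstructed new w∈n₀
          ... | no none = unobstructed (λ new w∈e → none (_ , new , w∈e))

      -- Two adjacent vertices in a disjoint union of cliques

      -- Adjacency in `S` is transitive on distinct vertices, so that `S` induces a disjoint union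
      -- of cliques; expressed through edges and their ends.
      Transitive : Subset n → Set
      Transitive S = ∀ {x y z e f} → x ≢ y → y ≢ z → x ≢ z → In S e → Touch x e → Touch y e →
                     In S f → Touch y f → Touch z f → ∃[ g ] (In S g × Touch x g × Touch z g)

      module Clustered (S : Subset n) (transitive : Transitive S) {e₀ : Fin m} (live : Live S e₀) where

        u v : Fin n
        u = tail e₀
        v = head e₀

        u≢v : u ≢ v
        u≢v = loopless e₀

        u∈e₀ : Touch u e₀
        u∈e₀ = inj₁ refl

        v∈e₀ : Touch v e₀
        v∈e₀ = inj₂ refl

        busy : ∀ {e} → In S e → Touch u e ⊎ Touch v e → ¬ Isolated S e
        busy e∈ (inj₁ u∈e) iso with iso e₀ (proj₁ live) (u , u∈e , u∈e₀)
        ... | refl = proj₂ live iso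
        busy e∈ (inj₂ v∈e) iso with iso e₀ (proj₁ live) (v , v∈e , v∈e₀)
        ... | refl = proj₂ live iso

        open Removal S u v u≢v busy

        Leg : Fin n → Fin n → Fin m → Set
        Leg p q e = In S e × Touch p e × Away q e

        Mates : Fin m → Fin m → Set
        Mates a b = ∃[ w ] (u ≢ w × v ≢ w × Touch w a × Touch w b)

        third : ∀ {p q e x} → p ≢ q → q ≢ x → Touch p e → Touch x e → p ≢ x → Away q e
        third p≢q q≢x p∈e x∈e p≢x q∈e = [ p≢q ∘ sym , q≢x ]′ (touch-two p≢x p∈e x∈e q∈e)

        other-tip : ∀ {p q e} → Leg p q e → ∃[ w ] (p ≢ w × q ≢ w × Touch w e)
        other-tip (e∈ , p∈e , q∉e) with other-end p∈e
        ... | w , p≢w , w∈e = w , p≢w , (λ { refl → q∉e w∈e }) , w∈e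

        mateᵘ : ∀ {a} → Leg u v a → ∃[ b ] (Leg v u b × Mates a b)
        mateᵘ leg@(a∈ , u∈a , v∉a) with other-tip leg
        ... | w , u≢w , v≢w , w∈a
          with transitive (u≢v ∘ sym) u≢w v≢w (proj₁ live) v∈e₀ u∈e₀ a∈ u∈a w∈a
        ...   | b , b∈ , v∈b , w∈b =
          b , (b∈ , v∈b , third (u≢v ∘ sym) u≢w v∈b w∈b v≢w) , w , u≢w , v≢w , w∈a , w∈b

        mateᵛ : ∀ {b} → Leg v u b → ∃[ a ] (Leg u v a × Mates a b)
        mateᵛ leg@(b∈ , v∈b , u∉b) with other-tip leg
        ... | w , v≢w , u≢w , w∈b
          with transitive u≢v v≢w u≢w (proj₁ live) u∈e₀ v∈e₀ b∈ v∈b w∈b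
        ...   | a , a∈ , u∈a , w∈a =
          a , (a∈ , u∈a , third u≢v v≢w u∈a w∈a u≢w) , w , u≢w , v≢w , w∈a , w∈b

        mate-unique : ∀ {a b b′} → Leg u v a → Leg v u b → Leg v u b′ → Mates a b → Mates a b′ → b ≡ b′
        mate-unique (_ , u∈a , _) (_ , v∈b , _) (_ , v∈b′ , _)
                    (w , u≢w , v≢w , w∈a , w∈b) (w′ , u≢w′ , v≢w′ , w′∈a , w′∈b′)
          with touch-two u≢w u∈a w∈a w′∈a
        ... | inj₁ refl = contradiction refl u≢w′
        ... | inj₂ refl = simple v≢w v∈b w∈b v∈b′ w′∈b′

        leg-unique : ∀ {a a′ b} → Leg u v a → Leg u v a′ → Leg v u b → Mates a b → Mates a′ b → a ≡ a′
        leg-unique (_ , u∈a , _) (_ , u∈a′ , _) (_ , v∈b , _)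
                   (w , u≢w , v≢w , w∈a , w∈b) (w′ , u≢w′ , v≢w′ , w′∈a′ , w′∈b)
          with touch-two v≢w v∈b w∈b w′∈b
        ... | inj₁ refl = contradiction refl v≢w′
        ... | inj₂ refl = simple u≢w u∈a w∈a u∈a′ w′∈a′

        abstract
          leg? : ∀ p q e → Dec (Leg p q e)
          leg? p q e = in? S e ×-dec (touch? p e ×-dec ¬? (touch? q e))

          mates? : ∀ a b → Dec (Mates a b)
          mates? a b = Finₚ.any? λ w → ¬? (u Finₚ.≟ w) ×-dec (¬? (v Finₚ.≟ w) ×-dec (touch? w a ×-dec touch? w b))

          partner : Fin m → Fin m
          partner a with Finₚ.any? (λ b → leg? v u b ×-dec mates? a b)
          ... | yes (b , _) = b
          ... | no _        = a

          partner-mates : ∀ {a} → Leg u v a → Leg v u (partner a) × Mates a (partner a)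
          partner-mates {a} leg with Finₚ.any? (λ b → leg? v u b ×-dec mates? a b)
          ... | yes (_ , spec) = spec
          ... | no none        = contradiction (mateᵘ leg) none

        legsᵘ legsᵛ : List (Fin m)
        legsᵘ = rowsOf (leg? u v)
        legsᵛ = rowsOf (leg? v u)

        partner-injective : ∀ {a a′} → Leg u v a → Leg u v a′ → partner a ≡ partner a′ → a ≡ a′
        partner-injective {a} l l′ eq = leg-unique l l′ (proj₁ (partner-mates l′))
          (subst (Mates a) eq (proj₂ (partner-mates l))) (proj₂ (partner-mates l′))

        -- The common neighbours of `u` and `v` match the legs at `u` with those at `v`. The
        -- resulting equality of numbers is what makes the signs sum to 0.
        partners-↭ : map partner legsᵘ ↭ legsᵛ
        partners-↭ = unique-↭
          (unique-map⁺ partner (λ a∈ a′∈ → partner-injective (∈-rowsOf⁻ (leg? u v) a∈) (∈-rowsOf⁻ (leg? u v) a′∈))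
            (rowsOf! (leg? u v)))
          (rowsOf! (leg? v u))
          (λ b∈ → let (a , a∈ , eq) = ∈-map⁻ partner b∈ in
            ∈-rowsOf⁺ (leg? v u) (subst (Leg v u) (sym eq) (proj₁ (partner-mates (∈-rowsOf⁻ (leg? u v) a∈)))))
          (λ {b} b∈ → let leg = ∈-rowsOf⁻ (leg? v u) b∈
                          (a , legᵃ , mates) = mateᵛ leg
                          (legᵇ , mates′) = partner-mates legᵃ in
            subst (List._∈ map partner legsᵘ) (mate-unique legᵃ legᵇ leg mates′ mates)
                  (∈-map⁺ partner (∈-rowsOf⁺ (leg? u v) legᵃ)))

        length-legs : length legsᵘ ≡ length legsᵛ
        length-legs = trans (sym (length-map partner legsᵘ)) (↭-length partners-↭)

        removed-↭ : rowsOf removed? ↭ e₀ ∷ (legsᵘ ++ legsᵛ)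
        removed-↭ = unique-↭ (rowsOf! removed?)
          (All.tabulate e₀∉ ∷ Uniqueₚ.++⁺ (rowsOf! (leg? u v)) (rowsOf! (leg? v u))
            (λ (∈u , ∈v) → proj₂ (proj₂ (∈-rowsOf⁻ (leg? v u) ∈v)) (proj₁ (proj₂ (∈-rowsOf⁻ (leg? u v) ∈u)))))
          (λ e∈ → to (∈-rowsOf⁻ removed? e∈)) from
          where
          e₀∉ : ∀ {e} → e List.∈ legsᵘ ++ legsᵛ → e₀ ≢ e
          e₀∉ e∈ refl with ∈-++⁻ legsᵘ e∈
          ... | inj₁ ∈u = proj₂ (proj₂ (∈-rowsOf⁻ (leg? u v) ∈u)) v∈e₀
          ... | inj₂ ∈v = proj₂ (proj₂ (∈-rowsOf⁻ (leg? v u) ∈v)) u∈e₀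
          to : ∀ {e} → Removed e → e List.∈ e₀ ∷ (legsᵘ ++ legsᵛ)
          to {e} (e∈ , meets) with touch? u e | touch? v e
          ... | yes u∈e | yes v∈e = here (simple u≢v u∈e v∈e u∈e₀ v∈e₀)
          ... | yes u∈e | no  v∉e = there (∈-++⁺ˡ (∈-rowsOf⁺ (leg? u v) (e∈ , u∈e , v∉e)))
          ... | no  u∉e | yes v∈e = there (∈-++⁺ʳ legsᵘ (∈-rowsOf⁺ (leg? v u) (e∈ , v∈e , u∉e)))
          ... | no  u∉e | no  v∉e = contradiction meets [ u∉e , v∉e ]′
          from : ∀ {e} → e List.∈ e₀ ∷ (legsᵘ ++ legsᵛ) → e List.∈ rowsOf removed?
          from (here refl) = ∈-rowsOf⁺ removed? (proj₁ live , inj₁ u∈e₀)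
          from (there e∈) with ∈-++⁻ legsᵘ e∈
          ... | inj₁ ∈u = let (e∈ , u∈e , _) = ∈-rowsOf⁻ (leg? u v) ∈u in ∈-rowsOf⁺ removed? (e∈ , inj₁ u∈e)
          ... | inj₂ ∈v = let (e∈ , v∈e , _) = ∈-rowsOf⁻ (leg? v u) ∈v in ∈-rowsOf⁺ removed? (e∈ , inj₂ v∈e)

        -- On a leg, the sign by which the column of `e₀` differs from the dipole: only one end of
        -- `e₀` lies on the leg, and the dipole counts `u` positively and `v` negatively.
        ε : Fin m → ℤ
        ε e = if does (touch? u e) then 1ℤ else ℤ.- 1ℤ

        εᵘ : ∀ {e} → Touch u e → ε e ≡ 1ℤ
        εᵘ {e} u∈e = cong (λ b → if b then 1ℤ else ℤ.- 1ℤ) (dec-true (touch? u e) u∈e)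

        εᵛ : ∀ {e} → Away u e → ε e ≡ ℤ.- 1ℤ
        εᵛ {e} u∉e = cong (λ b → if b then 1ℤ else ℤ.- 1ℤ) (dec-false (touch? u e) u∉e)

        open TwoColumns (colE e₀) (dipole u v) ε

        scaledᵘ : ∀ {e} → Leg u v e → Scaled e
        scaledᵘ {e} (_ , u∈e , v∉e) rewrite εᵘ u∈e =
          trans (colE-tip u≢v u∈e₀ v∈e₀ v∉e) (trans (sym (dipole-tip {u} v∉e)) (sym (ℤₚ.*-identityˡ _))) , refl

        scaledᵛ : ∀ {e} → Leg v u e → Scaled e
        scaledᵛ {e} (_ , v∈e , u∉e) rewrite εᵛ u∉e =
          trans (colE-tip (u≢v ∘ sym) v∈e₀ u∈e₀ u∉e)
            (trans (sym (dipole-tip {v} u∉e)) (trans (dipole-swap v u e) (sym (ℤₚ.-1*i≡-i _)))) , refl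

        scaled : All Scaled (legsᵘ ++ legsᵛ)
        scaled = Allₚ.++⁺ (all-rowsOf (leg? u v) scaledᵘ) (all-rowsOf (leg? v u) scaledᵛ)

        dipoles≢0 : All (λ e → dipole u v e ≢ 0ℤ) (legsᵘ ++ legsᵛ)
        dipoles≢0 = Allₚ.++⁺ (all-rowsOf (leg? u v) λ (_ , u∈e , _) → dipole≢0 u≢v (inj₁ u∈e))
                             (all-rowsOf (leg? v u) λ (_ , v∈e , _) → dipole≢0 u≢v (inj₂ v∈e))

        e₁-++ : ∀ xs ys → e₁ (xs ++ ys) ≡ e₁ xs ℤ.+ e₁ ys
        e₁-++ []       ys = sym (ℤₚ.+-identityˡ _)
        e₁-++ (x ∷ xs) ys = trans (cong (ℤ._+_ (ε x)) (e₁-++ xs ys)) (sym (ℤₚ.+-assoc (ε x) (e₁ xs) (e₁ ys)))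

        e₁-const : ∀ {c xs} → All (λ e → ε e ≡ c) xs → e₁ xs ≡ + length xs ℤ.* c
        e₁-const {c} []            = refl
        e₁-const {c} {x ∷ xs} (eq ∷ eqs) = trans (cong₂ ℤ._+_ eq (e₁-const eqs)) (lemma c (+ length xs))
          where
          lemma : ∀ c l → c ℤ.+ l ℤ.* c ≡ (1ℤ ℤ.+ l) ℤ.* c
          lemma = solve-∀

        e₁≡0 : e₁ (legsᵘ ++ legsᵛ) ≡ 0ℤ
        e₁≡0 = begin
          e₁ (legsᵘ ++ legsᵛ)       ≡⟨ e₁-++ legsᵘ legsᵛ ⟩
          e₁ legsᵘ ℤ.+ e₁ legsᵛ     ≡⟨ cong₂ ℤ._+_ (e₁-const (all-rowsOf (leg? u v) λ (_ , u∈e , _) → εᵘ u∈e))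
                                                   (e₁-const (all-rowsOf (leg? v u) λ (_ , _ , u∉e) → εᵛ u∉e)) ⟩
          + length legsᵘ ℤ.* 1ℤ ℤ.+ + length legsᵛ ℤ.* ℤ.- 1ℤ
            ≡⟨ cong (λ l → + l ℤ.* 1ℤ ℤ.+ + length legsᵛ ℤ.* ℤ.- 1ℤ) length-legs ⟩
          + length legsᵛ ℤ.* 1ℤ ℤ.+ + length legsᵛ ℤ.* ℤ.- 1ℤ
            ≡⟨ lemma (+ length legsᵛ) ⟩
          0ℤ ∎
          where
          open ≡-Reasoning
          lemma : ∀ l → l ℤ.* 1ℤ ℤ.+ l ℤ.* ℤ.- 1ℤ ≡ 0ℤ
          lemma = solve-∀

        pair : Fin m → Fin m × Fin m
        pair a = a , partner a

        pair≡dipole : ∀ {a} → Leg u v a → ∀ e → difference colE (pair a) e ≡ dipole u v e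
        pair≡dipole leg@(_ , u∈a , _) with partner-mates leg
        ... | (_ , v∈b , _) , _ , u≢w , v≢w , w∈a , w∈b = difference≡dipole u≢w v≢w u∈a w∈a v∈b w∈b

        agree : ∀ {rows as} → All (Leg u v) as →
                Pointwise (AgreeOn rows) (map (difference colE) (map pair as)) (replicate (length as) (dipole u v))
        agree []           = []
        agree (leg ∷ legs) = All.universal (pair≡dipole leg) _ ∷ agree legs

        -- The column of `e₀` is 0 in its own row, so this row takes one of the `suc j` dipoles. The
        -- legs keep both columns of `e₀` and `j` dipoles, which is the case of `per₂≢0`.
        block≢0 : ∀ {j as} → All (Leg u v) as → length as ≡ suc j → length (legsᵘ ++ legsᵛ) ≡ suc (suc j) →
                  per (rowsOf removed?) (map colE (e₀ ∷ e₀ ∷ []) ++ map (difference colE) (map pair as)) ≢ 0ℤ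
        block≢0 {j} {as} legs len len′ eq = i*j≢0 {+ suc j} (λ ())
          (i*j≢0 (dipole≢0 u≢v (inj₁ u∈e₀)) (per₂≢0 (legsᵘ ++ legsᵛ) len′ scaled dipoles≢0 e₁≡0))
          (trans (sym value) eq)
          where
          open ≡-Reasoning
          C D : Fin m → ℤ
          C = colE e₀
          D = dipole u v
          rs = legsᵘ ++ legsᵛ
          lemma : ∀ x y → 0ℤ ℤ.* x ℤ.+ (0ℤ ℤ.* x ℤ.+ y) ≡ y
          lemma = solve-∀
          value : per (rowsOf removed?) (C ∷ C ∷ map (difference colE) (map pair as)) ≡
                  + suc j ℤ.* (D e₀ ℤ.* per rs (C ∷ C ∷ replicate j D))
          value = begin
            per (rowsOf removed?) (C ∷ C ∷ map (difference colE) (map pair as))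
              ≡⟨ per-↭ removed-↭ (C ∷ C ∷ map (difference colE) (map pair as)) ⟩
            per (e₀ ∷ rs) (C ∷ C ∷ map (difference colE) (map pair as))
              ≡⟨ per-cong (e₀ ∷ rs) {C ∷ C ∷ map (difference colE) (map pair as)} {C ∷ C ∷ replicate (length as) D} (All.universal (λ _ → refl) _ ∷ All.universal (λ _ → refl) _ ∷ agree legs) ⟩
            per (e₀ ∷ rs) (C ∷ C ∷ replicate (length as) D)
              ≡⟨ cong (λ l → per (e₀ ∷ rs) (C ∷ C ∷ replicate l D)) len ⟩
            per (e₀ ∷ rs) (C ∷ C ∷ replicate (suc j) D)
              ≡⟨ cong (λ z → z ℤ.* per rs (C ∷ replicate (suc j) D) ℤ.+ (z ℤ.* per rs (C ∷ replicate (suc j) D) ℤ.+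
                             expand e₀ (replicate (suc j) D) (λ es → per rs (C ∷ C ∷ es)))) (colE-self e₀) ⟩
            0ℤ ℤ.* per rs (C ∷ replicate (suc j) D) ℤ.+ (0ℤ ℤ.* per rs (C ∷ replicate (suc j) D) ℤ.+
              expand e₀ (replicate (suc j) D) (λ es → per rs (C ∷ C ∷ es)))
              ≡⟨ lemma (per rs (C ∷ replicate (suc j) D)) _ ⟩
            expand e₀ (replicate (suc j) D) (λ es → per rs (C ∷ C ∷ es))
              ≡⟨ expand-replicate e₀ D j (λ es → per rs (C ∷ C ∷ es)) ⟩
            + suc j ℤ.* (D e₀ ℤ.* per rs (C ∷ C ∷ replicate j D)) ∎

        -- A leg whose end w other than u lies on the connectors of all new isolated edges.
        record Hub : Set where
          field
            {a} : Fin m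
            {w} : Fin n
            leg : Leg u v a
            u≢w : u ≢ w
            v≢w : v ≢ w
            w∈a : Touch w a
            w∈connector : ∀ {e} → New e → Touch w (connector e)

        legTo : ∀ {x z f} → u ≢ x → v ≢ x → z ≡ u ⊎ z ≡ v → In S f → Touch x f → Touch z f →
                ∃[ a ] (Leg u v a × Touch x a)
        legTo u≢x v≢x (inj₁ refl) f∈ x∈f u∈f = _ , (f∈ , u∈f , third u≢v v≢x u∈f x∈f u≢x) , x∈f
        legTo u≢x v≢x (inj₂ refl) f∈ x∈f v∈f
          with transitive u≢v v≢x u≢x (proj₁ live) u∈e₀ v∈e₀ f∈ v∈f x∈f
        ... | a , a∈ , u∈a , x∈a = a , (a∈ , u∈a , third u≢v v≢x u∈a x∈a u≢x) , x∈a

        bridgeLeg : ∀ {e} (new : New e) → u ≢ Bridge.x (bridge new) × v ≢ Bridge.x (bridge new) ×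
                    ∃[ a ] (Leg u v a × Touch (Bridge.x (bridge new)) a)
        bridgeLeg {e} new@(e∈ , _) = u≢x , v≢x , legTo u≢x v≢x z≡ (proj₁ (connector-connects new)) x∈f z∈f
          where
          open Bridge (bridge new)
          u≢x : u ≢ x
          u≢x u≡x = awayᵘ e∈ (subst (λ y → Touch y e) (sym u≡x) x∈e)
          v≢x : v ≢ x
          v≢x v≡x = awayᵛ e∈ (subst (λ y → Touch y e) (sym v≡x) x∈e)

        -- Suppose the connectors of two new edges reach them in different vertices x and x′. By
        -- transitivity at `u` there is an edge xx′; it avoids `u` and `v`, and shares an end with
        -- both new edges, so isolation makes both equal to it and their connectors coincide. If
        -- there is no new edge, any leg will do; one exists because `e₀` is live.
        hub : Hub
        hub with Finₚ.any? new?
        ... | no none = fromNeighbour (neighbourEdge (proj₂ live))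
          where
          legAt : ∀ {f} → In S f → f ≢ e₀ → Touch u f ⊎ Touch v f → ∃[ x ] (u ≢ x × v ≢ x × ∃[ a ] (Leg u v a × Touch x a))
          legAt f∈ f≢e₀ (inj₁ u∈f) with other-end u∈f
          ... | x , u≢x , x∈f = x , u≢x , v≢x , legTo u≢x v≢x (inj₁ refl) f∈ x∈f u∈f
            where
            v≢x : v ≢ x
            v≢x refl = f≢e₀ (simple u≢v u∈f x∈f u∈e₀ v∈e₀)
          legAt f∈ f≢e₀ (inj₂ v∈f) with other-end v∈f
          ... | x , v≢x , x∈f = x , u≢x , v≢x , legTo u≢x v≢x (inj₂ refl) f∈ x∈f v∈f
            where
            u≢x : u ≢ x
            u≢x refl = f≢e₀ (simple u≢v x∈f v∈f u∈e₀ v∈e₀)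
          fromNeighbour : ∃[ f ] (In S f × Share e₀ f × f ≢ e₀) → Hub
          fromNeighbour (f , f∈ , (y , y∈e₀ , y∈f) , f≢e₀)
            with legAt f∈ f≢e₀ ([ (λ y≡u → inj₁ (subst (λ z → Touch z f) y≡u y∈f))
                                , (λ y≡v → inj₂ (subst (λ z → Touch z f) y≡v y∈f)) ]′ (touch-two u≢v u∈e₀ v∈e₀ y∈e₀))
          ... | x , u≢x , v≢x , a , leg , x∈a = record
            { leg = leg ; u≢w = u≢x ; v≢w = v≢x ; w∈a = x∈a
            ; w∈connector = λ new → contradiction (_ , new) none }
        ... | yes (n₁ , new₁@(_ , iso₁ , _)) with bridgeLeg new₁
        ...   | u≢x , v≢x , a , leg@(a∈ , u∈a , _) , x∈a = record
          { leg = leg ; u≢w = u≢x ; v≢w = v≢x ; w∈a = x∈a ; w∈connector = on-connector }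
          where
          open Bridge (bridge new₁)
          on-connector : ∀ {e} → New e → Touch x (connector e)
          on-connector {e} new@(_ , iso , _) = compare (bridge new) (bridgeLeg new)
            where
            compare : (B : Bridge e (connector e)) → u ≢ Bridge.x B × v ≢ Bridge.x B ×
                      ∃[ a′ ] (Leg u v a′ × Touch (Bridge.x B) a′) → Touch x (connector e)
            compare B (u≢x′ , v≢x′ , a′ , (a′∈ , u∈a′ , _) , x′∈a′) with x Finₚ.≟ Bridge.x B
            ... | yes x≡x′ = subst (λ y → Touch y (connector e)) (sym x≡x′) (Bridge.x∈f B)
            ... | no x≢x′ with transitive (u≢x ∘ sym) u≢x′ x≢x′ a∈ x∈a u∈a a′∈ u∈a′ x′∈a′
            ...   | g , g∈ , x∈g , x′∈g = subst (λ y → Touch x (connector y)) n₁≡e x∈f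
              where
              g∈′ : In S′ g
              g∈′ = in⁺ g∈ λ
                { (inj₁ u∈g) → [ u≢x , u≢x′ ]′ (touch-two x≢x′ x∈g x′∈g u∈g)
                ; (inj₂ v∈g) → [ v≢x , v≢x′ ]′ (touch-two x≢x′ x∈g x′∈g v∈g) }
              n₁≡e : n₁ ≡ e
              n₁≡e = trans (sym (iso₁ g g∈′ (x , x∈e , x∈g))) (iso g g∈′ (Bridge.x B , Bridge.x∈e B , x′∈g))

        abstract
          theHub : Hub
          theHub = hub

        open Hub theHub renaming (a to a₀; w to w₀; leg to leg₀)

        -- One pair for the hub and two for every other common neighbour. For t common neighbours
        -- these 2t - 1 differences and the two columns of `e₀` match the 2t + 1 removed rows, and
        -- the single use at the hub leaves room for a connector.
        rest legs : List (Fin m)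
        rest = rowsOf (except? (leg? u v) a₀)
        legs = a₀ ∷ (rest ++ rest)

        rest-legs : All (Leg u v) rest
        rest-legs = all-rowsOf (except? (leg? u v) a₀) proj₁

        all-legs : All (Leg u v) legs
        all-legs = leg₀ ∷ Allₚ.++⁺ rest-legs rest-legs

        length-removed : length (legsᵘ ++ legsᵛ) ≡ suc (suc (length (rest ++ rest)))
        length-removed = begin
          length (legsᵘ ++ legsᵛ)           ≡⟨ length-++ legsᵘ ⟩
          length legsᵘ ℕ.+ length legsᵛ     ≡⟨ cong (length legsᵘ ℕ.+_) (sym length-legs) ⟩
          length legsᵘ ℕ.+ length legsᵘ     ≡⟨ cong₂ ℕ._+_ len len ⟩
          suc (length rest) ℕ.+ suc (length rest) ≡⟨ cong suc (ℕₚ.+-suc (length rest) (length rest)) ⟩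
          suc (suc (length rest ℕ.+ length rest)) ≡⟨ cong (suc ∘ suc) (sym (length-++ rest)) ⟩
          suc (suc (length (rest ++ rest))) ∎
          where
          open ≡-Reasoning
          len : length legsᵘ ≡ suc (length rest)
          len = ↭-length (rowsOf-extract (leg? u v) leg₀)

        Uses : Fin m → Fin m → Set
        Uses e a = e ≡ a ⊎ e ≡ partner a

        abstract
          uses? : ∀ e a → Dec (Uses e a)
          uses? e a = (e Finₚ.≟ a) ⊎-dec (e Finₚ.≟ partner a)

        uses-unique : ∀ {e a a′} → Leg u v a → Leg u v a′ → Uses e a → Uses e a′ → a ≡ a′
        uses-unique l l′ (inj₁ refl) (inj₁ refl) = refl
        uses-unique l l′ (inj₂ refl) (inj₂ eq)   = partner-injective l l′ eq
        uses-unique l l′ (inj₁ refl) (inj₂ refl) =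
          contradiction (proj₁ (proj₂ (proj₁ (partner-mates l′)))) (proj₂ (proj₂ l))
        uses-unique l l′ (inj₂ refl) (inj₁ refl) =
          contradiction (proj₁ (proj₂ (proj₁ (partner-mates l)))) (proj₂ (proj₂ l′))

        count-choice : ∀ e {ds as} → Choice colE ds (map pair as) → count e ds ≤ length (filter (uses? e) as)
        count-choice e {as = []}     []            = z≤n
        count-choice e {d ∷ ds} {a ∷ as} (d≡ ∷ choice) with d Finₚ.≟ e | uses? e a
        ... | yes _    | yes _ = s≤s (count-choice e choice)
        ... | no  _    | yes _ = ℕₚ.m≤n⇒m≤1+n (count-choice e choice)
        ... | no  _    | no  _ = count-choice e choice
        ... | yes refl | no ¬uses = contradiction d≡ ¬uses

        uses : Fin m → List (Fin m) → ℕ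
        uses e as = length (filter (uses? e) as)

        uses-rest≤1 : ∀ e → uses e rest ≤ 1
        uses-rest≤1 e = length-filter-unique≤1 (uses? e)
          (λ a∈ a′∈ → uses-unique (All.lookup rest-legs a∈) (All.lookup rest-legs a′∈))
          (rowsOf! (except? (leg? u v) a₀))

        uses-legs : ∀ e → uses e legs ≡ uses e (a₀ ∷ []) ℕ.+ (uses e rest ℕ.+ uses e rest)
        uses-legs e = trans (cong length (filter-++ (uses? e) (a₀ ∷ []) (rest ++ rest)))
          (trans (length-++ (filter (uses? e) (a₀ ∷ [])))
            (cong (uses e (a₀ ∷ []) ℕ.+_)
              (trans (cong length (filter-++ (uses? e) rest rest)) (length-++ (filter (uses? e) rest)))))

        uses-only-a₀ : ∀ {e} → (∀ {a} → Leg u v a → Uses e a → a ≡ a₀) → uses e legs ≤ 1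
        uses-only-a₀ {e} only = subst (_≤ 1)
          (sym (trans (uses-legs e) (trans (cong (λ l → uses e (a₀ ∷ []) ℕ.+ (l ℕ.+ l)) none) (ℕₚ.+-identityʳ _))))
          (length-filter-unique≤1 (uses? e) {a₀ ∷ []} (λ { (here refl) (here refl) _ _ → refl }) ([] ∷ []))
          where
          none : uses e rest ≡ 0
          none = cong length (filter-none (uses? e) (all-rowsOf (except? (leg? u v) a₀)
            (λ (leg , a≢a₀) uses → a≢a₀ (only leg uses))))

        uses≤2 : ∀ e → uses e legs ≤ 2
        uses≤2 e = bound (uses? e a₀)
          where
          bound : Dec (Uses e a₀) → uses e legs ≤ 2
          bound (yes p) = ℕₚ.m≤n⇒m≤1+n (uses-only-a₀ {e} (λ leg q → uses-unique leg leg₀ q p))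
          bound (no ¬p) = subst (_≤ 2)
            (sym (trans (uses-legs e)
              (cong (λ l → length l ℕ.+ (uses e rest ℕ.+ uses e rest)) (filter-reject (uses? e) {xs = []} ¬p))))
            (ℕₚ.+-mono-≤ (uses-rest≤1 e) (uses-rest≤1 e))

        module _ {k : ℕ} (2≤k : 2 ≤ k) (claim : Claim k S′) where

          private
            news = all-rowsOf new? {New} (λ new → new)
            fs = map connector (rowsOf new?)

          clustered : Claim k S
          clustered = Step.step news (rowsOf! new?) live-↭ claim (e₀ ∷ e₀ ∷ []) (map pair legs)
            (e₀-removed ∷ e₀-removed ∷ [])
            (Allₚ.map⁺ (All.map (λ leg@(a∈ , u∈a , _) → let (b∈ , v∈b , _) , _ = partner-mates leg in
                                   (a∈ , inj₁ u∈a) , (b∈ , inj₂ v∈b)) all-legs))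
            (λ e∈ _ → let e₀≡0 = colE-away u≢v u∈e₀ v∈e₀ (awayᵘ e∈) (awayᵛ e∈) in
               e₀≡0 ∷ e₀≡0 ∷ [] ,
               Allₚ.map⁺ (All.map (λ leg → trans (pair≡dipole leg _) (dipole-away (awayᵘ e∈) (awayᵛ e∈))) all-legs))
            (block≢0 all-legs refl length-removed)
            (λ ds choice e → ℕₚ.≤-trans (counts ds choice e) 2≤k)
            where
            e₀-removed : Removed e₀
            e₀-removed = proj₁ live , inj₁ u∈e₀
            e₀-unused : ∀ {a} → Leg u v a → ¬ Uses e₀ a
            e₀-unused (_ , _ , v∉a) (inj₁ refl) = v∉a v∈e₀
            e₀-unused leg (inj₂ eq) = proj₂ (proj₂ (proj₁ (partner-mates leg))) (subst (Touch u) eq u∈e₀)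
            connector≢e₀ : ∀ {n} → New n → connector n ≢ e₀
            connector≢e₀ new eq = [ u≢w ∘ sym , v≢w ∘ sym ]′
              (touch-two u≢v u∈e₀ v∈e₀ (subst (Touch w₀) eq (w∈connector new)))
            connector-uses : ∀ {n a} → New n → Leg u v a → Uses (connector n) a → a ≡ a₀
            connector-uses new (_ , u∈a , _) (inj₁ refl) =
              simple u≢w u∈a (w∈connector new) (proj₁ (proj₂ leg₀)) w∈a
            connector-uses new leg@(_ , u∈a , _) (inj₂ eq) with partner-mates leg
            ... | (_ , v∈b , _) , w , u≢w′ , v≢w′ , w∈a′ , w∈b
              with touch-two v≢w′ v∈b w∈b (subst (Touch w₀) eq (w∈connector new))
            ...   | inj₁ w₀≡v = contradiction (sym w₀≡v) v≢w
            ...   | inj₂ w₀≡w = simple u≢w u∈a (subst (λ y → Touch y _) (sym w₀≡w) w∈a′) (proj₁ (proj₂ leg₀)) w∈a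
            count-ds : ∀ {ds} → Choice colE ds (map pair legs) → ∀ {e} → e ≢ e₀ → count e (e₀ ∷ e₀ ∷ ds) ≡ count e ds
            count-ds choice {e} e≢e₀ = cong length
              (trans (filter-reject (Finₚ._≟ e) (e≢e₀ ∘ sym)) (filter-reject (Finₚ._≟ e) (e≢e₀ ∘ sym)))
            -- A connector is taken once as such, and otherwise only through the pair at the hub,
            -- which is used once. The edge `e₀` is neither a connector nor in a pair, so its two
            -- copies are all. Any other edge lies in at most one pair, used at most twice.
            counts : ∀ ds → Choice colE ds (map pair legs) → ∀ e → count e fs ℕ.+ count e (e₀ ∷ e₀ ∷ ds) ≤ 2
            counts ds choice e with member? Finₚ._≟_ e fs
            ... | yes e∈ with ∈-map⁻ connector e∈
            ...   | n , n∈ , refl = ℕₚ.+-mono-≤ (count-unique≤1 (connectors! news (rowsOf! new?)))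
              (subst (_≤ 1) (sym (count-ds choice (connector≢e₀ (All.lookup news n∈))))
                (ℕₚ.≤-trans (count-choice (connector n) choice)
                            (uses-only-a₀ {connector n} (connector-uses (All.lookup news n∈)))))
            counts ds choice e | no e∉ = subst (λ c → c ℕ.+ count e (e₀ ∷ e₀ ∷ ds) ≤ 2) (sym (count-∉ e∉)) columns
              where
              columns : count e (e₀ ∷ e₀ ∷ ds) ≤ 2
              columns with e Finₚ.≟ e₀
              ... | no e≢e₀  = subst (_≤ 2) (sym (count-ds choice e≢e₀)) (ℕₚ.≤-trans (count-choice e choice) (uses≤2 e))
              ... | yes refl = subst (_≤ 2)
                (sym (cong length (trans (filter-accept (Finₚ._≟ e₀) refl) (cong (e₀ ∷_) (filter-accept (Finₚ._≟ e₀) refl)))))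
                (s≤s (s≤s (subst (count e₀ ds ≤_) (cong length (filter-none (uses? e₀) (All.map e₀-unused all-legs)))
                                 (count-choice e₀ choice))))

      -- The induction over vertex sets

      record DistantPair (k : ℕ) (S : Subset n) : Set where
        field
          {u v w}    : Fin n
          {a b}      : Fin m
          u≢v        : u ≢ v
          u≢w        : u ≢ w
          v≢w        : v ≢ w
          a∈         : In S a
          u∈a        : Touch u a
          w∈a        : Touch w a
          b∈         : In S b
          v∈b        : Touch v b
          w∈b        : Touch w b
          apart      : ∀ {e} → In S e → Touch u e → Touch v e → ⊥
          -- Required for every decision procedure, so that it applies to the abstract `removed?`.
          -- As no edge joins `u` to `v`, the list has length d(u) + d(v).
          degreeSum≤ : (P? : Decidable (λ e → In S e × (Touch u e ⊎ Touch v e))) → length (rowsOf P?) ≤ k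

      touch⇒∈ : ∀ {S e x} → In S e → Touch x e → x ∈ S
      touch⇒∈ (t∈ , _) (inj₁ refl) = t∈
      touch⇒∈ (_ , h∈) (inj₂ refl) = h∈

      module _ {k : ℕ} (2≤k : 2 ≤ k) (reducible : ∀ S → Transitive S ⊎ DistantPair k S) where

        -- Induction on a bound for the size of `S`; the removal of the first of the two vertices
        -- already decreases it.
        claim : ∀ j S → ∣ S ∣ < j → Claim k S
        claim (suc j) S (s≤s ∣S∣≤j) with reducible S
        ... | inj₂ pair = Distant.distant S u≢v u≢w v≢w a∈ u∈a w∈a b∈ v∈b w∈b apart
            (claim j (S - u - v) (ℕₚ.≤-<-trans (∣p─q∣≤∣p∣ (S - u) _)
              (ℕₚ.<-≤-trans (x∈p⇒∣p-x∣<∣p∣ (touch⇒∈ a∈ u∈a)) ∣S∣≤j)))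
            (degreeSum≤ _)
          where open DistantPair pair
        ... | inj₁ transitive with Finₚ.any? (live? S)
        ...   | yes (e₀ , live) = Clustered.clustered S transitive live 2≤k
            (claim j (S - tail e₀ - head e₀) (ℕₚ.≤-<-trans (∣p─q∣≤∣p∣ (S - tail e₀) _)
              (ℕₚ.<-≤-trans (x∈p⇒∣p-x∣<∣p∣ (proj₁ (proj₁ live))) ∣S∣≤j)))
        -- Without live rows the matrix is empty and has permanent 1.
        ...   | no none = [] , [] , (λ _ → z≤n) , subst (λ rows → per rows [] ≢ 0ℤ)
            (sym (filter-none (live? S) (All.universal (λ e live → none (e , live)) (allFin m)))) (λ ())

        bounded-permanent : (∀ e → ¬ Isolated ⊤ e) →
          ∃[ cs ] ((∀ e → count e cs ≤ k) × per (allFin m) (map colE cs) ≢ 0ℤ)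
        bounded-permanent ¬iso with claim (suc ∣ ⊤ {n} ∣) ⊤ ℕₚ.≤-refl
        ... | cs , _ , count≤ , p≢0 = cs , count≤ , subst (λ rows → per rows (map colE cs) ≢ 0ℤ)
          (filter-all (live? ⊤) (All.universal (λ e → (∈⊤ , ∈⊤) , ¬iso e) (allFin m))) p≢0

-- Edges of a graph, degrees and 2-degeneracy

module GraphEdgeColumns where

  open import Defs
  open import Data.Bool.Base using (Bool; true; false; T; if_then_else_)
  open import Data.Bool.Properties using (T?; T-∧; T-≡)
  open import Data.Empty using (⊥)
  open import Data.Fin.Base as Fin using (Fin; zero; suc)
  import Data.Fin.Properties as Finₚ
  open import Data.Fin.Subset using (Subset; _∈_; ∣_∣; ⊤; ⁅_⁆; _∪_)
  open import Data.Fin.Subset.Properties using (∈⊤; x∈p∪q⁻; x∈p∪q⁺; x∈⁅y⁆⇒x≡y; x∈⁅x⁆)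
  open import Data.Integer.Base using (0ℤ)
  open import Data.List.Base as List using (List; []; _∷_; map; filter; foldr; length; allFin; cartesianProduct; mapMaybe)
  import Data.List.Membership.Propositional as List
  open import Data.List.Membership.Propositional.Properties using (∈-filter⁺; ∈-filter⁻; ∈-allFin; ∈-map⁺; ∈-map⁻; ∈-lookup; ∈-cartesianProduct⁺; ∈-++⁺ˡ; ∈-++⁺ʳ)
  open import Data.List.Properties using (length-map; length-++)
  open import Data.List.Relation.Binary.Permutation.Propositional.Properties using (↭-length)
  open import Data.List.Relation.Unary.All as All using (All; []; _∷_)
  open import Data.List.Relation.Unary.AllPairs using ([]; _∷_)
  open import Data.List.Relation.Unary.Any using (here; there; index)
  open import Data.List.Relation.Unary.Any.Properties using (lookup-index)
  open import Data.List.Relation.Unary.Unique.Propositional using (Unique)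
  import Data.List.Relation.Unary.Unique.Propositional.Properties as Uniqueₚ
  open import Data.Maybe.Base using (Maybe; just; nothing)
  open import Data.Nat.Base as ℕ using (ℕ; zero; suc; _≤_; _⊔_; _⊓_; z≤n; s≤s)
  import Data.Nat.Properties as ℕₚ
  open import Data.Product.Base using (∃-syntax; _×_; _,_; proj₁; proj₂)
  open import Data.Sum.Base using (_⊎_; inj₁; inj₂)
  import Data.Vec.Base as Vec
  import Data.Vec.Properties as Vecₚ
  open import Function.Base using (_∘_; id)
  open import Function.Bundles using (mk⇔; Equivalence)
  open import Relation.Binary.Definitions using (tri<; tri≈; tri>)
  open import Relation.Binary.PropositionalEquality
  open import Relation.Nullary.Decidable using (Dec; yes; no; does; _×-dec_)
  open import Relation.Nullary.Negation using (¬_; contradiction)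
  open import Relation.Unary using (Decidable)
  open Permanents
  open Coefficients using (count)
  open Lists
  open EdgeColumns

  lookup-injective : {A : Set} {xs : List A} → Unique xs → ∀ {i j} → List.lookup xs i ≡ List.lookup xs j → i ≡ j
  lookup-injective (_  ∷ _)   {zero}  {zero}  eq = refl
  lookup-injective (x∉ ∷ _)   {zero}  {suc j} eq = contradiction eq (All.lookup x∉ (∈-lookup j))
  lookup-injective (x∉ ∷ _)   {suc i} {zero}  eq = contradiction (sym eq) (All.lookup x∉ (∈-lookup i))
  lookup-injective (_  ∷ xs!) {suc i} {suc j} eq = cong suc (lookup-injective xs! eq)

  length-filter-T : ∀ {A : Set} (f : A → Bool) {k} (g : Fin k → A) →
                    length (filter (T? ∘ f) (List.tabulate g)) ≡ ∣ Vec.tabulate (f ∘ g) ∣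
  length-filter-T f {zero}  g = refl
  length-filter-T f {suc k} g with f (g zero)
  ... | true  = cong suc (length-filter-T f (g ∘ suc))
  ... | false = length-filter-T f (g ∘ suc)

  minimum-∈ : ∀ xs {d} → minimum xs ≡ just d → d List.∈ xs
  minimum-∈ (x ∷ xs) refl = go xs
    where
    go : ∀ xs → foldr _⊓_ x xs List.∈ x ∷ xs
    go []       = here refl
    go (y ∷ ys) with ℕₚ.⊓-sel y (foldr _⊓_ x ys) | go ys
    ... | inj₁ eq | _        = there (here eq)
    ... | inj₂ eq | here p   = here (trans eq p)
    ... | inj₂ eq | there p  = there (there (subst (List._∈ ys) (sym eq) p))

  minimum-nothing : ∀ xs → minimum xs ≡ nothing → xs ≡ []
  minimum-nothing [] refl = refl

  maximum-≥ : ∀ xs {d k} → maximum xs ≡ just k → d List.∈ xs → d ≤ k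
  maximum-≥ (x ∷ xs) refl d∈ = go xs d∈
    where
    go : ∀ xs {d} → d List.∈ x ∷ xs → d ≤ foldr _⊔_ x xs
    go []       (here refl)         = ℕₚ.≤-refl
    go (y ∷ ys) (here refl)         = ℕₚ.≤-trans (go ys (here refl)) (ℕₚ.m≤n⊔m y _)
    go (y ∷ ys) (there (here refl)) = ℕₚ.m≤m⊔n y _
    go (y ∷ ys) (there (there d∈))  = ℕₚ.≤-trans (go ys (there d∈)) (ℕₚ.m≤n⊔m y _)

  ∈-mapMaybe⁺ : {A : Set} (f : A → Maybe ℕ) {xs : List A} {x : A} {y : ℕ} →
                x List.∈ xs → f x ≡ just y → y List.∈ mapMaybe f xs
  ∈-mapMaybe⁺ f {x ∷ xs} (here refl) eq rewrite eq = here refl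
  ∈-mapMaybe⁺ f {x ∷ xs} (there x∈) eq with f x
  ... | nothing = ∈-mapMaybe⁺ f x∈ eq
  ... | just _  = there (∈-mapMaybe⁺ f x∈ eq)

  ∈-mapMaybe⁻ : {A : Set} (f : A → Maybe ℕ) (xs : List A) {y : ℕ} →
                y List.∈ mapMaybe f xs → ∃[ x ] f x ≡ just y
  ∈-mapMaybe⁻ f (x ∷ xs) y∈ with f x in eq | y∈
  ... | nothing | y∈′       = ∈-mapMaybe⁻ f xs y∈′
  ... | just _  | here refl = x , eq
  ... | just _  | there y∈′ = ∈-mapMaybe⁻ f xs y∈′

  ∈-subsets : ∀ {n} (S : Subset n) → S List.∈ subsets n
  ∈-subsets Vec.[]            = here refl
  ∈-subsets (true Vec.∷ S)    = ∈-++⁺ˡ (∈-map⁺ (true Vec.∷_) (∈-subsets S))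
  ∈-subsets {suc n} (false Vec.∷ S) = ∈-++⁺ʳ (map (true Vec.∷_) (subsets n)) (∈-map⁺ (false Vec.∷_) (∈-subsets S))

  foldr-⊔-≥ : ∀ {d xs} → d List.∈ xs → d ≤ foldr _⊔_ 0 xs
  foldr-⊔-≥ {xs = x ∷ xs} (here refl) = ℕₚ.m≤m⊔n x _
  foldr-⊔-≥ {xs = x ∷ xs} (there d∈)  = ℕₚ.≤-trans (foldr-⊔-≥ d∈) (ℕₚ.m≤n⊔m x _)

  module _ {n : ℕ} (H : Graph n) where
    open Graph H using (degree; IsDistance; isDistance?)

    distance-2? : (p : Fin n × Fin n) → Dec (IsDistance (proj₁ p) (proj₂ p) 2)
    distance-2? (u , v) = isDistance? u v 2

    δ₂-just : ∀ {d} → δ₂ H ≡ just d → ∃[ u ] ∃[ v ] (IsDistance u v 2 × degree u ℕ.+ degree v ≡ d)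
    δ₂-just eq with ∈-map⁻ _ (minimum-∈ (map _ _) eq)
    ... | (u , v) , uv∈ , d≡ = u , v , proj₂ (∈-filter⁻ distance-2? {xs = cartesianProduct (allFin n) (allFin n)} uv∈) , sym d≡

    δ₂-nothing : δ₂ H ≡ nothing → ∀ u v → ¬ IsDistance u v 2
    δ₂-nothing eq u v dist with () ← subst ((degree u ℕ.+ degree v) List.∈_) (minimum-nothing (map _ _) eq)
      (∈-map⁺ (λ (u , v) → degree u ℕ.+ degree v)
        (∈-filter⁺ distance-2? (∈-cartesianProduct⁺ (∈-allFin u) (∈-allFin v)) dist))

  module GraphEdges {n : ℕ} (G : Graph n) where

    open Graph G using (Adj; edgeList; size; ends; adj) renaming (sym to adj-sym; irrefl to adj-irrefl)
    open Edges ends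

    edgeList! : Unique edgeList
    edgeList! = Uniqueₚ.filter⁺ _ (Uniqueₚ.cartesianProduct⁺ (Uniqueₚ.allFin⁺ n) (Uniqueₚ.allFin⁺ n))

    ends-spec : ∀ e → tail e Fin.< head e × Adj (tail e) (head e)
    ends-spec e = proj₂ (∈-filter⁻ (λ (u , v) → (u Finₚ.<? v) ×-dec T? (adj u v))
                                   {xs = cartesianProduct (allFin n) (allFin n)} (∈-lookup {xs = edgeList} e))

    loopless : ∀ e → tail e ≢ head e
    loopless e eq = Finₚ.<-irrefl eq (proj₁ (ends-spec e))

    edge< : ∀ {x y} → x Fin.< y → Adj x y → ∃[ e ] ends e ≡ (x , y)
    edge< {x} {y} x<y xy = index ∈edges , sym (lookup-index ∈edges)
      where
      ∈edges : (x , y) List.∈ edgeList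
      ∈edges = ∈-filter⁺ _ (∈-cartesianProduct⁺ (∈-allFin x) (∈-allFin y)) (x<y , xy)

    edge : ∀ {x y} → Adj x y → ∃[ e ] (Touch x e × Touch y e)
    edge {x} {y} xy with Finₚ.<-cmp x y
    ... | tri< x<y _ _ with edge< x<y xy
    ...   | e , eq = e , inj₁ (cong proj₁ eq) , inj₂ (cong proj₂ eq)
    edge {x} {y} xy | tri≈ _ refl _ = contradiction xy adj-irrefl
    edge {x} {y} xy | tri> _ _ y<x with edge< y<x (adj-sym xy)
    ...   | e , eq = e , inj₂ (cong proj₂ eq) , inj₁ (cong proj₁ eq)

    touch⇒adj : ∀ {x y e} → x ≢ y → Touch x e → Touch y e → Adj x y
    touch⇒adj     x≢y (inj₁ refl) (inj₁ refl) = contradiction refl x≢y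
    touch⇒adj {e = e} x≢y (inj₁ refl) (inj₂ refl) = proj₂ (ends-spec e)
    touch⇒adj {e = e} x≢y (inj₂ refl) (inj₁ refl) = adj-sym (proj₂ (ends-spec e))
    touch⇒adj     x≢y (inj₂ refl) (inj₂ refl) = contradiction refl x≢y

    ends≡ : ∀ {x y e} → x Fin.< y → Touch x e → Touch y e → ends e ≡ (x , y)
    ends≡         x<y (inj₁ refl) (inj₁ refl) = contradiction x<y (Finₚ.<-irrefl refl)
    ends≡         x<y (inj₁ refl) (inj₂ refl) = refl
    ends≡ {e = e} x<y (inj₂ refl) (inj₁ refl) = contradiction x<y (Finₚ.<-asym (proj₁ (ends-spec e)))
    ends≡         x<y (inj₂ refl) (inj₂ refl) = contradiction x<y (Finₚ.<-irrefl refl)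

    simple : ∀ {e f x y} → x ≢ y → Touch x e → Touch y e → Touch x f → Touch y f → e ≡ f
    simple {x = x} {y} x≢y x∈e y∈e x∈f y∈f with Finₚ.<-cmp x y
    ... | tri< x<y _ _ = lookup-injective edgeList! (trans (ends≡ x<y x∈e y∈e) (sym (ends≡ x<y x∈f y∈f)))
    ... | tri≈ _ x≡y _ = contradiction x≡y x≢y
    ... | tri> _ _ y<x = lookup-injective edgeList! (trans (ends≡ y<x y∈e x∈e) (sym (ends≡ y<x y∈f x∈f)))

    open Simple loopless simple

    module _ (S : Subset n) where

      open Graph (induced G S) using () renaming (Adj to AdjS; degree to degreeS; IsDistance to IsDistanceS; adj to adjS; irrefl to irreflS)

      T-lookup : ∀ {x} → T (Vec.lookup S x) → x ∈ S
      T-lookup {x} t = Vecₚ.lookup⇒[]= x S (Equivalence.to T-≡ t)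

      lookup-T : ∀ {x} → x ∈ S → T (Vec.lookup S x)
      lookup-T x∈S = Equivalence.from T-≡ (Vecₚ.[]=⇒lookup x∈S)

      in-touch : ∀ {x y e} → x ≢ y → Touch x e → Touch y e → x ∈ S → y ∈ S → In S e
      in-touch x≢y (inj₁ refl) (inj₁ refl) x∈S y∈S = contradiction refl x≢y
      in-touch x≢y (inj₁ refl) (inj₂ refl) x∈S y∈S = x∈S , y∈S
      in-touch x≢y (inj₂ refl) (inj₁ refl) x∈S y∈S = y∈S , x∈S
      in-touch x≢y (inj₂ refl) (inj₂ refl) x∈S y∈S = contradiction refl x≢y

      adjS⁻ : ∀ {x y} → AdjS x y → x ≢ y × ∃[ e ] (In S e × Touch x e × Touch y e)
      adjS⁻ {x} {y} xy with Equivalence.to T-∧ xy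
      ... | tx , rest with Equivalence.to T-∧ rest
      ...   | ty , a with edge a
      ...     | e , x∈e , y∈e = x≢y , e , in-touch x≢y x∈e y∈e (T-lookup tx) (T-lookup ty) , x∈e , y∈e
        where
        x≢y : x ≢ y
        x≢y refl = adj-irrefl a

      adjS⁺ : ∀ {x y e} → x ≢ y → In S e → Touch x e → Touch y e → AdjS x y
      adjS⁺ x≢y e∈ x∈e y∈e = Equivalence.from T-∧ (lookup-T (touch⇒∈ e∈ x∈e) ,
        Equivalence.from T-∧ (lookup-T (touch⇒∈ e∈ y∈e) , touch⇒adj x≢y x∈e y∈e))

      other : Fin n → Fin size → Fin n
      other u e = if does (tail e Finₚ.≟ u) then head e else tail e

      other-spec : ∀ {u e} → Touch u e → u ≢ other u e × Touch (other u e) e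
      other-spec {u} {e} u∈e with tail e Finₚ.≟ u | u∈e
      ... | yes refl | _         = loopless e , inj₂ refl
      ... | no t≢u   | inj₁ t≡u  = contradiction t≡u t≢u
      ... | no t≢u   | inj₂ refl = (t≢u ∘ sym) , inj₁ refl

      other≡ : ∀ {u x e} → u ≢ x → Touch u e → Touch x e → other u e ≡ x
      other≡ u≢x u∈e x∈e with touch-two u≢x u∈e x∈e (proj₂ (other-spec u∈e))
      ... | inj₁ eq = contradiction (sym eq) (proj₁ (other-spec u∈e))
      ... | inj₂ eq = eq

      -- Taking the other end is a bijection from the edges at `u` to its neighbours; it is
      -- injective because the graph is simple.
      degree≡ : ∀ u (Q? : Decidable (λ e → In S e × Touch u e)) → length (rowsOf Q?) ≡ degreeS u
      degree≡ u Q? = trans (sym (length-map (other u) (rowsOf Q?)))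
        (trans (↭-length (unique-↭
          (unique-map⁺ (other u) injective (rowsOf! Q?))
          (Uniqueₚ.filter⁺ (T? ∘ adjS u) (Uniqueₚ.allFin⁺ n)) to from))
          (length-filter-T (adjS u) id))
        where
        neighbours = filter (T? ∘ adjS u) (allFin n)
        injective : ∀ {e f} → e List.∈ rowsOf Q? → f List.∈ rowsOf Q? → other u e ≡ other u f → e ≡ f
        injective {e} {f} e∈ f∈ eq with ∈-rowsOf⁻ Q? e∈ | ∈-rowsOf⁻ Q? f∈
        ... | _ , u∈e | _ , u∈f = simple (proj₁ (other-spec u∈e)) u∈e (proj₂ (other-spec u∈e))
                                    u∈f (subst (λ x → Touch x f) (sym eq) (proj₂ (other-spec u∈f)))
        to : ∀ {x} → x List.∈ map (other u) (rowsOf Q?) → x List.∈ neighbours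
        to x∈ with ∈-map⁻ (other u) x∈
        ... | e , e∈ , refl with ∈-rowsOf⁻ Q? e∈
        ...   | e∈S , u∈e = ∈-filter⁺ (T? ∘ adjS u) (∈-allFin _)
                              (adjS⁺ (proj₁ (other-spec u∈e)) e∈S u∈e (proj₂ (other-spec u∈e)))
        from : ∀ {x} → x List.∈ neighbours → x List.∈ map (other u) (rowsOf Q?)
        from {x} x∈ with adjS⁻ (proj₂ (∈-filter⁻ (T? ∘ adjS u) {xs = allFin n} x∈))
        ... | u≢x , e , e∈S , u∈e , x∈e = subst (List._∈ map (other u) (rowsOf Q?)) (other≡ u≢x u∈e x∈e)
                                            (∈-map⁺ (other u) (∈-rowsOf⁺ Q? (e∈S , u∈e)))

      1≤degree : ∀ {u v} → AdjS u v → 1 ≤ degreeS u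
      1≤degree {u} uv with adjS⁻ uv
      ... | _ , e , e∈S , u∈e , _ = subst (1 ≤_) (degree≡ u Q?) (nonempty (∈-rowsOf⁺ Q? (e∈S , u∈e)))
        where
        Q? : Decidable (λ e → In S e × Touch u e)
        Q? e = in? S e ×-dec touch? u e
        nonempty : ∀ {x xs} → x List.∈ xs → 1 ≤ length xs
        nonempty {xs = _ ∷ _} _ = s≤s z≤n

      distantPair : ∀ {u v k} → IsDistanceS u v 2 → degreeS u ℕ.+ degreeS v ≤ k → DistantPair k S
      distantPair {u} {v} {k} ((w , uw , (_ , wv , refl)) , minimal) sum≤ with adjS⁻ uw | adjS⁻ wv
      ... | u≢w , a , a∈ , u∈a , w∈a | w≢v , b , b∈ , w∈b , v∈b = record
        { u≢v = u≢v ; u≢w = u≢w ; v≢w = w≢v ∘ sym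
        ; a∈ = a∈ ; u∈a = u∈a ; w∈a = w∈a ; b∈ = b∈ ; v∈b = v∈b ; w∈b = w∈b
        ; apart = apart
        ; degreeSum≤ = λ P? → ℕₚ.≤-trans (ℕₚ.≤-reflexive (sum≡ P?)) sum≤ }
        where
        u≢v : u ≢ v
        u≢v = minimal {0} (s≤s z≤n)
        apart : ∀ {e} → In S e → Touch u e → Touch v e → ⊥
        apart e∈ u∈e v∈e = minimal {1} (s≤s (s≤s z≤n)) (v , adjS⁺ u≢v e∈ u∈e v∈e , refl)
        Q? : ∀ x → Decidable (λ e → In S e × Touch x e)
        Q? x e = in? S e ×-dec touch? x e
        sum≡ : (P? : Decidable (λ e → In S e × (Touch u e ⊎ Touch v e))) →
               length (rowsOf P?) ≡ degreeS u ℕ.+ degreeS v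
        sum≡ P? = trans (↭-length (filter-split P? (Q? u) (Q? v)
          (λ { e (e∈ , inj₁ u∈e) → inj₁ (e∈ , u∈e) ; e (e∈ , inj₂ v∈e) → inj₂ (e∈ , v∈e) })
          (λ e (e∈ , u∈e) → e∈ , inj₁ u∈e) (λ e (e∈ , v∈e) → e∈ , inj₂ v∈e)
          (λ e (e∈ , u∈e) (_ , v∈e) → apart e∈ u∈e v∈e) (allFin size)))
          (trans (length-++ (rowsOf (Q? u))) (cong₂ ℕ._+_ (degree≡ u (Q? u)) (degree≡ v (Q? v))))

      -- Distinct nonadjacent ends of a path with two edges would be at distance 2.
      transitive : (∀ u v → ¬ IsDistanceS u v 2) → Transitive S
      transitive none {x} {y} {z} x≢y y≢z x≢z e∈ x∈e y∈e f∈ y∈f z∈f with T? (adjS x z)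
      ... | yes xz = let (_ , g , g∈ , x∈g , z∈g) = adjS⁻ xz in g , g∈ , x∈g , z∈g
      ... | no ¬xz = contradiction
        ((y , adjS⁺ x≢y e∈ x∈e y∈e , z , adjS⁺ y≢z f∈ y∈f z∈f , refl) , λ {j} → minimal {j}) (none x z)
        where
        minimal : ∀ {j} → j ℕ.< 2 → ¬ Graph.Walk (induced G S) j x z
        minimal {zero} _ x≡z = x≢z x≡z
        minimal {suc zero} _ (_ , xz , refl) = ¬xz xz
        minimal {suc (suc j)} (s≤s (s≤s ()))

    δ₂s : List ℕ
    δ₂s = mapMaybe (λ S → δ₂ (induced G S)) (subsets n)

    δ₂≤∂₂ : ∀ S {d} → δ₂ (induced G S) ≡ just d → d ≤ ∂₂ G
    δ₂≤∂₂ S {d} eq with maximum δ₂s in max | ∈-mapMaybe⁺ (λ S → δ₂ (induced G S)) (∈-subsets S) eq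
    ... | just k  | d∈ = maximum-≥ δ₂s max d∈
    ... | nothing | d∈ with δ₂s
    ...   | []    with () ← d∈
    δ₂≤∂₂ S {d} eq | nothing | d∈ | _ ∷ _ with () ← max

    reducible : ∀ S → Transitive S ⊎ DistantPair (∂₂ G) S
    reducible S with δ₂ (induced G S) in eq
    ... | nothing = inj₁ (transitive S (δ₂-nothing (induced G S) eq))
    ... | just d with δ₂-just (induced G S) eq
    ...   | u , v , dist , refl = inj₂ (distantPair S dist (δ₂≤∂₂ S eq))

    -- An edge is assumed because the convention gives 0 for an edgeless graph. With an edge, the
    -- convention gives at least 2; if it does not apply, both vertices of a pair at distance 2 have
    -- degree at least 1.
    2≤∂₂ : Fin size → 2 ≤ ∂₂ G
    2≤∂₂ e with maximum δ₂s in max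
    ... | nothing = ℕₚ.+-mono-≤ 1≤Δ (ℕₚ.≤-trans 1≤Δ (ℕₚ.m≤m+n _ 0))
      where
      u = tail e
      1≤degreeᵤ : 1 ≤ Graph.degree G u
      1≤degreeᵤ = subst (1 ≤_) (length-filter-T (adj u) id)
        (nonempty (∈-filter⁺ (T? ∘ adj u) (∈-allFin (head e)) (proj₂ (ends-spec e))))
        where
        nonempty : ∀ {x} {xs : List (Fin n)} → x List.∈ xs → 1 ≤ length xs
        nonempty {xs = _ ∷ _} _ = s≤s z≤n
      1≤Δ : 1 ≤ Graph.maxDegree G
      1≤Δ = ℕₚ.≤-trans 1≤degreeᵤ (foldr-⊔-≥ (∈-map⁺ (Graph.degree G) (∈-allFin u)))
    ... | just k = attained (∈max δ₂s max)
      where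
      ∈max : ∀ xs → maximum xs ≡ just k → ∃[ d ] (d List.∈ xs)
      ∈max (x ∷ _) _ = x , here refl
      attained : ∃[ d ] (d List.∈ δ₂s) → 2 ≤ k
      attained (d , d∈) with ∈-mapMaybe⁻ (λ S → δ₂ (induced G S)) (subsets n) d∈
      ... | S , eq with δ₂-just (induced G S) eq
      ...   | u , v , ((w , uw , (_ , wv , refl)) , _) , refl = ℕₚ.≤-trans
        (ℕₚ.+-mono-≤ (1≤degree S uw) (1≤degree S (Graph.sym (induced G S) {w} {v} wv))) (maximum-≥ δ₂s max d∈)

    -- A walk from an end of an isolated edge never leaves its two ends, so these form a component.
    nice⇒¬isolated : Nice G → ∀ e → ¬ Isolated ⊤ e
    nice⇒¬isolated nice e iso = nice (C , component , isK₂)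
      where
      open Graph G using (Walk; Connected; IsComponent; IsK₂)
      u = tail e
      v = head e
      uv : Adj u v
      uv = proj₂ (ends-spec e)
      C : Subset n
      C = ⁅ u ⁆ ∪ ⁅ v ⁆
      C⁻ : ∀ {x} → x ∈ C → u ≡ x ⊎ v ≡ x
      C⁻ x∈ with x∈p∪q⁻ ⁅ u ⁆ ⁅ v ⁆ x∈
      ... | inj₁ x∈u = inj₁ (sym (x∈⁅y⁆⇒x≡y u x∈u))
      ... | inj₂ x∈v = inj₂ (sym (x∈⁅y⁆⇒x≡y v x∈v))
      C⁺ : ∀ {x} → u ≡ x ⊎ v ≡ x → x ∈ C
      C⁺ (inj₁ refl) = x∈p∪q⁺ (inj₁ (x∈⁅x⁆ u))
      C⁺ (inj₂ refl) = x∈p∪q⁺ {p = ⁅ u ⁆} (inj₂ (x∈⁅x⁆ v))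
      stays : ∀ {x y} → Touch x e → Adj x y → Touch y e
      stays {x} x∈e xy with edge xy
      ... | f , x∈f , y∈f with iso f (∈⊤ , ∈⊤) (x , x∈e , x∈f)
      ...   | refl = y∈f
      walk⇒ : ∀ k {x y} → Touch x e → Walk k x y → Touch y e
      walk⇒ zero    x∈e refl         = x∈e
      walk⇒ (suc k) x∈e (_ , xw , p) = walk⇒ k (stays x∈e xw) p
      connected : ∀ {x y} → Touch x e → Touch y e → Connected x y
      connected (inj₁ refl) (inj₁ refl) = 0 , refl
      connected (inj₁ refl) (inj₂ refl) = 1 , v , uv , refl
      connected (inj₂ refl) (inj₁ refl) = 1 , u , adj-sym uv , refl
      connected (inj₂ refl) (inj₂ refl) = 0 , refl
      component : IsComponent C
      component = (u , C⁺ (inj₁ refl)) , λ x∈ y → mk⇔ (λ y∈ → connected (C⁻ x∈) (C⁻ y∈))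
        (λ (k , walk) → C⁺ (walk⇒ k (C⁻ x∈) walk))
      f : Fin 2 → Fin n
      f zero       = u
      f (suc zero) = v
      isK₂ : IsK₂ C
      isK₂ = f , injective , (λ x → mk⇔ (to ∘ C⁻) (C⁺ ∘ from)) , adjacent
        where
        injective : ∀ {i j} → f i ≡ f j → i ≡ j
        injective {zero}     {zero}     _  = refl
        injective {zero}     {suc zero} eq = contradiction eq (loopless e)
        injective {suc zero} {zero}     eq = contradiction (sym eq) (loopless e)
        injective {suc zero} {suc zero} _  = refl
        to : ∀ {x} → Touch x e → ∃[ i ] f i ≡ x
        to (inj₁ eq) = zero , eq
        to (inj₂ eq) = suc zero , eq
        from : ∀ {x} → ∃[ i ] f i ≡ x → Touch x e
        from (zero , eq)     = inj₁ eq
        from (suc zero , eq) = inj₂ eq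
        adjacent : ∀ i j → _
        adjacent zero       zero       = mk⇔ (λ a → contradiction a adj-irrefl) (λ i≢i → contradiction refl i≢i)
        adjacent zero       (suc zero) = mk⇔ (λ _ ()) (λ _ → uv)
        adjacent (suc zero) zero       = mk⇔ (λ _ ()) (λ _ → adj-sym uv)
        adjacent (suc zero) (suc zero) = mk⇔ (λ a → contradiction a adj-irrefl) (λ i≢i → contradiction refl i≢i)

    bounded-permanent-∂₂ : Nice G →
      ∃[ cs ] ((∀ e → count e cs ≤ ∂₂ G) × per (allFin size) (map colE cs) ≢ 0ℤ)
    bounded-permanent-∂₂ nice = conclude (allFin size) refl
      where
      conclude : ∀ es → allFin size ≡ es →
        ∃[ cs ] ((∀ e → count e cs ≤ ∂₂ G) × per (allFin size) (map colE cs) ≢ 0ℤ)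
      -- The edgeless graph is separate, since `2≤∂₂` takes an edge; the empty permanent is 1.
      conclude []      eq = [] , (λ _ → z≤n) , subst (λ es → per es [] ≢ 0ℤ) (sym eq) (λ ())
      conclude (e ∷ _) _  = bounded-permanent (2≤∂₂ e) reducible (nice⇒¬isolated nice)

-- Apartness in the real field and the embedding of the integers

module RealField where

  open import Defs
  open import Algebra.Bundles using (CommutativeRing)
  import Algebra.Apartness.Properties.HeytingCommutativeRing as HeytingProperties
  import Algebra.Definitions.RawMonoid as RawMonoidDefs
  import Algebra.Properties.Monoid.Mult as Mult
  import Algebra.Properties.Ring as RingProperties
  import Algebra.Solver.Ring.NaturalCoefficients.Default as Solver
  open import Data.Integer.Base as ℤ using (ℤ; +_; -[1+_]; 0ℤ; _⊖_)
  import Data.Integer.Properties as ℤₚ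
  open import Data.Nat.Base as ℕ using (ℕ; zero; suc)
  open import Data.Product.Base using (_×_; _,_)
  open import Data.Sum.Base using (_⊎_; inj₁; inj₂)
  open import Function.Bundles using (Equivalence)
  open import Relation.Binary.PropositionalEquality as ≡ using (_≡_; _≢_)
  import Relation.Binary.Reasoning.Setoid as SetoidReasoning
  open import Relation.Binary.Structures using (IsStrictPartialOrder)
  open import Relation.Nullary.Negation using (¬_; contradiction)

  module RingIdentities {c ℓ} (R : CommutativeRing c ℓ) where

    open CommutativeRing R
    open RingProperties ring using (x[y-z]≈xy-xz; [y-z]x≈yx-zx; -‿+-comm)
    open Solver commutativeSemiring using (solve; _:+_; _:*_; _:=_)
    open SetoidReasoning setoid

    +-interchange : ∀ a b c d → (a + b) + (c + d) ≈ (a + c) + (b + d)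
    +-interchange = solve 4 (λ a b c d → (a :+ b) :+ (c :+ d) := (a :+ c) :+ (b :+ d)) refl

    *-interchange : ∀ a b c d → (a * b) * (c * d) ≈ (a * c) * (b * d)
    *-interchange = solve 4 (λ a b c d → (a :* b) :* (c :* d) := (a :* c) :* (b :* d)) refl

    regroup-difference : ∀ a b c d → (a + b) - (c + d) ≈ (a - c) + (b - d)
    regroup-difference a b c d = trans (+-congˡ (sym (-‿+-comm c d))) (+-interchange a b (- c) (- d))

    scale-sum : ∀ a w x r → w * (a * x) + a * r ≈ a * (w * x + r)
    scale-sum = solve 4 (λ a w x r → w :* (a :* x) :+ a :* r := a :* (w :* x :+ r)) refl

    split-sum : ∀ w x y p q → w * (x + y) + (p + q) ≈ (w * x + p) + (w * y + q)
    split-sum = solve 5 (λ w x y p q → w :* (x :+ y) :+ (p :+ q) := (w :* x :+ p) :+ (w :* y :+ q)) refl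

    gather : ∀ a b s x y → (a + s * x) + (b + s * y) ≈ (a + b) + s * (x + y)
    gather = solve 5 (λ a b s x y → (a :+ s :* x) :+ (b :+ s :* y) := (a :+ b) :+ s :* (x :+ y)) refl

    telescope : ∀ a b c → (a - b) + (b - c) ≈ a - c
    telescope a b c = begin
      (a - b) + (b - c) ≈⟨ +-interchange a (- b) b (- c) ⟩
      (a + b) + (- b - c) ≈⟨ solve 4 (λ a b b′ c → (a :+ b) :+ (b′ :+ c) := (a :+ c) :+ (b :+ b′)) refl a b (- b) (- c) ⟩
      (a - c) + (b - b) ≈⟨ +-congˡ (-‿inverseʳ b) ⟩
      (a - c) + 0#      ≈⟨ +-identityʳ _ ⟩
      a - c ∎

    -- One step of the recursion for divided differences: `t` and `s` are points, `p` and `q` their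
    -- powers with a common exponent, and `i` will be the inverse of `t - s`.
    factor-power : ∀ w i s t p q → (w * i) * (t * p - s * q) ≈ (i * (t - s)) * (w * p) + s * ((w * i) * (p - q))
    factor-power w i s t p q = begin
      (w * i) * (t * p - s * q)
        ≈⟨ *-congˡ (sym (telescope (t * p) (s * p) (s * q))) ⟩
      (w * i) * ((t * p - s * p) + (s * p - s * q))
        ≈⟨ *-congˡ (+-cong (sym ([y-z]x≈yx-zx p t s)) (sym (x[y-z]≈xy-xz s p q))) ⟩
      (w * i) * ((t - s) * p + s * (p - q))
        ≈⟨ solve 6 (λ w i s d p e → (w :* i) :* (d :* p :+ s :* e) := (i :* d) :* (w :* p) :+ s :* ((w :* i) :* e))
             refl w i s (t - s) p (p - q) ⟩
      (i * (t - s)) * (w * p) + s * ((w * i) * (p - q)) ∎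

    difference-form : ∀ w x y p q → (w * x + p) - (w + q) * y ≈ w * (x - y) + (p - q * y)
    difference-form w x y p q = begin
      (w * x + p) - (w + q) * y       ≈⟨ +-congˡ (-‿cong (distribʳ y w q)) ⟩
      (w * x + p) - (w * y + q * y)   ≈⟨ regroup-difference (w * x) p (w * y) (q * y) ⟩
      (w * x - w * y) + (p - q * y)   ≈⟨ +-congʳ (sym (x[y-z]≈xy-xz w x y)) ⟩
      w * (x - y) + (p - q * y) ∎

  module Field {c ℓ₁ ℓ₂ ℓ₃} (ℝ : RealNumbers c ℓ₁ ℓ₂ ℓ₃) where

    open RealNumbers ℝ public hiding (zero)
    open RingIdentities commutativeRing public
    open HeytingProperties heytingCommutativeRing public
    open RingProperties (CommutativeRing.ring commutativeRing) public
      using (-0#≈0#; -‿involutive; -‿+-comm; -‿distribˡ-*; -‿distribʳ-*)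
    open RawMonoidDefs (CommutativeRing.+-rawMonoid commutativeRing) public using () renaming (_×_ to _·_)

    module ≈-Reasoning = SetoidReasoning setoid

    open IsStrictPartialOrder isStrictPartialOrder public
      using (<-respʳ-≈; <-respˡ-≈) renaming (trans to <-trans)

    -- Cotransitivity compares `x + y` and 0 with `y`; if `x + y` is apart from `y`, then their
    -- difference `x` is invertible.
    +#0 : ∀ {x y} → x + y # 0# → x # 0# ⊎ y # 0#
    +#0 {x} {y} x+y#0 with #-cotrans x+y#0 y
    ... | inj₂ y#0   = inj₂ y#0
    ... | inj₁ x+y#y = inj₁ (helper (#⇒invertible x+y#y))
      where
      open ≈-Reasoning
      helper : _ → x # 0#
      helper (i , i*≈1 , _) = invertibleˡ⇒# (i , (begin
        i * (x - 0#)      ≈⟨ *-congˡ (x-0≈x x) ⟩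
        i * x             ≈⟨ *-congˡ (sym (+-identityʳ x)) ⟩
        i * (x + 0#)      ≈⟨ *-congˡ (+-congˡ (sym (-‿inverseʳ y))) ⟩
        i * (x + (y - y)) ≈⟨ *-congˡ (sym (+-assoc x y (- y))) ⟩
        i * (x + y - y)   ≈⟨ i*≈1 ⟩
        1# ∎))

    *#0ʳ : ∀ {x y} → x * y # 0# → y # 0#
    *#0ʳ {x} {y} xy#0 with #⇒invertible xy#0
    ... | i , i*≈1 , _ = invertibleˡ⇒# (i * x , (begin
        i * x * (y - 0#)   ≈⟨ *-congˡ (x-0≈x y) ⟩
        i * x * y          ≈⟨ *-assoc i x y ⟩
        i * (x * y)        ≈⟨ *-congˡ (sym (x-0≈x (x * y))) ⟩
        i * (x * y - 0#)   ≈⟨ i*≈1 ⟩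
        1# ∎))
      where open ≈-Reasoning

    *#0ˡ : ∀ {x y} → x * y # 0# → x # 0#
    *#0ˡ {x} {y} xy#0 = *#0ʳ (#-congʳ (*-comm x y) xy#0)

    0¬#0 : ¬ (0# # 0#)
    0¬#0 = #-irrefl refl

    0<1 : 0# < 1#
    0<1 with Equivalence.to #⇔< 1#0
    ... | inj₂ 0<1 = 0<1
    -- Even 1 < 0 leads to the conclusion, since 1 is then the square of the positive number -1.
    ... | inj₁ 1<0 = <-respʳ-≈ (trans (sym (-‿distribˡ-* 1# (- 1#)))
          (trans (-‿cong (*-identityˡ (- 1#))) (-‿involutive 1#))) (*-pos 0<-1 0<-1)
      where
      0<-1 : 0# < - 1#
      0<-1 = <-respˡ-≈ (-‿inverseʳ 1#) (<-respʳ-≈ (+-identityˡ (- 1#)) (+-mono-< (- 1#) 1<0))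

    0<suc : ∀ n → 0# < suc n · 1#
    0<suc zero    = <-respʳ-≈ (sym (+-identityʳ 1#)) 0<1
    0<suc (suc n) = <-trans 0<1 (<-respˡ-≈ (+-identityʳ 1#)
      (<-respˡ-≈ (+-comm 0# 1#) (<-respʳ-≈ (+-comm _ 1#) (+-mono-< 1# (0<suc n)))))

    ι : ℤ → Carrier
    ι (+ n)    = n · 1#
    ι -[1+ n ] = - (suc n · 1#)

    ι-⊖ : ∀ m n → ι (m ⊖ n) ≈ m · 1# - n · 1#
    ι-⊖ zero    zero    = sym (x-0≈x 0#)
    ι-⊖ (suc m) zero    = sym (x-0≈x _)
    ι-⊖ zero    (suc n) = sym (+-identityˡ _)
    ι-⊖ (suc m) (suc n) = begin
      ι (suc m ⊖ suc n)                     ≡⟨ ≡.cong ι (ℤₚ.[1+m]⊖[1+n]≡m⊖n m n) ⟩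
      ι (m ⊖ n)                             ≈⟨ ι-⊖ m n ⟩
      m · 1# - n · 1#                       ≈⟨ sym (+-identityˡ _) ⟩
      0# + (m · 1# - n · 1#)                ≈⟨ +-congʳ (sym (-‿inverseʳ 1#)) ⟩
      (1# - 1#) + (m · 1# - n · 1#)         ≈⟨ sym (regroup-difference 1# (m · 1#) 1# (n · 1#)) ⟩
      suc m · 1# - suc n · 1# ∎
      where open ≈-Reasoning

    ι-+ : ∀ x y → ι (x ℤ.+ y) ≈ ι x + ι y
    ι-+ (+ m)    (+ n)    = ×-homo-+ 1# m n
      where open Mult (CommutativeRing.+-monoid commutativeRing)
    ι-+ (+ m)    -[1+ n ] = ι-⊖ m (suc n)
    ι-+ -[1+ m ] (+ n)    = trans (ι-⊖ n (suc m)) (+-comm _ _)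
    ι-+ -[1+ m ] -[1+ n ] = trans (-‿cong (begin
        1# + (1# + (m ℕ.+ n) · 1#)        ≈⟨ +-congˡ (+-congˡ (×-homo-+ 1# m n)) ⟩
        1# + (1# + (m · 1# + n · 1#))     ≈⟨ sym (+-assoc 1# 1# _) ⟩
        (1# + 1#) + (m · 1# + n · 1#)     ≈⟨ +-interchange 1# 1# _ _ ⟩
        (1# + m · 1#) + (1# + n · 1#) ∎))
      (sym (-‿+-comm _ _))
      where
      open ≈-Reasoning
      open Mult (CommutativeRing.+-monoid commutativeRing)

    ι-neg : ∀ x → ι (ℤ.- x) ≈ - ι x
    ι-neg (+ zero)  = sym -0#≈0#
    ι-neg (+ suc n) = refl
    ι-neg -[1+ n ]  = sym (-‿involutive _)

    -- Characteristic 0 in the form of an apartness, which comes from the order. It turns decidable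
    -- statements on integer coefficients into statements on real ones.
    ι#0 : ∀ {z} → z ≢ 0ℤ → ι z # 0#
    ι#0 {+ zero}   z≢0 = contradiction ≡.refl z≢0
    ι#0 {+ suc n}  z≢0 = Equivalence.from #⇔< (inj₂ (0<suc n))
    ι#0 { -[1+ n ]} z≢0 = Equivalence.from #⇔< (inj₁
      (<-respˡ-≈ (+-identityˡ _) (<-respʳ-≈ (-‿inverseʳ _) (+-mono-< (- (suc n · 1#)) (0<suc n)))))

    ι#0⇒≢0 : ∀ {z} → ι z # 0# → z ≢ 0ℤ
    ι#0⇒≢0 ι#0 ≡.refl = 0¬#0 ι#0

-- Coefficients of formal polynomials

module FormalPolynomials where

  open import Defs
  open import Data.Bool.Base using (true; false)
  open import Data.Fin.Base using (Fin; zero; suc)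
  open import Data.Integer.Base as ℤ using (ℤ; 0ℤ)
  open import Data.List.Base using (List; []; _∷_; _++_; map; foldr)
  import Data.List.Membership.Propositional as List
  open import Data.List.Relation.Unary.All using ([]; _∷_)
  open import Data.List.Relation.Unary.Any using (here; there)
  open import Data.Nat.Base as ℕ using (ℕ; zero; suc)
  import Data.Nat.Properties as ℕₚ
  open import Data.Product.Base using (∃-syntax; _,_; map₁)
  open import Data.Vec.Base as Vec using (Vec; []; _∷_)
  import Data.Vec.Properties as Vecₚ
  open import Function.Base using (_∘_)
  open import Relation.Binary.PropositionalEquality as ≡ using (_≡_; _≢_)
  open import Relation.Nullary.Decidable using (Dec; yes; no; does; dec-true; dec-false)
  open import Relation.Nullary.Negation using (contradiction)
  open Coefficients
  open RealField

  unitVec : ∀ {m} → Fin m → Vec ℕ m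
  unitVec i = Vec.replicate _ 0 Vec.[ i ]≔ 1

  0+ : ∀ {m} (β : Vec ℕ m) → Vec.zipWith ℕ._+_ (Vec.replicate m 0) β ≡ β
  0+ []      = ≡.refl
  0+ (b ∷ β) = ≡.cong (b ∷_) (0+ β)

  unitVec+ : ∀ {m} (i : Fin m) β → Vec.zipWith ℕ._+_ (unitVec i) β ≡ raise i β
  unitVec+ zero    (b ∷ β) = ≡.cong (suc b ∷_) (0+ β)
  unitVec+ (suc i) (b ∷ β) = ≡.cong (b ∷_) (unitVec+ i β)

  raise-injective : ∀ {m} (i : Fin m) {α β} → raise i α ≡ raise i β → α ≡ β
  raise-injective zero    {_ ∷ _} {_ ∷ _} ≡.refl = ≡.refl
  raise-injective (suc i) {_ ∷ _} {_ ∷ _} eq     =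
    ≡.cong₂ _∷_ (Vecₚ.∷-injectiveˡ eq) (raise-injective i (Vecₚ.∷-injectiveʳ eq))

  -- Divisibility of a monomial by the variable `i`, as a view: an indivisible monomial is no value
  -- of `raise i`, and `shift` returns its default there.
  data Lowering {a} (A : Set a) {m} (i : Fin m) : Vec ℕ m → Set a where
    raised : ∀ α → Lowering A i (raise i α)
    lowest : ∀ {α} → (∀ β → raise i β ≢ α) → (∀ (o : A) q → shift o i q α ≡ o) → Lowering A i α

  lowering : ∀ {a} (A : Set a) {m} (i : Fin m) α → Lowering A i α
  lowering A zero    (zero  ∷ α) = lowest (λ { (_ ∷ _) () }) (λ o q → ≡.refl)
  lowering A zero    (suc a ∷ α) = raised (a ∷ α)
  lowering A (suc i) (a ∷ α) with lowering A i α
  ... | raised α′      = raised (a ∷ α′)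
  ... | lowest none eq = lowest (λ { (b ∷ β) e → none β (Vecₚ.∷-injectiveʳ e) }) (λ o q → eq o (q ∘ (a ∷_)))

  shift-raise : ∀ {a} {A : Set a} {m} (o : A) (i : Fin m) q α → shift o i q (raise i α) ≡ q α
  shift-raise o zero    q (a ∷ α) = ≡.refl
  shift-raise o (suc i) q (a ∷ α) = shift-raise o i (q ∘ (a ∷_)) α

  module Polynomials {c ℓ₁ ℓ₂ ℓ₃} (ℝ : RealNumbers c ℓ₁ ℓ₂ ℓ₃) where

    open Field ℝ

    Poly : ℕ → Set c
    Poly = Polynomial ℝ

    coeff : ∀ {m} → Poly m → Vec ℕ m → Carrier
    coeff = coefficient ℝ

    infixl 7 _⊛_

    _⊛_ : ∀ {m} → Poly m → Poly m → Poly m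
    _⊛_ = _*ᵖ_ ℝ

    negate : ∀ {m} → Poly m → Poly m
    negate = map (map₁ (λ a → - a))

    term : ∀ {m} → Carrier → Vec ℕ m → Vec ℕ m → Carrier
    term a β α = coeff ((a , β) ∷ []) α

    term-≡ : ∀ {m} a (α : Vec ℕ m) → term a α α ≈ a
    term-≡ a α rewrite dec-true (Vecₚ.≡-dec ℕₚ._≟_ α α) ≡.refl = +-identityʳ a

    term-≢ : ∀ {m} a {α β : Vec ℕ m} → β ≢ α → term a β α ≈ 0#
    term-≢ a {α} {β} β≢α rewrite dec-false (Vecₚ.≡-dec ℕₚ._≟_ β α) β≢α = refl

    coeff-∷ : ∀ {m} a β (p : Poly m) α → coeff ((a , β) ∷ p) α ≈ term a β α + coeff p α
    coeff-∷ a β p α with does (Vecₚ.≡-dec ℕₚ._≟_ β α)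
    ... | true  = +-congʳ (sym (+-identityʳ a))
    ... | false = sym (+-identityˡ _)

    coeff-++ : ∀ {m} (p q : Poly m) α → coeff (p ++ q) α ≈ coeff p α + coeff q α
    coeff-++ []            q α = sym (+-identityˡ _)
    coeff-++ ((a , β) ∷ p) q α = begin
      coeff ((a , β) ∷ (p ++ q)) α          ≈⟨ coeff-∷ a β (p ++ q) α ⟩
      term a β α + coeff (p ++ q) α         ≈⟨ +-congˡ (coeff-++ p q α) ⟩
      term a β α + (coeff p α + coeff q α)  ≈⟨ sym (+-assoc _ _ _) ⟩
      term a β α + coeff p α + coeff q α    ≈⟨ +-congʳ (sym (coeff-∷ a β p α)) ⟩
      coeff ((a , β) ∷ p) α + coeff q α ∎
      where open ≈-Reasoning

    ⊛-++ : ∀ {m} (p q r : Poly m) α → coeff ((p ++ q) ⊛ r) α ≈ coeff (p ⊛ r) α + coeff (q ⊛ r) α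
    ⊛-++ []      q r α = sym (+-identityˡ _)
    ⊛-++ ((a , β) ∷ p) q r α = begin
      coeff (row ++ ((p ++ q) ⊛ r)) α              ≈⟨ coeff-++ row _ α ⟩
      coeff row α + coeff ((p ++ q) ⊛ r) α         ≈⟨ +-congˡ (⊛-++ p q r α) ⟩
      coeff row α + (coeff (p ⊛ r) α + coeff (q ⊛ r) α) ≈⟨ sym (+-assoc _ _ _) ⟩
      coeff row α + coeff (p ⊛ r) α + coeff (q ⊛ r) α   ≈⟨ +-congʳ (sym (coeff-++ row (p ⊛ r) α)) ⟩
      coeff (row ++ (p ⊛ r)) α + coeff (q ⊛ r) α ∎
      where
      open ≈-Reasoning
      row = map (λ (b , γ) → a * b , Vec.zipWith ℕ._+_ β γ) r

    shift-term : ∀ {m} (i : Fin m) a β α → shift 0# i (term a β) α ≈ term a (raise i β) α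
    shift-term i a β α with lowering Carrier i α
    ... | lowest none eq = trans (reflexive (eq 0# (term a β))) (sym (term-≢ a (none β)))
    ... | raised α′ = trans (reflexive (shift-raise 0# i (term a β) α′)) same
      where
      same : term a β α′ ≈ term a (raise i β) (raise i α′)
      same with Vecₚ.≡-dec ℕₚ._≟_ β α′
      ... | yes ≡.refl = trans (+-identityʳ a) (sym (term-≡ a (raise i β)))
      ... | no β≢α′    = sym (term-≢ a (β≢α′ ∘ raise-injective i))

    shift-cong : ∀ {m} (i : Fin m) {f g : Vec ℕ m → Carrier} {o o′} → o ≈ o′ → (∀ α → f α ≈ g α) →
                 ∀ α → shift o i f α ≈ shift o′ i g α
    shift-cong zero    o≈ f≈g (zero  ∷ α) = o≈
    shift-cong zero    o≈ f≈g (suc a ∷ α) = f≈g (a ∷ α)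
    shift-cong (suc i) o≈ f≈g (a     ∷ α) = shift-cong i o≈ (f≈g ∘ (a ∷_)) α

    shift-+ : ∀ {m} (i : Fin m) (f g : Vec ℕ m → Carrier) α →
              shift 0# i (λ α → f α + g α) α ≈ shift 0# i f α + shift 0# i g α
    shift-+ zero    f g (zero  ∷ α) = sym (+-identityˡ 0#)
    shift-+ zero    f g (suc a ∷ α) = refl
    shift-+ (suc i) f g (a     ∷ α) = shift-+ i (f ∘ (a ∷_)) (g ∘ (a ∷_)) α

    shift-zero : ∀ {m} (i : Fin m) α → shift 0# i (λ _ → 0#) α ≈ 0#
    shift-zero zero    (zero  ∷ α) = refl
    shift-zero zero    (suc a ∷ α) = refl
    shift-zero (suc i) (a     ∷ α) = shift-zero i α

    term-cong : ∀ {m} {a b} → a ≈ b → ∀ (β α : Vec ℕ m) → term a β α ≈ term b β α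
    term-cong a≈b β α with does (Vecₚ.≡-dec ℕₚ._≟_ β α)
    ... | true  = +-congʳ a≈b
    ... | false = refl

    term-neg : ∀ {m} a (β α : Vec ℕ m) → term (- a) β α ≈ - term a β α
    term-neg a β α with does (Vecₚ.≡-dec ℕₚ._≟_ β α)
    ... | true  = trans (+-identityʳ _) (-‿cong (sym (+-identityʳ a)))
    ... | false = sym -0#≈0#

    term-∷ : ∀ {m} a b (β α : Vec ℕ m) → term a (b ∷ β) (b ∷ α) ≈ term a β α
    term-∷ a b β α = same (Vecₚ.≡-dec ℕₚ._≟_ β α)
      where
      same : Dec (β ≡ α) → term a (b ∷ β) (b ∷ α) ≈ term a β α
      same (yes ≡.refl) = trans (term-≡ a (b ∷ α)) (sym (term-≡ a α))
      same (no β≢α)     = trans (term-≢ a {b ∷ α} {b ∷ β} (β≢α ∘ Vecₚ.∷-injectiveʳ)) (sym (term-≢ a β≢α))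

    coeff-var-⊛ : ∀ {m} (i : Fin m) q α → coeff (map (λ (b , γ) → 1# * b , Vec.zipWith ℕ._+_ (unitVec i) γ) q) α ≈
                                         shift 0# i (coeff q) α
    coeff-var-⊛ i []            α = sym (shift-zero i α)
    coeff-var-⊛ i ((b , γ) ∷ q) α = begin
      coeff ((1# * b , Vec.zipWith ℕ._+_ (unitVec i) γ) ∷ row) α
        ≈⟨ coeff-∷ (1# * b) (Vec.zipWith ℕ._+_ (unitVec i) γ) row α ⟩
      term (1# * b) (Vec.zipWith ℕ._+_ (unitVec i) γ) α + coeff row α
        ≡⟨ ≡.cong (λ β → term (1# * b) β α + coeff row α) (unitVec+ i γ) ⟩
      term (1# * b) (raise i γ) α + coeff row α
        ≈⟨ +-cong (term-cong (*-identityˡ b) (raise i γ) α) (coeff-var-⊛ i q α) ⟩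
      term b (raise i γ) α + shift 0# i (coeff q) α
        ≈⟨ +-congʳ (sym (shift-term i b γ α)) ⟩
      shift 0# i (term b γ) α + shift 0# i (coeff q) α
        ≈⟨ sym (shift-+ i (term b γ) (coeff q) α) ⟩
      shift 0# i (λ α → term b γ α + coeff q α) α
        ≈⟨ shift-cong i refl (λ α → sym (coeff-∷ b γ q α)) α ⟩
      shift 0# i (coeff ((b , γ) ∷ q)) α ∎
      where
      open ≈-Reasoning
      row = map (λ (b , γ) → 1# * b , Vec.zipWith ℕ._+_ (unitVec i) γ) q

    coeff-negate-⊛ : ∀ {m} (p q : Poly m) α → coeff (negate p ⊛ q) α ≈ - coeff (p ⊛ q) α
    coeff-negate-⊛ []            q α = sym -0#≈0#
    coeff-negate-⊛ ((a , β) ∷ p) q α = begin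
      coeff (row (- a) q ++ (negate p ⊛ q)) α          ≈⟨ coeff-++ (row (- a) q) _ α ⟩
      coeff (row (- a) q) α + coeff (negate p ⊛ q) α   ≈⟨ +-cong (neg-row q) (coeff-negate-⊛ p q α) ⟩
      - coeff (row a q) α - coeff (p ⊛ q) α            ≈⟨ -‿+-comm _ _ ⟩
      - (coeff (row a q) α + coeff (p ⊛ q) α)          ≈⟨ -‿cong (sym (coeff-++ (row a q) (p ⊛ q) α)) ⟩
      - coeff (row a q ++ (p ⊛ q)) α ∎
      where
      open ≈-Reasoning
      row : Carrier → Poly _ → Poly _
      row a = map (λ (b , γ) → a * b , Vec.zipWith ℕ._+_ β γ)
      neg-row : ∀ q → coeff (row (- a) q) α ≈ - coeff (row a q) α
      neg-row []            = sym -0#≈0#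
      neg-row ((b , γ) ∷ q) = begin
        coeff ((- a * b , βγ) ∷ row (- a) q) α     ≈⟨ coeff-∷ (- a * b) βγ (row (- a) q) α ⟩
        term (- a * b) βγ α + coeff (row (- a) q) α ≈⟨ +-cong (trans (term-cong (sym (-‿distribˡ-* a b)) βγ α) (term-neg (a * b) βγ α)) (neg-row q) ⟩
        - term (a * b) βγ α - coeff (row a q) α     ≈⟨ -‿+-comm _ _ ⟩
        - (term (a * b) βγ α + coeff (row a q) α)   ≈⟨ -‿cong (sym (coeff-∷ (a * b) βγ (row a q) α)) ⟩
        - coeff ((a * b , βγ) ∷ row a q) α ∎
        where βγ = Vec.zipWith ℕ._+_ β γ

    module _ {m : ℕ} where

      sumVars : List (Fin m) → Poly m
      sumVars is = foldr (_+ᵖ_ ℝ) (0ᵖ ℝ) (map (var ℝ) is)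

      factorOf : Form → Poly m
      factorOf (ps , ns) = _-ᵖ_ ℝ (sumVars ps) (sumVars ns)

      productOf : List Form → Poly m
      productOf ℓs = foldr _⊛_ (1ᵖ ℝ) (map factorOf ℓs)

      coeff-sumVars-⊛ : ∀ is (q : Poly m) {z} → (∀ α → coeff q α ≈ ι (z α)) →
                        ∀ α → coeff (sumVars is ⊛ q) α ≈ ι (sumOver is (λ i → shift 0ℤ i z α))
      coeff-sumVars-⊛ []       q q≈z α = refl
      coeff-sumVars-⊛ (i ∷ is) q {z} q≈z α = begin
        coeff (row ++ (sumVars is ⊛ q)) α              ≈⟨ coeff-++ row _ α ⟩
        coeff row α + coeff (sumVars is ⊛ q) α         ≈⟨ +-cong (coeff-var-⊛ i q α) (coeff-sumVars-⊛ is q q≈z α) ⟩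
        shift 0# i (coeff q) α + ι rest                ≈⟨ +-congʳ (shift-cong i refl q≈z α) ⟩
        shift 0# i (ι ∘ z) α + ι rest                  ≡⟨ ≡.cong (_+ ι rest) (≡.sym (shift-map ι 0ℤ i z α)) ⟩
        ι (shift 0ℤ i z α) + ι rest                    ≈⟨ sym (ι-+ (shift 0ℤ i z α) rest) ⟩
        ι (shift 0ℤ i z α ℤ.+ rest) ∎
        where
        open ≈-Reasoning
        row = map (λ (b , γ) → 1# * b , Vec.zipWith ℕ._+_ (unitVec i) γ) q
        rest = sumOver is (λ i → shift 0ℤ i z α)

      -- The link between real polynomials and the integer coefficient functions on which the
      -- permanents give information.
      coeff-product : ∀ ℓs α → coeff (productOf ℓs) α ≈ ι (coefs ℓs α)
      coeff-product [] α = coeff-1 α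
        where
        coeff-1 : ∀ {m} (α : Vec ℕ m) → coeff ((1# , Vec.replicate m 0) ∷ []) α ≈ ι (unit α)
        coeff-1 []          = refl
        coeff-1 (zero  ∷ α) = trans (term-∷ 1# 0 (Vec.replicate _ 0) α) (coeff-1 α)
        coeff-1 (suc a ∷ α) = term-≢ 1# {suc a ∷ α} {0 ∷ Vec.replicate _ 0} (λ ())
      coeff-product ((ps , ns) ∷ ℓs) α = begin
        coeff ((sumVars ps ++ negate (sumVars ns)) ⊛ q) α
          ≈⟨ ⊛-++ (sumVars ps) (negate (sumVars ns)) q α ⟩
        coeff (sumVars ps ⊛ q) α + coeff (negate (sumVars ns) ⊛ q) α
          ≈⟨ +-congˡ (coeff-negate-⊛ (sumVars ns) q α) ⟩
        coeff (sumVars ps ⊛ q) α - coeff (sumVars ns ⊛ q) α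
          ≈⟨ +-cong (coeff-sumVars-⊛ ps q (coeff-product ℓs) α) (-‿cong (coeff-sumVars-⊛ ns q (coeff-product ℓs) α)) ⟩
        ι (s ps) - ι (s ns)            ≈⟨ +-congˡ (sym (ι-neg (s ns))) ⟩
        ι (s ps) + ι (ℤ.- s ns)        ≈⟨ sym (ι-+ (s ps) (ℤ.- s ns)) ⟩
        ι (s ps ℤ.- s ns) ∎
        where
        open ≈-Reasoning
        q = productOf ℓs
        s : List (Fin m) → ℤ
        s is = sumOver is (λ i → shift 0ℤ i (coefs ℓs) α)

    -- Confines the monomials with nonzero coefficient to the finite list of terms, so that they can
    -- be searched and inherit the common degree of the terms.
    coeff#0⇒∈ : ∀ {m} (p : Poly m) {α} → coeff p α # 0# → ∃[ a ] ((a , α) List.∈ p)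
    coeff#0⇒∈ []            #0 = contradiction #0 0¬#0
    coeff#0⇒∈ ((a , β) ∷ p) {α} #0 with Vecₚ.≡-dec ℕₚ._≟_ β α
    ... | yes ≡.refl = a , here ≡.refl
    ... | no _ with coeff#0⇒∈ p #0
    ...   | b , ∈p = b , there ∈p

-- The Combinatorial Nullstellensatz through divided differences

module CombinatorialNullstellensatz where

  open import Defs
  open import Data.Fin.Base using (Fin; zero; suc)
  open import Data.List.Base using (List; []; _∷_; _++_; map; length; take; allFin)
  open import Data.List.Membership.Propositional using (_∈_; _∉_)
  open import Data.List.Properties using (length-take; length-tabulate)
  open import Data.List.Relation.Unary.All as All using (All; []; _∷_)
  open import Data.List.Relation.Unary.AllPairs using ([]; _∷_)
  open import Data.List.Relation.Unary.Any using (here; there)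
  open import Data.List.Relation.Unary.Unique.Propositional using (Unique)
  import Data.List.Relation.Unary.Unique.Propositional.Properties as Uniqueₚ
  open import Data.Nat.Base as ℕ using (ℕ; zero; suc; s≤s)
  import Data.Nat.Properties as ℕₚ
  open import Data.Product.Base using (∃-syntax; _×_; _,_; proj₁; proj₂)
  open import Data.Sum.Base using (_⊎_; inj₁; inj₂)
  open import Data.Vec.Base as Vec using (Vec; []; _∷_)
  open import Function.Base using (_∘_)
  open import Relation.Binary.Definitions using (tri<; tri≈; tri>)
  open import Relation.Binary.PropositionalEquality as ≡ using (_≡_; _≢_)
  open import Relation.Nullary.Negation using (contradiction)
  open Coefficients using ()
  open RealField
  open FormalPolynomials

  -- An inequality between the sums, rather than equality, persists when a first entry of `β`
  -- exceeding that of `α` is dropped.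
  some-smaller : ∀ {m} (β α : Vec ℕ m) → Vec.sum β ℕ.≤ Vec.sum α →
                 β ≡ α ⊎ ∃[ e ] Vec.lookup β e ℕ.< Vec.lookup α e
  some-smaller []      []      _ = inj₁ ≡.refl
  some-smaller (b ∷ β) (a ∷ α) Σβ≤Σα with ℕₚ.<-cmp b a
  ... | tri< b<a _ _ = inj₂ (zero , b<a)
  ... | tri≈ _ ≡.refl _ with some-smaller β α (ℕₚ.+-cancelˡ-≤ b _ _ Σβ≤Σα)
  ...   | inj₁ ≡.refl    = inj₁ ≡.refl
  ...   | inj₂ (e , β<α) = inj₂ (suc e , β<α)
  some-smaller (b ∷ β) (a ∷ α) Σβ≤Σα | tri> _ _ a<b = inj₂ (later (some-smaller β α (ℕₚ.<⇒≤ Σβ<Σα)))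
    where
    Σβ<Σα : Vec.sum β ℕ.< Vec.sum α
    Σβ<Σα = ℕₚ.+-cancelˡ-< a _ _ (ℕₚ.<-≤-trans (ℕₚ.+-monoˡ-< (Vec.sum β) a<b) Σβ≤Σα)
    later : β ≡ α ⊎ (∃[ e ] Vec.lookup β e ℕ.< Vec.lookup α e) →
            ∃[ e ] Vec.lookup (b ∷ β) e ℕ.< Vec.lookup (a ∷ α) e
    later (inj₁ ≡.refl)    = contradiction Σβ<Σα (ℕₚ.<-irrefl ≡.refl)
    later (inj₂ (e , β<α)) = suc e , β<α

  module Nullstellensatz {c ℓ₁ ℓ₂ ℓ₃} (ℝ : RealNumbers c ℓ₁ ℓ₂ ℓ₃) where

    open Field ℝ
    open Polynomials ℝ

    infixr 8 _^_

    _^_ : Carrier → ℕ → Carrier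
    x ^ zero  = 1#
    x ^ suc n = x * x ^ n

    ^-+ : ∀ x m n → x ^ (m ℕ.+ n) ≈ x ^ m * x ^ n
    ^-+ x zero    n = sym (*-identityˡ _)
    ^-+ x (suc m) n = trans (*-congˡ (^-+ x m n)) (sym (*-assoc x _ _))

    mono : ∀ {m} → Vec ℕ m → (Fin m → Carrier) → Carrier
    mono []      x = 1#
    mono (b ∷ β) x = x zero ^ b * mono β (x ∘ suc)

    eval : ∀ {m} → Poly m → (Fin m → Carrier) → Carrier
    eval []            x = 0#
    eval ((a , β) ∷ p) x = a * mono β x + eval p x

    mono-+ : ∀ {m} (α β : Vec ℕ m) x → mono (Vec.zipWith ℕ._+_ α β) x ≈ mono α x * mono β x
    mono-+ []      []      x = sym (*-identityˡ 1#)
    mono-+ (a ∷ α) (b ∷ β) x = trans (*-cong (^-+ (x zero) a b) (mono-+ α β (x ∘ suc))) (*-interchange _ _ _ _)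

    mono-0 : ∀ m x → mono (Vec.replicate m 0) x ≈ 1#
    mono-0 zero    x = refl
    mono-0 (suc m) x = trans (*-identityˡ _) (mono-0 m (x ∘ suc))

    mono-unitVec : ∀ {m} (i : Fin m) x → mono (unitVec i) x ≈ x i
    mono-unitVec {suc m} zero x = trans (*-cong (*-identityʳ (x zero)) (mono-0 m (x ∘ suc))) (*-identityʳ _)
    mono-unitVec (suc i) x      = trans (*-identityˡ _) (mono-unitVec i (x ∘ suc))

    eval-++ : ∀ {m} (p q : Poly m) x → eval (p ++ q) x ≈ eval p x + eval q x
    eval-++ []            q x = sym (+-identityˡ _)
    eval-++ ((a , β) ∷ p) q x = trans (+-congˡ (eval-++ p q x)) (sym (+-assoc _ _ _))

    eval-negate : ∀ {m} (p : Poly m) x → eval (negate p) x ≈ - eval p x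
    eval-negate []            x = sym -0#≈0#
    eval-negate ((a , β) ∷ p) x = trans (+-cong (sym (-‿distribˡ-* a _)) (eval-negate p x)) (-‿+-comm _ _)

    eval-⊛ : ∀ {m} (p q : Poly m) x → eval (p ⊛ q) x ≈ eval p x * eval q x
    eval-⊛ []            q x = sym (zeroˡ _)
    eval-⊛ ((a , β) ∷ p) q x = begin
      eval (row q ++ (p ⊛ q)) x                      ≈⟨ eval-++ (row q) (p ⊛ q) x ⟩
      eval (row q) x + eval (p ⊛ q) x                ≈⟨ +-cong (eval-row q) (eval-⊛ p q x) ⟩
      a * mono β x * eval q x + eval p x * eval q x  ≈⟨ sym (distribʳ _ _ _) ⟩
      (a * mono β x + eval p x) * eval q x ∎
      where
      open ≈-Reasoning
      row : Poly _ → Poly _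
      row = map (λ (b , γ) → a * b , Vec.zipWith ℕ._+_ β γ)
      eval-row : ∀ q → eval (row q) x ≈ a * mono β x * eval q x
      eval-row []            = sym (zeroʳ _)
      eval-row ((b , γ) ∷ q) = begin
        a * b * mono (Vec.zipWith ℕ._+_ β γ) x + eval (row q) x  ≈⟨ +-cong (*-congˡ (mono-+ β γ x)) (eval-row q) ⟩
        a * b * (mono β x * mono γ x) + a * mono β x * eval q x  ≈⟨ +-congʳ (*-interchange a b _ _) ⟩
        a * mono β x * (b * mono γ x) + a * mono β x * eval q x  ≈⟨ sym (distribˡ _ _ _) ⟩
        a * mono β x * (b * mono γ x + eval q x) ∎

    -- A linear functional on functions of `Fin k`, as a finite combination of point evaluations.
    Weights : ℕ → Set c
    Weights k = List (Carrier × Fin k)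

    weighted : ∀ {k} → Weights k → (Fin k → Carrier) → Carrier
    weighted []            f = 0#
    weighted ((w , i) ∷ Λ) f = w * f i + weighted Λ f

    weighted-cong : ∀ {k} (Λ : Weights k) {f g} → (∀ i → f i ≈ g i) → weighted Λ f ≈ weighted Λ g
    weighted-cong []            f≈g = refl
    weighted-cong ((w , i) ∷ Λ) f≈g = +-cong (*-congˡ (f≈g i)) (weighted-cong Λ f≈g)

    weighted-*ʳ : ∀ {k} (Λ : Weights k) f x → weighted Λ (λ i → f i * x) ≈ weighted Λ f * x
    weighted-*ʳ []            f x = sym (zeroˡ x)
    weighted-*ʳ ((w , i) ∷ Λ) f x = trans (+-cong (sym (*-assoc w (f i) x)) (weighted-*ʳ Λ f x)) (sym (distribʳ x _ _))

    weighted-linear : ∀ {k} (Λ : Weights k) a f g → weighted Λ (λ i → a * f i + g i) ≈ a * weighted Λ f + weighted Λ g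
    weighted-linear []            a f g = sym (trans (+-identityʳ _) (zeroʳ a))
    weighted-linear ((w , i) ∷ Λ) a f g = begin
      w * (a * f i + g i) + weighted Λ (λ i → a * f i + g i)   ≈⟨ +-congˡ (weighted-linear Λ a f g) ⟩
      w * (a * f i + g i) + (a * weighted Λ f + weighted Λ g)  ≈⟨ split-sum w (a * f i) (g i) _ _ ⟩
      (w * (a * f i) + a * weighted Λ f) + (w * g i + weighted Λ g) ≈⟨ +-congʳ (scale-sum a w (f i) _) ⟩
      a * (w * f i + weighted Λ f) + (w * g i + weighted Λ g) ∎
      where open ≈-Reasoning

    weighted#0 : ∀ {k} (Λ : Weights k) f → weighted Λ f # 0# → ∃[ i ] f i # 0#
    weighted#0 []            f #0 = contradiction #0 0¬#0
    weighted#0 ((w , i) ∷ Λ) f #0 with +#0 #0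
    ... | inj₁ wf#0 = i , *#0ʳ wf#0
    ... | inj₂ Λ#0  = weighted#0 Λ f Λ#0

    module _ {k : ℕ} (s : Fin k → Carrier) where

      moment : Weights k → ℕ → Carrier
      moment Λ j = weighted Λ (λ i → s i ^ j)

      -- On polynomials of degree at most a, the functional is the coefficient of the a-th power.
      Extracts : ℕ → Weights k → Set ℓ₁
      Extracts a Λ = (∀ {j} → j ℕ.< a → moment Λ j ≈ 0#) × moment Λ a ≈ 1#

      module _ (apart : ∀ {i j} → i ≢ j → s i # s j) where

        total : Weights k → Carrier
        total []            = 0#
        total ((w , _) ∷ Λ) = w + total Λ

        -- Subtracting the value at `i₀` amounts to giving `i₀` the extra weight `- total Λ`, so a
        -- centred functional is again a combination of evaluations.
        centred : Fin k → Weights k → ℕ → Carrier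
        centred i₀ Λ j = weighted Λ (λ i → s i ^ j - s i₀ ^ j)

        centred≈ : ∀ i₀ Λ j → centred i₀ Λ j ≈ moment Λ j - total Λ * s i₀ ^ j
        centred≈ i₀ []            j = sym (trans (+-congˡ (trans (-‿cong (zeroˡ _)) -0#≈0#)) (+-identityˡ 0#))
        centred≈ i₀ ((w , i) ∷ Λ) j = trans (+-congˡ (centred≈ i₀ Λ j)) (sym (difference-form w _ _ _ _))

        centred-0 : ∀ i₀ Λ → centred i₀ Λ 0 ≈ 0#
        centred-0 i₀ []            = refl
        centred-0 i₀ ((w , i) ∷ Λ) = trans (+-cong (trans (*-congˡ (-‿inverseʳ 1#)) (zeroʳ w)) (centred-0 i₀ Λ)) (+-identityˡ 0#)

        -- Each weight is divided by s i - s₀, where s₀ is `s i₀`, so `centred i₀ Λ′ j` is `Λ`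
        -- applied to the quotient (x^j - s₀^j) / (x - s₀). The recurrence is x^(j+1) - s₀^(j+1) =
        -- (x - s₀) x^j + s₀ (x^j - s₀^j), divided by x - s₀.
        divide : ∀ i₀ {is} → i₀ ∉ is → ∀ Λ → All (λ t → proj₂ t ∈ is) Λ →
                 ∃[ Λ′ ] (All (λ t → proj₂ t ∈ is) Λ′ ×
                          (∀ j → centred i₀ Λ′ (suc j) ≈ moment Λ j + s i₀ * centred i₀ Λ′ j))
        divide i₀ i₀∉ []            []           = [] , [] , λ j → sym (trans (+-identityˡ _) (zeroʳ _))
        divide i₀ i₀∉ ((w , i) ∷ Λ) (i∈ ∷ Λ∈) with divide i₀ i₀∉ Λ Λ∈ | #⇒invertible (apart {i} {i₀} (λ { ≡.refl → i₀∉ i∈ }))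
        ... | Λ′ , Λ′∈ , eq | v , v*≈1 , _ = (w * v , i) ∷ Λ′ , i∈ ∷ Λ′∈ , λ j → begin
          w * v * (s i * s i ^ j - s i₀ * s i₀ ^ j) + centred i₀ Λ′ (suc j)
            ≈⟨ +-cong (factor-power w v (s i₀) (s i) (s i ^ j) (s i₀ ^ j)) (eq j) ⟩
          (v * (s i - s i₀) * (w * s i ^ j) + s i₀ * (w * v * (s i ^ j - s i₀ ^ j))) + (moment Λ j + s i₀ * centred i₀ Λ′ j)
            ≈⟨ +-congʳ (+-congʳ (trans (*-congʳ v*≈1) (*-identityˡ _))) ⟩
          (w * s i ^ j + s i₀ * (w * v * (s i ^ j - s i₀ ^ j))) + (moment Λ j + s i₀ * centred i₀ Λ′ j)
            ≈⟨ gather _ _ (s i₀) _ _ ⟩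
          (w * s i ^ j + moment Λ j) + s i₀ * (w * v * (s i ^ j - s i₀ ^ j) + centred i₀ Λ′ j) ∎
          where open ≈-Reasoning

        -- These are Newton's divided differences. Dividing by x - s₀ lowers degrees by one, so each
        -- additional point raises the extracted power by one.
        extracting : ∀ i₀ is → Unique (i₀ ∷ is) →
                     ∃[ Λ ] (All (λ t → proj₂ t ∈ i₀ ∷ is) Λ × Extracts (length is) Λ)
        extracting i₀ [] _ = (1# , i₀) ∷ [] , here ≡.refl ∷ [] , (λ ()) , trans (+-identityʳ _) (*-identityˡ 1#)
        extracting i₀ (i₁ ∷ is) (i₀∉ ∷ is!) with extracting i₁ is is!
        ... | Λ , Λ∈ , Λ<≈0 , Λ≈1 with divide i₀ (λ i₀∈ → All.lookup i₀∉ i₀∈ ≡.refl) Λ Λ∈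
        ...   | Λ′ , Λ′∈ , eq = (- total Λ′ , i₀) ∷ Λ′ , here ≡.refl ∷ All.map there Λ′∈ ,
          (λ {j} j< → trans (moment≈ j) (vanish j j<)) ,
          trans (moment≈ (suc (length is))) (trans (eq (length is)) (trans
            (+-cong Λ≈1 (trans (*-congˡ (vanish (length is) ℕₚ.≤-refl)) (zeroʳ _))) (+-identityʳ 1#)))
          where
          moment≈ : ∀ j → - total Λ′ * s i₀ ^ j + moment Λ′ j ≈ centred i₀ Λ′ j
          moment≈ j = trans (+-comm _ _) (trans (+-congˡ (sym (-‿distribˡ-* (total Λ′) _))) (sym (centred≈ i₀ Λ′ j)))
          vanish : ∀ j → j ℕ.< suc (length is) → centred i₀ Λ′ j ≈ 0#
          vanish zero    _        = centred-0 i₀ Λ′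
          vanish (suc j) (s≤s j<) = trans (eq j) (trans
            (+-cong (Λ<≈0 j<) (trans (*-congˡ (vanish j (ℕₚ.m≤n⇒m≤1+n j<))) (zeroʳ _))) (+-identityˡ 0#))

    -- Weights are put on the first a + 1 points: that many are needed to separate the a-th power
    -- from the lower ones.
    extractor : ∀ {k} (s : Fin k → Carrier) → (∀ {i j} → i ≢ j → s i # s j) → ∀ {a} → a ℕ.< k →
                ∃[ Λ ] Extracts s a Λ
    extractor {k} s apart {a} a<k = from (take (suc a) (allFin k))
      (≡.trans (length-take (suc a) (allFin k)) (≡.trans (≡.cong (suc a ℕ.⊓_) (length-tabulate (λ i → i))) (ℕₚ.m≤n⇒m⊓n≡m a<k)))
      (Uniqueₚ.take⁺ (suc a) (Uniqueₚ.allFin⁺ k))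
      where
      from : ∀ is → length is ≡ suc a → Unique is → ∃[ Λ ] Extracts s a Λ
      from (i₀ ∷ is) len is! = let (Λ , _ , extracts) = extracting s apart i₀ is is! in
        Λ , ≡.subst (λ a → Extracts s a Λ) (ℕₚ.suc-injective len) extracts

    cons : ∀ {k m} → Fin k → (Fin m → Fin k) → Fin (suc m) → Fin k
    cons i c zero    = i
    cons i c (suc e) = c e

    -- The tensor product of the functionals for the single variables.
    grid : ∀ {k m} → (Fin m → Weights k) → ((Fin m → Fin k) → Carrier) → Carrier
    grid {m = zero}  Λ f = f (λ ())
    grid {m = suc m} Λ f = weighted (Λ zero) (λ i → grid (Λ ∘ suc) (λ c → f (cons i c)))

    grid-linear : ∀ {k m} (Λ : Fin m → Weights k) a f g →
                  grid Λ (λ c → a * f c + g c) ≈ a * grid Λ f + grid Λ g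
    grid-linear {m = zero}  Λ a f g = refl
    grid-linear {m = suc m} Λ a f g = trans
      (weighted-cong (Λ zero) (λ i → grid-linear (Λ ∘ suc) a (λ c → f (cons i c)) (λ c → g (cons i c))))
      (weighted-linear (Λ zero) a (λ i → grid (Λ ∘ suc) (λ c → f (cons i c))) (λ i → grid (Λ ∘ suc) (λ c → g (cons i c))))

    grid-0 : ∀ {k m} (Λ : Fin m → Weights k) → grid Λ (λ _ → 0#) ≈ 0#
    grid-0 {m = zero}  Λ = refl
    grid-0 {m = suc m} Λ = trans (weighted-cong (Λ zero) (λ _ → grid-0 (Λ ∘ suc))) (zeros (Λ zero))
      where
      zeros : ∀ Λ → weighted Λ (λ _ → 0#) ≈ 0#
      zeros []            = refl
      zeros ((w , i) ∷ Λ) = trans (+-cong (zeroʳ w) (zeros Λ)) (+-identityˡ 0#)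

    grid#0 : ∀ {k m} (Λ : Fin m → Weights k) f → grid Λ f # 0# → ∃[ c ] f c # 0#
    grid#0 {m = zero}  Λ f #0 = (λ ()) , #0
    grid#0 {m = suc m} Λ f #0 with weighted#0 (Λ zero) _ #0
    ... | i , #0′ with grid#0 (Λ ∘ suc) (λ c → f (cons i c)) #0′
    ...   | c , fc#0 = cons i c , fc#0

    module _ {k : ℕ} where

      moments : ∀ {m} → (Fin m → Fin k → Carrier) → (Fin m → Weights k) → Vec ℕ m → Carrier
      moments L Λ []      = 1#
      moments L Λ (b ∷ β) = moment (L zero) (Λ zero) b * moments (L ∘ suc) (Λ ∘ suc) β

      grid-*ˡ : ∀ {m} (Λ : Fin m → Weights k) a f → grid Λ (λ c → a * f c) ≈ a * grid Λ f
      grid-*ˡ {m = zero}  Λ a f = refl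
      grid-*ˡ {m = suc m} Λ a f = trans
        (weighted-cong (Λ zero) (λ i → trans (grid-*ˡ (Λ ∘ suc) a (λ c → f (cons i c))) (*-comm a _)))
        (trans (weighted-*ʳ (Λ zero) (λ i → grid (Λ ∘ suc) (λ c → f (cons i c))) a) (*-comm _ a))

      grid-mono : ∀ {m} (L : Fin m → Fin k → Carrier) Λ β → grid Λ (λ c → mono β (λ e → L e (c e))) ≈ moments L Λ β
      grid-mono L Λ []      = refl
      grid-mono L Λ (b ∷ β) = trans
        (weighted-cong (Λ zero) (λ i → trans
          (grid-*ˡ (Λ ∘ suc) (L zero i ^ b) (λ c → mono β (λ e → L (suc e) (c e))))
          (*-congˡ (grid-mono (L ∘ suc) (Λ ∘ suc) β))))
        (weighted-*ʳ (Λ zero) (λ i → L zero i ^ b) _)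

      module _ {m : ℕ} (L : Fin m → Fin k → Carrier) (Λ : Fin m → Weights k) (α : Vec ℕ m)
               (extracts : ∀ e → Extracts (L e) (Vec.lookup α e) (Λ e)) where

        moments-≡ : moments L Λ α ≈ 1#
        moments-≡ = go L Λ α extracts
          where
          go : ∀ {m} (L : Fin m → Fin k → Carrier) Λ (α : Vec ℕ m) →
               (∀ e → Extracts (L e) (Vec.lookup α e) (Λ e)) → moments L Λ α ≈ 1#
          go L Λ []      ex = refl
          go L Λ (a ∷ α) ex = trans (*-cong (proj₂ (ex zero)) (go (L ∘ suc) (Λ ∘ suc) α (ex ∘ suc))) (*-identityˡ 1#)

        moments-< : ∀ β e → Vec.lookup β e ℕ.< Vec.lookup α e → moments L Λ β ≈ 0#
        moments-< β e β<α = go L Λ β e (proj₁ (extracts e) β<α)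
          where
          go : ∀ {m} (L : Fin m → Fin k → Carrier) Λ (β : Vec ℕ m) e →
               moment (L e) (Λ e) (Vec.lookup β e) ≈ 0# → moments L Λ β ≈ 0#
          go L Λ (b ∷ β) zero    ≈0 = trans (*-congʳ ≈0) (zeroˡ _)
          go L Λ (b ∷ β) (suc e) ≈0 = trans (*-congˡ (go (L ∘ suc) (Λ ∘ suc) β e ≈0)) (zeroʳ _)

        -- Among monomials of the same total degree, any one other than `α` has a smaller exponent
        -- than `α` in some variable, and the functional of that variable kills it.
        grid-eval : ∀ p → All (λ t → Vec.sum (proj₂ t) ≡ Vec.sum α) p →
                    grid Λ (λ c → eval p (λ e → L e (c e))) ≈ coeff p α
        grid-eval []            []            = grid-0 Λ
        grid-eval ((a , β) ∷ p) (Σβ ∷ Σp) = begin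
          grid Λ (λ c → a * mono β (λ e → L e (c e)) + eval p (λ e → L e (c e)))
            ≈⟨ grid-linear Λ a _ _ ⟩
          a * grid Λ (λ c → mono β (λ e → L e (c e))) + grid Λ (λ c → eval p (λ e → L e (c e)))
            ≈⟨ +-cong (*-congˡ (grid-mono L Λ β)) (grid-eval p Σp) ⟩
          a * moments L Λ β + coeff p α
            ≈⟨ +-congʳ (value (some-smaller β α (ℕₚ.≤-reflexive Σβ))) ⟩
          term a β α + coeff p α
            ≈⟨ sym (coeff-∷ a β p α) ⟩
          coeff ((a , β) ∷ p) α ∎
          where
          open ≈-Reasoning
          value : β ≡ α ⊎ ∃[ e ] Vec.lookup β e ℕ.< Vec.lookup α e → a * moments L Λ β ≈ term a β α
          value (inj₁ ≡.refl)    = trans (*-congˡ moments-≡) (trans (*-identityʳ a) (sym (term-≡ a α)))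
          value (inj₂ (e , β<α)) = trans (*-congˡ (moments-< β e β<α)) (trans (zeroʳ a)
            (sym (term-≢ a {α} {β} (λ { ≡.refl → ℕₚ.<-irrefl ≡.refl β<α }))))

      -- The coefficient is a weighted sum of values on the grid, and a finite sum apart from 0 has
      -- a summand apart from 0; the point is thus found constructively.
      nullstellensatz : ∀ {m} (p : Poly m) α → All (λ t → Vec.sum (proj₂ t) ≡ Vec.sum α) p → coeff p α # 0# →
        (L : Fin m → Fin k → Carrier) → (∀ e {i j} → i ≢ j → L e i # L e j) →
        (∀ e → Vec.lookup α e ℕ.< k) → ∃[ c ] eval p (λ e → L e (c e)) # 0#
      nullstellensatz p α Σp #0 L apart α<k = grid#0 Λ _
        (#-congʳ (sym (grid-eval L Λ α (λ e → proj₂ (extractor (L e) (apart e) (α<k e))) p Σp)) #0)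
        where
        Λ : ∀ e → Weights k
        Λ e = proj₁ (extractor (L e) (apart e) (α<k e))

-- From permanents to the monomial index and to choosability

module MonomialIndex where

  open import Defs
  open import Data.Bool.Base using (true; false)
  import Data.Nat.Properties as ℕₚ
  open import Data.Fin.Base using (Fin; zero; suc)
  open import Data.Integer.Base as ℤ using (ℤ; 0ℤ; 1ℤ)
  import Data.Integer.Properties as ℤₚ
  open import Data.Integer.Tactic.RingSolver using (solve-∀)
  open import Data.List.Base using (List; []; _∷_; map; foldr; filter; length; allFin)
  open import Data.List.Membership.Propositional using (_∈_; _∉_)
  open import Data.List.Membership.Propositional.Properties using (∈-map⁺; ∈-filter⁺; ∈-allFin)
  open import Data.List.Properties using (map-∘)
  open import Data.List.Relation.Binary.Pointwise.Base using (Pointwise; []; _∷_)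
  open import Data.List.Relation.Unary.All as All using (All; []; _∷_)
  import Data.List.Relation.Unary.All.Properties as Allₚ
  open import Data.List.Relation.Unary.AllPairs using ([]; _∷_)
  open import Data.List.Relation.Unary.Any using (here; there)
  open import Data.List.Relation.Unary.Unique.Propositional using (Unique)
  open import Data.Nat.Base as ℕ using (ℕ; zero; suc; _≤_; s≤s)
  open import Data.Product.Base using (∃-syntax; _×_; _,_; proj₁; proj₂)
  open import Data.Sum.Base using (inj₁; inj₂)
  open import Data.Vec.Base as Vec using (Vec; []; _∷_)
  open import Function.Base using (_∘_)
  open import Relation.Binary.PropositionalEquality as ≡ using (_≡_; _≢_)
  open import Relation.Nullary.Decidable using (Dec; yes; no; ¬?)
  open import Relation.Nullary.Negation using (contradiction)
  open import Data.List.Extrema ℕₚ.≤-totalOrder using (argmin; argmin-all; f[argmin]≤f[xs]; f[argmin]≤f[⊤])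
  open Permanents hiding (Choice)
  open Coefficients
  open Lists
  open EdgeColumns
  open GraphEdgeColumns
  open RealField
  open FormalPolynomials
  open CombinatorialNullstellensatz

  expand-map : ∀ {A B : Set} (g : A → B) r cs (k : List (Column {B}) → ℤ) k′ →
               (∀ es → k es ≡ k′ (map (_∘ g) es)) → expand (g r) cs k ≡ expand r (map (_∘ g) cs) k′
  expand-map g r []       k k′ k≗ = ≡.refl
  expand-map g r (c ∷ cs) k k′ k≗ = ≡.cong₂ ℤ._+_ (≡.cong (c (g r) ℤ.*_) (k≗ cs))
    (expand-map g r cs (k ∘ (c ∷_)) (k′ ∘ ((c ∘ g) ∷_)) (λ es → k≗ (c ∷ es)))

  -- Allows the rows to be indexed by edges, as in the combinatorial part, instead of by their
  -- linear forms.
  per-map : ∀ {A B : Set} (g : A → B) rs cs → per (map g rs) cs ≡ per rs (map (_∘ g) cs)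
  per-map g []       []       = ≡.refl
  per-map g []       (_ ∷ _)  = ≡.refl
  per-map g (r ∷ rs) cs       = expand-map g r cs (per (map g rs)) (per rs) (per-map g rs)

  sumOver-δ-∉ : ∀ {m} {c : Fin m} is → c ∉ is → sumOver is (λ i → δ i c) ≡ 0ℤ
  sumOver-δ-∉ []       c∉ = ≡.refl
  sumOver-δ-∉ (i ∷ is) c∉ = ≡.cong₂ ℤ._+_ (δ-≢ {i = i} (c∉ ∘ here ∘ ≡.sym)) (sumOver-δ-∉ is (c∉ ∘ there))

  sumOver-δ-∈ : ∀ {m} {c : Fin m} {is} → Unique is → c ∈ is → sumOver is (λ i → δ i c) ≡ 1ℤ
  sumOver-δ-∈ {is = i ∷ is} (i∉ ∷ _) (here ≡.refl) =
    ≡.cong₂ ℤ._+_ (δ-refl i) (sumOver-δ-∉ is (λ i∈ → All.lookup i∉ i∈ ≡.refl))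
  sumOver-δ-∈ {is = i ∷ is} (i∉ ∷ is!) (there c∈) =
    ≡.cong₂ ℤ._+_ (δ-≢ {i = i} (λ { ≡.refl → All.lookup i∉ c∈ ≡.refl })) (sumOver-δ-∈ is! c∈)

  shift-scale : ∀ {m} (i : Fin m) s {p q : Vec ℕ m → ℤ} → (∀ α → p α ≡ s ℤ.* q α) →
                ∀ α → shift 0ℤ i p α ≡ s ℤ.* shift 0ℤ i q α
  shift-scale zero    s p≡ (zero  ∷ α) = ≡.sym (ℤₚ.*-zeroʳ s)
  shift-scale zero    s p≡ (suc a ∷ α) = p≡ (a ∷ α)
  shift-scale (suc i) s p≡ (a     ∷ α) = shift-scale i s (p≡ ∘ (a ∷_)) α

  sumOver-scale : ∀ {m} (is : List (Fin m)) s {f g} → (∀ i → f i ≡ s ℤ.* g i) →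
                  sumOver is f ≡ s ℤ.* sumOver is g
  sumOver-scale []       s f≡ = ≡.sym (ℤₚ.*-zeroʳ s)
  sumOver-scale (i ∷ is) s f≡ = ≡.trans (≡.cong₂ ℤ._+_ (f≡ i) (sumOver-scale is s f≡)) (≡.sym (ℤₚ.*-distribˡ-+ s _ _))

  sum-+ : ∀ {m} (α β : Vec ℕ m) → Vec.sum (Vec.zipWith ℕ._+_ α β) ≡ Vec.sum α ℕ.+ Vec.sum β
  sum-+ []      []      = ≡.refl
  sum-+ (a ∷ α) (b ∷ β) = ≡.trans (≡.cong (a ℕ.+ b ℕ.+_) (sum-+ α β)) (lemma a b (Vec.sum α) (Vec.sum β))
    where
    open import Data.Nat.Solver using (module +-*-Solver)
    open +-*-Solver
    lemma : ∀ a b x y → a ℕ.+ b ℕ.+ (x ℕ.+ y) ≡ a ℕ.+ x ℕ.+ (b ℕ.+ y)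
    lemma = solve 4 (λ a b x y → a :+ b :+ (x :+ y) := a :+ x :+ (b :+ y)) ≡.refl

  sum-0 : ∀ m → Vec.sum (Vec.replicate m 0) ≡ 0
  sum-0 zero    = ≡.refl
  sum-0 (suc m) = sum-0 m

  sum-unitVec : ∀ {m} (i : Fin m) → Vec.sum (unitVec i) ≡ 1
  sum-unitVec {suc m} zero = ≡.cong suc (sum-0 m)
  sum-unitVec (suc i)      = sum-unitVec i

  module _ {c ℓ₁ ℓ₂ ℓ₃} (ℝ : RealNumbers c ℓ₁ ℓ₂ ℓ₃) where

    open Field ℝ
    open Polynomials ℝ
    open Nullstellensatz ℝ

    Homogeneous : ∀ {m} → ℕ → Poly m → Set c
    Homogeneous d = All (λ t → Vec.sum (proj₂ t) ≡ d)

    homogeneous-⊛ : ∀ {m d e} {p q : Poly m} → Homogeneous d p → Homogeneous e q → Homogeneous (d ℕ.+ e) (p ⊛ q)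
    homogeneous-⊛ []         hq = []
    homogeneous-⊛ {p = (_ , β) ∷ _} (hβ ∷ hp) hq = Allₚ.++⁺
      (Allₚ.map⁺ (All.map (λ {t} ht → ≡.trans (sum-+ β (proj₂ t)) (≡.cong₂ ℕ._+_ hβ ht)) hq))
      (homogeneous-⊛ hp hq)

    module _ {m : ℕ} where

      homogeneous-sumVars : ∀ (is : List (Fin m)) → Homogeneous 1 (sumVars is)
      homogeneous-sumVars []       = []
      homogeneous-sumVars (i ∷ is) = sum-unitVec i ∷ homogeneous-sumVars is

      homogeneous-product : ∀ (ℓs : List Form) → Homogeneous {m} (length ℓs) (productOf ℓs)
      homogeneous-product []               = sum-0 m ∷ []
      homogeneous-product ((ps , ns) ∷ ℓs) = homogeneous-⊛ {d = 1} {p = factorOf (ps , ns)}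
        (Allₚ.++⁺ (homogeneous-sumVars ps) (Allₚ.map⁺ (homogeneous-sumVars ns)))
        (homogeneous-product ℓs)

      sumAt : (Fin m → Carrier) → List (Fin m) → Carrier
      sumAt x is = foldr _+_ 0# (map x is)

      eval-sumVars : ∀ is x → eval (sumVars is) x ≈ sumAt x is
      eval-sumVars []       x = refl
      eval-sumVars (i ∷ is) x = +-cong (trans (*-identityˡ _) (mono-unitVec i x)) (eval-sumVars is x)

      eval-factor : ∀ ps ns x → eval (factorOf (ps , ns)) x ≈ sumAt x ps - sumAt x ns
      eval-factor ps ns x = trans (eval-++ (sumVars ps) (negate (sumVars ns)) x)
        (+-cong (eval-sumVars ps x) (trans (eval-negate (sumVars ns) x) (-‿cong (eval-sumVars ns x))))

      eval-product#0 : ∀ {ℓ : Form {m}} {ℓs} x → eval (productOf ℓs) x # 0# → ℓ ∈ ℓs → eval (factorOf ℓ) x # 0#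
      eval-product#0 {ℓs = ℓ ∷ ℓs} x #0 ℓ∈ with #-congʳ (eval-⊛ (factorOf ℓ) (productOf ℓs) x) #0 | ℓ∈
      ... | #0′ | here ≡.refl = *#0ˡ #0′
      ... | #0′ | there ℓ∈ℓs  = eval-product#0 x (*#0ʳ #0′) ℓ∈ℓs

    x-y#0⇒x#y : ∀ {x y} → x - y # 0# → x # y
    x-y#0⇒x#y {x} {y} #0 with #⇒invertible #0
    ... | i , i*≈1 , _ = invertibleˡ⇒# (i , trans (*-congˡ (sym (x-0≈x (x - y)))) i*≈1)

    module _ {n : ℕ} (G : Graph n) where

      open Graph G using (Adj; Edge; Orientation; arc; ends; size; incidentEdges)
      open GraphEdges G
      open Edges ends
      open Simple loopless simple

      formOf : Orientation → Edge → Form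
      formOf D e = incidentEdges (proj₂ (arc D e)) , incidentEdges (proj₁ (arc D e))

      forms : Orientation → List Form
      forms D = map (formOf D) (allFin size)

      D₀ : Orientation
      D₀ _ = true

      graphPolynomial≡ : ∀ D → graphPolynomial ℝ G D ≡ productOf (forms D)
      graphPolynomial≡ D = ≡.cong (foldr _⊛_ (1ᵖ ℝ)) (map-∘ (allFin size))

      coeff-graph : ∀ D α → coeff (graphPolynomial ℝ G D) α ≈ ι (coefs (forms D) α)
      coeff-graph D α = trans (reflexive (≡.cong (λ p → coeff p α) (graphPolynomial≡ D))) (coeff-product (forms D) α)

      -- Reversing an arc negates its factor, so `s` is 1 or -1; it suffices to record that it is
      -- not 0.
      reorient : ∀ D es → ∃[ s ] (s ≢ 0ℤ × ∀ α → coefs (map (formOf D) es) α ≡ s ℤ.* coefs (map (formOf D₀) es) α)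
      reorient D []       = 1ℤ , (λ ()) , λ α → ≡.sym (ℤₚ.*-identityˡ _)
      reorient D (e ∷ es) with D e | reorient D es
      ... | true  | s , s≢0 , eq = s , s≢0 , λ α → ≡.trans
        (≡.cong₂ ℤ._-_ (sumOver-scale (incidentEdges (head e)) s (λ i → shift-scale i s eq α))
                       (sumOver-scale (incidentEdges (tail e)) s (λ i → shift-scale i s eq α)))
        (lemma s (at (head e) α) (at (tail e) α))
        where
        at : Fin n → Vec ℕ size → ℤ
        at x α = sumOver (incidentEdges x) (λ i → shift 0ℤ i (coefs (map (formOf D₀) es)) α)
        lemma : ∀ s x y → s ℤ.* x ℤ.- s ℤ.* y ≡ s ℤ.* (x ℤ.- y)
        lemma = solve-∀
      ... | false | s , s≢0 , eq = ℤ.- s , -x≢0 s≢0 , λ α → ≡.trans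
        (≡.cong₂ ℤ._-_ (sumOver-scale (incidentEdges (tail e)) s (λ i → shift-scale i s eq α))
                       (sumOver-scale (incidentEdges (head e)) s (λ i → shift-scale i s eq α)))
        (lemma s (at (head e) α) (at (tail e) α))
        where
        at : Fin n → Vec ℕ size → ℤ
        at x α = sumOver (incidentEdges x) (λ i → shift 0ℤ i (coefs (map (formOf D₀) es)) α)
        lemma : ∀ s x y → s ℤ.* y ℤ.- s ℤ.* x ≡ ℤ.- s ℤ.* (x ℤ.- y)
        lemma = solve-∀

      -- A decidable condition on integers, equivalent for every orientation to the real coefficient
      -- being apart from 0.
      Occurs : Vec ℕ size → Set
      Occurs α = coefs (forms D₀) α ≢ 0ℤ

      occurs⇒coeff#0 : ∀ D {α} → Occurs α → coeff (graphPolynomial ℝ G D) α # 0#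
      occurs⇒coeff#0 D {α} occ with reorient D (allFin size)
      ... | s , s≢0 , eq = #-congʳ (sym (coeff-graph D α)) (ι#0 (i*j≢0 s≢0 occ ∘ ≡.trans (≡.sym (eq α))))

      coeff#0⇒occurs : ∀ D {α} → coeff (graphPolynomial ℝ G D) α # 0# → Occurs α
      coeff#0⇒occurs D {α} #0 ≡0 with reorient D (allFin size)
      ... | s , s≢0 , eq = ι#0⇒≢0 (#-congʳ (coeff-graph D α) #0)
        (≡.trans (eq α) (≡.trans (≡.cong (s ℤ.*_) ≡0) (ℤₚ.*-zeroʳ s)))

      sumOver-incident : ∀ x c → sumOver (incidentEdges x) (λ i → δ i c) ≡ δ (tail c) x ℤ.+ δ (head c) x
      sumOver-incident x c with touch? x c
      ... | yes x∈c@(inj₁ ≡.refl) = ≡.trans (sumOver-δ-∈ (rowsOf! (touch? x)) (∈-rowsOf⁺ (touch? x) x∈c))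
        (≡.sym (≡.cong₂ ℤ._+_ (δ-refl x) (δ-≢ (loopless c ∘ ≡.sym))))
      ... | yes x∈c@(inj₂ ≡.refl) = ≡.trans (sumOver-δ-∈ (rowsOf! (touch? x)) (∈-rowsOf⁺ (touch? x) x∈c))
        (≡.sym (≡.cong₂ ℤ._+_ (δ-≢ (loopless c)) (δ-refl x)))
      ... | no x∉c = ≡.trans (sumOver-δ-∉ (incidentEdges x) (x∉c ∘ ∈-rowsOf⁻ (touch? x)))
        (≡.sym (≡.cong₂ ℤ._+_ (δ-≢ (x∉c ∘ inj₁)) (δ-≢ (x∉c ∘ inj₂))))

      col≡colE : ∀ c e → col c (formOf D₀ e) ≡ colE c e
      col≡colE c e = ≡.cong₂ ℤ._-_ (sumOver-incident (head e) c) (sumOver-incident (tail e) c)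

      per-forms : ∀ cs → per (forms D₀) (map col cs) ≡ per (allFin size) (map colE cs)
      per-forms cs = ≡.trans (per-map (formOf D₀) (allFin size) (map col cs)) (per-cong (allFin size) (agree cs))
        where
        agree : ∀ cs → Pointwise (AgreeOn (allFin size)) (map (_∘ formOf D₀) (map col cs)) (map colE cs)
        agree []       = []
        agree (c ∷ cs) = All.universal (col≡colE c) (allFin size) ∷ agree cs

      low-monomial : Nice G → ∃[ α ] (Occurs α × ∀ e → Vec.lookup α e ≤ ∂₂ G)
      low-monomial nice with bounded-permanent-∂₂ nice
      ... | cs , count≤ , per≢0 = foldr raise 0̂ cs ,
        per≢0⇒coefs≢0 (forms D₀) cs (per≢0 ∘ ≡.trans (≡.sym (per-forms cs))) ,
        λ e → ≡.subst (_≤ ∂₂ G) (≡.sym (lookup-foldr-raise cs e)) (count≤ e)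

      occurs? : ∀ α → Dec (Occurs α)
      occurs? α = ¬? (coefs (forms D₀) α ℤₚ.≟ 0ℤ)

      module LeastMonomial (α₀ : Vec ℕ size) (occurs₀ : Occurs α₀) where

        h : Vec ℕ size → ℕ
        h = largestExponent ℝ

        -- Every occurring monomial is among the terms of the formal product, so the minimum runs
        -- over a finite list; the filter discards exponent vectors whose terms cancel. The given
        -- `α₀` is the initial value of the search.
        candidates : List (Vec ℕ size)
        candidates = filter occurs? (map proj₂ (graphPolynomial ℝ G D₀))

        least : Vec ℕ size
        least = argmin h α₀ candidates

        occurs-least : Occurs least
        occurs-least = argmin-all h {P = Occurs} occurs₀ (Allₚ.all-filter occurs? (map proj₂ (graphPolynomial ℝ G D₀)))

        least≤₀ : h least ≤ h α₀
        least≤₀ = f[argmin]≤f[⊤] {f = h} α₀ candidates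

        least≤ : ∀ {α} → Occurs α → h least ≤ h α
        least≤ {α} occ = All.lookup {P = λ β → h least ≤ h β} (f[argmin]≤f[xs] {f = h} α₀ candidates)
          (∈-filter⁺ occurs? (∈-map⁺ proj₂ (proj₂ (coeff#0⇒∈ (graphPolynomial ℝ G D₀) (occurs⇒coeff#0 D₀ occ)))) occ)

        isMind : IsMind ℝ G (h least)
        isMind D = (least , occurs⇒coeff#0 D occurs-least , ≡.refl) , λ α #0 → least≤ (coeff#0⇒occurs D #0)

      mind≤ : Nice G → ∃[ k ] (IsMind ℝ G k × k ≤ ∂₂ G)
      mind≤ nice = let (α₀ , occurs₀ , α₀≤) = low-monomial nice
                       open LeastMonomial α₀ occurs₀ in
        h least , isMind , ℕₚ.≤-trans least≤₀ (largest≤ α₀ α₀≤)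

      sumEnds : (Edge → Carrier) → Fin n → Carrier
      sumEnds x v = sumAt x (incidentEdges v)

      eval#0⇒proper : ∀ x → eval (productOf (forms D₀)) x # 0# → ∀ {u v} → Adj u v → sumEnds x u # sumEnds x v
      eval#0⇒proper x #0 uv = proper uv (edge uv)
        where
        ends-differ : ∀ e → sumEnds x (head e) # sumEnds x (tail e)
        ends-differ e = x-y#0⇒x#y (#-congʳ (eval-factor (incidentEdges (head e)) (incidentEdges (tail e)) x)
          (eval-product#0 x #0 (∈-map⁺ (formOf D₀) (∈-allFin e))))
        proper : ∀ {u v} → Adj u v → ∃[ e ] (Touch u e × Touch v e) → sumEnds x u # sumEnds x v
        proper uv (e , inj₁ ≡.refl , inj₂ ≡.refl) = #-sym (ends-differ e)
        proper uv (e , inj₂ ≡.refl , inj₁ ≡.refl) = ends-differ e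
        proper uv (e , inj₁ ≡.refl , inj₁ ≡.refl) = contradiction uv (Graph.irrefl G)
        proper uv (e , inj₂ ≡.refl , inj₂ ≡.refl) = contradiction uv (Graph.irrefl G)

      occurs⇒choosable : ∀ {α k} → Occurs α → (∀ e → Vec.lookup α e ℕ.< k) → Choosable ℝ G k
      occurs⇒choosable {α} {k} occ α<k L apart = proj₁ point ,
        λ {u} {v} → eval#0⇒proper (λ e → L e (proj₁ point e)) (proj₂ point) {u} {v}
        where
        p : Poly size
        p = productOf (forms D₀)
        #0 : coeff p α # 0#
        #0 = #-congʳ (sym (coeff-product (forms D₀) α)) (ι#0 occ)
        -- All terms have the number of edges as their degree, and `α` is one of them because its
        -- coefficient is not 0.
        Σα : Vec.sum α ≡ length (forms D₀)
        Σα = All.lookup (homogeneous-product (forms D₀)) (proj₂ (coeff#0⇒∈ p #0))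
        point : ∃[ c ] eval p (λ e → L e (c e)) # 0#
        point = nullstellensatz p α
          (All.map (λ eq → ≡.trans eq (≡.sym Σα)) (homogeneous-product (forms D₀))) #0 L (λ e → apart e) α<k

      choosable : Nice G → Choosable ℝ G (∂₂ G ℕ.+ 1)
      choosable nice = let (α₀ , occurs₀ , α₀≤) = low-monomial nice in
        -- The additional 1 comes from the Nullstellensatz, where an exponent must be smaller than
        -- the size of the list.
        occurs⇒choosable occurs₀ (λ e → ≡.subst (Vec.lookup α₀ e ℕ.<_) (ℕₚ.+-comm 1 (∂₂ G)) (s≤s (α₀≤ e)))

open import Defs
open import Data.Nat.Base using (ℕ; _≤_; _+_)
open import Data.Product.Base using (∃-syntax; _×_; _,_)
import Data.Nat.Properties as ℕₚ
open MonomialIndex using (mind≤; choosable)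

theorem4p1 : ∀ {c ℓ₁ ℓ₂ ℓ₃} (ℝ : RealNumbers c ℓ₁ ℓ₂ ℓ₃) →
    ∀ {n : ℕ} (G : Graph n) → 3 ≤ n → Nice G →
    (∃[ k ] (IsMind ℝ G k × k ≤ ∂₂ G)) × Ch≤ ℝ G (∂₂ G + 1)
theorem4p1 ℝ G _ nice =
  mind≤ ℝ G nice , (∂₂ G + 1 , ℕₚ.m≤n+m 1 (∂₂ G) , ℕₚ.≤-refl , choosable ℝ G nice)
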